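{- Let $k\ge 1$ and $n\ge 1$ be integers and let $\mathcal{M}=([n],\{\chi,-\chi\})$ be a degree-$k$ uniform oriented matroid on the ground set $[n]=\{1,\dots,n\}$ (with its usual order). Then there exists a $k$-intersecting pseudoconfiguration of points $PP=(P,L)$ in general position, with $P=\{p_1,\dots,p_n\}$ and $x(p_1)<\cdots<x(p_n)$, such that $\mathcal{M}=\mathcal{M}_{PP}$, i.e. $\{\chi,-\chi\}=\{\chi_{PP},-\chi_{PP}\}$.
   Context: **Notation.** For a finite ordered set $S$ and a positive integer $r$, $\Lambda(S,r)=\{(\lambda_1,\dots,\lambda_r)\in S^r : \lambda_1<\cdots<\lambda_r\}$. For $\lambda\in\Lambda(S,r)$, $\bar\lambda=\{\lambda_1,\dots,\lambda_r\}$, and $\lambda\setminus\{\lambda_i\}$ is $\lambda$ with the entry $\lambda_i$ deleted. $x(p)$ is the $x$-coordinate of a point $p\in\mathbb{R}^2$. **Oriented matroids.** For a finite set $E$, a map $\chi:E^r\to\{+1,-1,0\}$ is a chirotope of rank $r$ if (B1) $\chi$ is not identically zero; (B2) $\chi(i_{\sigma(1)},\dots,i_{\sigma(r)})=\mathrm{sgn}(\sigma)\chi(i_1,\dots,i_r)$ for all $i_1,\dots,i_r\in E$ and all permutations $\sigma$ of $[r]$; (B3) for all $\lambda,\mu\in E^r$, the set $\{ -\chi(\lambda)\chi(\mu)\}\cup\{\chi(\lambda[\lambda_1|\mu_s])\,\chi(\mu[\mu_s|\lambda_1]) : s=1,\dots,r\}$ either contains $\{+1,-1\}$ or equals $\{0\}$,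 where $\lambda[\lambda_i|a]$ is $\lambda$ with its $i$-th entry replaced by $a$. The pair $(E,\{\chi,-\chi\})$ is then an oriented matroid of rank $r$; it is uniform if $\chi(\lambda)\ne 0$ for all $\lambda\in\Lambda(E,r)$ (for some, equivalently any, linear order on $E$). **Degree-$k$ uniform oriented matroids.** Let $E$ be a finite ordered set. A uniform oriented matroid $(E,\{\chi,-\chi\})$ of rank $k+2$ is a degree-$k$ uniform oriented matroid if for every $\lambda\in\Lambda(E,k+3)$ and all $a<b<c$ in $\bar\lambda$, setting $\mu_1=\lambda\setminus\{c\}$, $\mu_2=\lambda\setminus\{b\}$, $\mu_3=\lambda\setminus\{a\}$ (so $\mu_1<\mu_2<\mu_3$ lexicographically), one has: if $\chi(\mu_1)=-\chi(\mu_2)$, then $\chi(\mu_3)=\chi(\mu_2)$. **$k$-intersecting pseudoconfigurations of points.** An $x$-monotone Jordan curve is a set $l=\{(x,f(x)):x\in\mathbb{R}\}$ with $f:\mathbb{R}\to\mathbb{R}$ continuous; put $l^+=\{(x,y):y>f(x)\}$ and $l^-=\{(x,y):y<f(x)\}$. A pair $PP=(P,L)$ of a point set $P=\{p_1,\dots,p_n\}\subset\mathbb{R}^2$ with $x(p_1)<\cdots<x(p_n)$ and a collection $L$ of $x$-monotone Jordan curves is a $k$-intersecting pseudoconfiguration of points if: (PP1) every $l\in L$ contains at least $k+1$ points of $P$; (PP2) for any $k+1$ points of $P$ there is a unique $l\in L$ passing through all of them; (PP3) any two distinct $l_1,l_2\in L$ intersect at most $k$ times, each intersection being transversal (at each common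 point the two curves exchange their above-below order). It is in general position if $|P\cap l|=k+1$ for all $l\in L$; then $l_{i_1,\dots,i_{k+1}}$ denotes the curve of $L$ through $p_{i_1},\dots,p_{i_{k+1}}$. **The map $\chi_{PP}$.** For $PP$ in general position, $\chi_{PP}:[n]^{k+2}\to\{+1,-1,0\}$ is the (well-defined) map such that: for $\lambda_1<\cdots<\lambda_{k+1}$ and $\lambda_{k+2}\notin\{\lambda_1,\dots,\lambda_{k+1}\}$, $\chi_{PP}(\lambda_1,\dots,\lambda_{k+2})=+1$ if $p_{\lambda_{k+2}}\in l^+_{\lambda_1,\dots,\lambda_{k+1}}$ and $-1$ if $p_{\lambda_{k+2}}\in l^-_{\lambda_1,\dots,\lambda_{k+1}}$; $\chi_{PP}$ is $0$ on tuples with a repeated entry; and $\chi_{PP}(\lambda_{\sigma(1)},\dots,\lambda_{\sigma(k+2)})=\mathrm{sgn}(\sigma)\chi_{PP}(\lambda_1,\dots,\lambda_{k+2})$ for every permutation $\sigma$ of $[k+2]$. $\mathcal{M}_{PP}$ denotes $([n],\{\chi_{PP},-\chi_{PP}\})$. -}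

module Defs where

open import Level using (0ℓ)
open import Data.Nat as ℕ using (ℕ; zero; suc)
import Data.Nat.Properties as ℕₚ
open import Data.Fin as Fin using (Fin; zero; suc)
import Data.Fin.Properties as Finₚ
open import Data.Fin.Permutation using (Permutation′; _⟨$⟩ʳ_)
open import Data.List as List using (List)
open import Data.Vec as Vec using (Vec; lookup; tabulate; removeAt; _[_]≔_; _∷ʳ_)
open import Data.Vec.Membership.Propositional using (_∈_; _∉_)
open import Data.Vec.Relation.Unary.All using (All)
open import Data.Vec.Relation.Unary.Linked using (Linked)
open import Data.Rational as ℚ using (ℚ; 0ℚ; ½)
import Data.Rational.Properties as ℚₚ
open import Data.Rational.Solver using (module +-*-Solver)
open import Data.Product using (_×_; _,_; ∃; ∃₂; proj₁; proj₂)
open import Data.Sum using (_⊎_; inj₁; inj₂)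
open import Function.Bundles using (Func; _⇔_)
open import Relation.Binary.Bundles using (Setoid)
open import Relation.Binary.PropositionalEquality
  using (_≡_; _≢_; _≗_; refl; sym; trans; cong; cong₂; subst; subst₂)
open import Relation.Nullary using (¬_)
open import Relation.Nullary.Decidable using (_×-dec_)
open import Relation.Unary using (Pred)

------------------------------------------------------------------------
-- Auxiliary facts about ℚ

private

  Eventually : (ℕ → Set) → Set
  Eventually P = ∃ λ N → ∀ n → N ℕ.≤ n → P n

  half>0 : ∀ {ε} → 0ℚ ℚ.< ε → 0ℚ ℚ.< ½ ℚ.* ε
  half>0 {ε} ε>0 =
    subst (ℚ._< ½ ℚ.* ε) (ℚₚ.*-zeroʳ ½) (ℚₚ.*-monoʳ-<-pos ½ ε>0)

  halves : ∀ ε → ½ ℚ.* ε ℚ.+ ½ ℚ.* ε ≡ ε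
  halves ε = trans (sym (ℚₚ.*-distribʳ-+ ε ½ ½)) (ℚₚ.*-identityˡ ε)

  -- u ≤ v + w with v, w < ε / 2 gives u < ε.
  ≤-halves : ∀ {u v w} ε → u ℚ.≤ v ℚ.+ w → v ℚ.< ½ ℚ.* ε → w ℚ.< ½ ℚ.* ε → u ℚ.< ε
  ≤-halves ε u≤ v< w< =
    ℚₚ.≤-<-trans u≤ (subst (_ ℚ.<_) (halves ε) (ℚₚ.+-mono-< v< w<))

  ∣-∣-sym : ∀ p q → ℚ.∣ p ℚ.- q ∣ ≡ ℚ.∣ q ℚ.- p ∣
  ∣-∣-sym p q = trans (sym (ℚₚ.∣-p∣≡∣p∣ (p ℚ.- q))) (cong ℚ.∣_∣ (lemma p q))
    where
    open +-*-Solver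
    lemma : ∀ p q → ℚ.- (p ℚ.- q) ≡ q ℚ.- p
    lemma = solve 2 (λ p q → :- (p :- q) := q :- p) refl

  triangle : ∀ p q r → ℚ.∣ p ℚ.- r ∣ ℚ.≤ ℚ.∣ p ℚ.- q ∣ ℚ.+ ℚ.∣ q ℚ.- r ∣
  triangle p q r =
    subst (λ z → ℚ.∣ z ∣ ℚ.≤ ℚ.∣ p ℚ.- q ∣ ℚ.+ ℚ.∣ q ℚ.- r ∣) (lemma p q r)
      (ℚₚ.∣p+q∣≤∣p∣+∣q∣ (p ℚ.- q) (q ℚ.- r))
    where
    open +-*-Solver
    lemma : ∀ p q r → (p ℚ.- q) ℚ.+ (q ℚ.- r) ≡ p ℚ.- r
    lemma = solve 3 (λ p q r → (p :- q) :+ (q :- r) := p :- r) refl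

  ∣-∣-minus : ∀ p q r s →
    ℚ.∣ (p ℚ.- q) ℚ.- (r ℚ.- s) ∣ ℚ.≤ ℚ.∣ p ℚ.- r ∣ ℚ.+ ℚ.∣ q ℚ.- s ∣
  ∣-∣-minus p q r s =
    subst (λ z → ℚ.∣ z ∣ ℚ.≤ ℚ.∣ p ℚ.- r ∣ ℚ.+ ℚ.∣ q ℚ.- s ∣) (lemma p q r s)
      (ℚₚ.∣p-q∣≤∣p∣+∣q∣ (p ℚ.- r) (q ℚ.- s))
    where
    open +-*-Solver
    lemma : ∀ p q r s → (p ℚ.- r) ℚ.- (q ℚ.- s) ≡ (p ℚ.- q) ℚ.- (r ℚ.- s)
    lemma = solve 4 (λ p q r s → (p :- r) :- (q :- s) := (p :- q) :- (r :- s)) refl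

  ∣∣-∣∣-≤ : ∀ p q → ℚ.∣ p ∣ ℚ.- ℚ.∣ q ∣ ℚ.≤ ℚ.∣ p ℚ.- q ∣
  ∣∣-∣∣-≤ p q =
    subst (ℚ.∣ p ∣ ℚ.- ℚ.∣ q ∣ ℚ.≤_) (cancel ℚ.∣ p ℚ.- q ∣ ℚ.∣ q ∣)
      (ℚₚ.+-monoˡ-≤ (ℚ.- ℚ.∣ q ∣)
        (subst (λ z → ℚ.∣ z ∣ ℚ.≤ ℚ.∣ p ℚ.- q ∣ ℚ.+ ℚ.∣ q ∣) (lemma p q)
          (ℚₚ.∣p+q∣≤∣p∣+∣q∣ (p ℚ.- q) q)))
    where
    open +-*-Solver
    lemma : ∀ p q → (p ℚ.- q) ℚ.+ q ≡ p
    lemma = solve 2 (λ p q → (p :- q) :+ q := p) refl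
    cancel : ∀ p q → (p ℚ.+ q) ℚ.- q ≡ p
    cancel = solve 2 (λ p q → (p :+ q) :- q := p) refl

  ∣∣∣-∣∣∣-≤ : ∀ p q → ℚ.∣ ℚ.∣ p ∣ ℚ.- ℚ.∣ q ∣ ∣ ℚ.≤ ℚ.∣ p ℚ.- q ∣
  ∣∣∣-∣∣∣-≤ p q with ℚₚ.∣p∣≡p∨∣p∣≡-p (ℚ.∣ p ∣ ℚ.- ℚ.∣ q ∣)
  ... | inj₁ eq = subst (ℚ._≤ ℚ.∣ p ℚ.- q ∣) (sym eq) (∣∣-∣∣-≤ p q)
  ... | inj₂ eq =
    subst₂ ℚ._≤_ (sym (trans eq (lemma ℚ.∣ p ∣ ℚ.∣ q ∣))) (∣-∣-sym q p) (∣∣-∣∣-≤ q p)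
    where
    open +-*-Solver
    lemma : ∀ p q → ℚ.- (p ℚ.- q) ≡ q ℚ.- p
    lemma = solve 2 (λ p q → :- (p :- q) := q :- p) refl

  ∣p-p∣≡0 : ∀ p → ℚ.∣ p ℚ.- p ∣ ≡ 0ℚ
  ∣p-p∣≡0 p = cong ℚ.∣_∣ (ℚₚ.+-inverseʳ p)

------------------------------------------------------------------------
-- The real numbers, as the setoid of Cauchy sequences of rationals

IsCauchy : (ℕ → ℚ) → Set
IsCauchy x = ∀ ε → 0ℚ ℚ.< ε →
  ∃ λ N → ∀ m n → N ℕ.≤ m → N ℕ.≤ n → ℚ.∣ x m ℚ.- x n ∣ ℚ.< ε

record ℝ : Set where
  constructor mkℝ
  field
    seq    : ℕ → ℚ
    cauchy : IsCauchy seq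
open ℝ public

infix 4 _≈_ _<_
infixl 6 _-_

_≈_ : ℝ → ℝ → Set
x ≈ y = ∀ ε → 0ℚ ℚ.< ε →
  ∃ λ N → ∀ n → N ℕ.≤ n → ℚ.∣ seq x n ℚ.- seq y n ∣ ℚ.< ε

_<_ : ℝ → ℝ → Set
x < y = ∃ λ ε → 0ℚ ℚ.< ε ×
  ∃ λ N → ∀ n → N ℕ.≤ n → seq x n ℚ.+ ε ℚ.≤ seq y n

fromℚ : ℚ → ℝ
fromℚ q = mkℝ (λ _ → q) λ ε ε>0 → 0 , λ _ _ _ _ →
  subst (ℚ._< ε) (sym (∣p-p∣≡0 q)) ε>0

0ℝ : ℝ
0ℝ = fromℚ 0ℚ

_-_ : ℝ → ℝ → ℝ
x - y = mkℝ (λ n → seq x n ℚ.- seq y n) λ ε ε>0 →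
  let M , hx = cauchy x (½ ℚ.* ε) (half>0 ε>0)
      N , hy = cauchy y (½ ℚ.* ε) (half>0 ε>0)
  in M ℕ.⊔ N , λ m n ≤m ≤n →
       ≤-halves ε (∣-∣-minus (seq x m) (seq y m) (seq x n) (seq y n))
         (hx m n (ℕₚ.m⊔n≤o⇒m≤o M N ≤m) (ℕₚ.m⊔n≤o⇒m≤o M N ≤n))
         (hy m n (ℕₚ.m⊔n≤o⇒n≤o M N ≤m) (ℕₚ.m⊔n≤o⇒n≤o M N ≤n))

∣_∣ : ℝ → ℝ
∣ x ∣ = mkℝ (λ n → ℚ.∣ seq x n ∣) λ ε ε>0 →
  let N , h = cauchy x ε ε>0
  in N , λ m n ≤m ≤n →
       ℚₚ.≤-<-trans (∣∣∣-∣∣∣-≤ (seq x m) (seq x n)) (h m n ≤m ≤n)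

ℝ-setoid : Setoid 0ℓ 0ℓ
ℝ-setoid = record
  { Carrier       = ℝ
  ; _≈_           = _≈_
  ; isEquivalence = record
    { refl  = λ {x} ε ε>0 → 0 , λ n _ →
        subst (ℚ._< ε) (sym (∣p-p∣≡0 (seq x n))) ε>0
    ; sym   = λ {x} {y} h ε ε>0 → let N , k = h ε ε>0 in
        N , λ n ≤n → subst (ℚ._< ε) (∣-∣-sym (seq x n) (seq y n)) (k n ≤n)
    ; trans = λ {x} {y} {z} g h ε ε>0 →
        let M , a = g (½ ℚ.* ε) (half>0 ε>0)
            N , b = h (½ ℚ.* ε) (half>0 ε>0)
        in M ℕ.⊔ N , λ n ≤n →
             ≤-halves ε (triangle (seq x n) (seq y n) (seq z n))
               (a n (ℕₚ.m⊔n≤o⇒m≤o M N ≤n)) (b n (ℕₚ.m⊔n≤o⇒n≤o M N ≤n))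
    }
  }

Continuous : (ℝ → ℝ) → Set
Continuous f = ∀ x ε → 0ℝ < ε →
  ∃ λ δ → 0ℝ < δ × (∀ t → ∣ t - x ∣ < δ → ∣ f t - f x ∣ < ε)

------------------------------------------------------------------------
-- Points and x-monotone Jordan curves

record Point : Set where
  constructor _,ₚ_
  field
    xcoord ycoord : ℝ
open Point public

infix 4 _≈ₚ_ _≈ᶜ_ _∈ᶜ_ _∈⁺_ _∈⁻_

_≈ₚ_ : Point → Point → Set
p ≈ₚ q = xcoord p ≈ xcoord q × ycoord p ≈ ycoord q

-- A curve is given by the function of which it is the graph; since the graph
-- determines the function, equality of curves as sets is _≈ᶜ_.
record Curve : Set where
  field
    func       : Func ℝ-setoid ℝ-setoid
  open Func func public using () renaming (to to height)
  field
    continuous : Continuous height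
open Curve public using (height)

_≈ᶜ_ : Curve → Curve → Set
l₁ ≈ᶜ l₂ = ∀ t → height l₁ t ≈ height l₂ t

_∈ᶜ_ _∈⁺_ _∈⁻_ : Point → Curve → Set
p ∈ᶜ l = ycoord p ≈ height l (xcoord p)
p ∈⁺ l = height l (xcoord p) < ycoord p
p ∈⁻ l = ycoord p < height l (xcoord p)

-- No k + 1 pairwise distinct points are common to both curves.
MeetAtMost : ℕ → Curve → Curve → Set
MeetAtMost k l₁ l₂ = (q : Fin (suc k) → Point) →
  (∀ i → q i ∈ᶜ l₁ × q i ∈ᶜ l₂) →
  ¬ (∀ i j → i ≢ j → ¬ (q i ≈ₚ q j))

CrossesUp : ℝ → ℝ → ℝ → Curve → Curve → Set
CrossesUp a x b l₁ l₂ =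
  (∀ t → a < t → t < x → height l₁ t < height l₂ t) ×
  (∀ t → x < t → t < b → height l₂ t < height l₁ t)

TransversalAt : ℝ → Curve → Curve → Set
TransversalAt x l₁ l₂ = ∃₂ λ a b →
  a < x × x < b × (CrossesUp a x b l₁ l₂ ⊎ CrossesUp a x b l₂ l₁)

------------------------------------------------------------------------
-- k-intersecting pseudoconfigurations of points

-- Λ([n],r) is the set of v : Vec (Fin n) r with Increasing v.
Increasing : ∀ {n r} → Vec (Fin n) r → Set
Increasing = Linked Fin._<_

-- Sets of exactly (at least) k + 1 indices are given by their increasing
-- enumerations (contain an increasing tuple of k + 1 indices).
record PseudoConfiguration (k n : ℕ) : Set₁ where
  field
    point        : Fin n → Point
    L            : Pred Curve 0ℓ
    x-increasing : ∀ i j → i Fin.< j → xcoord (point i) < xcoord (point j)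

  Through : ∀ {r} → Curve → Vec (Fin n) r → Set
  Through l v = All (λ i → point i ∈ᶜ l) v

  field
    pp1 : ∀ l → L l → ∃ λ (v : Vec (Fin n) (suc k)) → Increasing v × Through l v
    pp2 : ∀ (v : Vec (Fin n) (suc k)) → Increasing v →
          ∃ λ l → (L l × Through l v) ×
                  (∀ l′ → L l′ → Through l′ v → l′ ≈ᶜ l)
    pp3 : ∀ l₁ l₂ → L l₁ → L l₂ → ¬ (l₁ ≈ᶜ l₂) →
          MeetAtMost k l₁ l₂ ×
          (∀ q → q ∈ᶜ l₁ → q ∈ᶜ l₂ → TransversalAt (xcoord q) l₁ l₂)

GeneralPosition : ∀ {k n} → PseudoConfiguration k n → Set
GeneralPosition {k} {n} PP = ∀ l → L l →
  ∃ λ (v : Vec (Fin n) (suc k)) → Increasing v ×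
    (∀ i → (point i ∈ᶜ l) ⇔ (i ∈ v))
  where open PseudoConfiguration PP

------------------------------------------------------------------------
-- Chirotopes and oriented matroids

data Sgn : Set where
  [+] [0] [-] : Sgn

infix  8 -ₛ_
infixl 7 _·_

-ₛ_ : Sgn → Sgn
-ₛ [+] = [-]
-ₛ [0] = [0]
-ₛ [-] = [+]

_·_ : Sgn → Sgn → Sgn
[+] · t = t
[0] · t = [0]
[-] · t = -ₛ t

inversions : ∀ {r} → Permutation′ r → List (Fin r × Fin r)
inversions {r} σ =
  List.filter (λ (i , j) → (i Finₚ.<? j) ×-dec ((σ ⟨$⟩ʳ j) Finₚ.<? (σ ⟨$⟩ʳ i)))
    (List.cartesianProduct (List.allFin r) (List.allFin r))

sgn : ∀ {r} → Permutation′ r → Sgn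
sgn σ = List.foldr (λ _ s → -ₛ s) [+] (inversions σ)

module _ {E : Set} {r : ℕ} where

  permute : Permutation′ r → Vec E r → Vec E r
  permute σ v = tabulate λ j → lookup v (σ ⟨$⟩ʳ j)

  Alternating : (Vec E r → Sgn) → Set
  Alternating χ = ∀ σ v → χ (permute σ v) ≡ sgn σ · χ v

  -- The pair {χ , -χ}.
  ± : (Vec E r → Sgn) → Pred (Vec E r → Sgn) 0ℓ
  ± χ φ = (φ ≗ χ) ⊎ (φ ≗ λ v → -ₛ χ v)

module _ {E : Set} {r : ℕ} (χ : Vec E (suc r) → Sgn) where

  -- The set of signs appearing in the exchange axiom for the tuples u and v.
  ExchangeSet : Vec E (suc r) → Vec E (suc r) → Pred Sgn 0ℓ
  ExchangeSet u v z =
    z ≡ -ₛ (χ u · χ v) ⊎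
    ∃ λ s → z ≡ χ (u [ zero ]≔ lookup v s) · χ (v [ s ]≔ lookup u zero)

  record IsChirotope : Set where
    field
      nonzero     : ∃ λ v → χ v ≢ [0]
      alternating : Alternating χ
      exchange    : ∀ u v →
        (ExchangeSet u v [+] × ExchangeSet u v [-]) ⊎
        (∀ z → ExchangeSet u v z ⇔ (z ≡ [0]))

record IsDegreeUniform (k : ℕ) {n : ℕ} (χ : Vec (Fin n) (suc (suc k)) → Sgn) : Set where
  field
    isChirotope : IsChirotope χ
    uniform     : ∀ v → Increasing v → χ v ≢ [0]
    -- The elements a < b < c of an increasing tuple are its entries at
    -- positions a < b < c.
    degree      : ∀ (v : Vec (Fin n) (suc (suc (suc k)))) → Increasing v →
      ∀ a b c → a Fin.< b → b Fin.< c →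
      χ (removeAt v c) ≡ -ₛ χ (removeAt v b) →
      χ (removeAt v a) ≡ χ (removeAt v b)

-- Order on ℝ is not decidable, so χ_PP is specified by its defining properties
-- and not computed.  In general position a point off a curve is, classically,
-- above or below it, so each converse of `above` and `below` follows from the
-- forward implications.
record IsχOf {k n : ℕ} (PP : PseudoConfiguration k n)
             (χ : Vec (Fin n) (suc (suc k)) → Sgn) : Set where
  open PseudoConfiguration PP
  field
    above       : ∀ v → Increasing v → ∀ j → j ∉ v → ∀ l → L l → Through l v →
                  point j ∈⁺ l ⇔ χ (v ∷ʳ j) ≡ [+]
    below       : ∀ v → Increasing v → ∀ j → j ∉ v → ∀ l → L l → Through l v →
                  point j ∈⁻ l ⇔ χ (v ∷ʳ j) ≡ [-]
    repeated    : ∀ v i j → i ≢ j → lookup v i ≡ lookup v j → χ v ≡ [0]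
    alternating : Alternating χ

{-# OPTIONS --safe #-}
module Submission where

open import Defs
open import Data.Nat using (ℕ; suc; _≤_)
open import Data.Fin using (Fin)
open import Data.Vec using (Vec)
open import Data.Product using (Σ; ∃; _×_)
open import Relation.Unary using (_≐_)

open import Level using (0ℓ)
import Data.Nat as ℕ
open import Data.Nat using (zero)
import Data.Nat.Properties as ℕₚ
open import Algebra.Properties.CommutativeSemigroup ℕₚ.+-commutativeSemigroup using (x∙yz≈y∙xz)
import Data.Fin as Fin
open import Data.Fin using (zero; suc; inject₁; toℕ)
import Data.Fin.Properties as Finₚ
open import Data.Fin.Permutation using (Permutation′; _⟨$⟩ʳ_; permutation; transpose)
import Data.Fin.Permutation.Components as Components
open import Data.List as List using (List; []; _∷_)
import Data.List.Properties as Listₚ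
import Data.List.Membership.Propositional as List∈
open import Data.List.Membership.Propositional.Properties using (∈-allFin; ∈-cartesianProduct⁺)
open import Data.List.Relation.Unary.All as Allₗ using ()
open import Data.List.Relation.Unary.AllPairs using (_∷_)
open import Data.List.Relation.Unary.Any using (here; there)
open import Data.List.Relation.Unary.Unique.Propositional using (Unique)
open import Data.List.Relation.Unary.Unique.Propositional.Properties using (allFin⁺; cartesianProduct⁺)
import Data.Vec as Vec
open import Data.Vec using ([]; _∷_; lookup; removeAt; _∷ʳ_)
open import Data.Vec.Properties using (tabulate∘lookup; tabulate-cong; lookup∘tabulate)
open import Data.Vec.Membership.Propositional using (_∈_; _∉_)
open import Data.Vec.Membership.Propositional.Properties using (∈-lookup; ∈-map⁺)
open import Data.Vec.Relation.Unary.Any using (here; there; index; any?)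
open import Data.Vec.Relation.Unary.Any.Properties using (lookup-index)
open import Data.Vec.Relation.Unary.All as All using (All; []; _∷_)
open import Data.Vec.Relation.Unary.AllPairs using (AllPairs; []; _∷_)
open import Data.Vec.Relation.Unary.Linked using ([]; [-]; _∷_)
open import Data.Vec.Relation.Unary.Linked.Properties using (Linked⇒All)
open import Data.Rational as ℚ using (ℚ; 0ℚ; 1ℚ; ½; _+_; _*_)
import Data.Rational.Properties as ℚₚ
open import Data.Rational.Solver using (module +-*-Solver)
open import Data.Product using (_,_; ∃₂; proj₁; proj₂)
open import Data.Sum using (_⊎_; inj₁; inj₂; [_,_]′)
open import Data.Empty using (⊥-elim)
open import Data.Unit using (tt)
open import Function using (_∘_; id)
open import Function.Bundles using (Func; _⇔_; mk⇔)
open import Relation.Binary.Bundles using (Setoid)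
open import Relation.Binary.Definitions using (tri<; tri≈; tri>; DecidableEquality)
open import Relation.Binary.PropositionalEquality
open import Relation.Nullary using (¬_; Dec; yes; no; contradiction)
open import Relation.Nullary.Decidable
  using (_×-dec_; _⊎-dec_; ¬?; dec-true; dec-false; decidable-stable)
open import Relation.Unary using (Pred; Decidable)
open +-*-Solver

-- Put the points on the x-axis. The curve of a (k + 1)-set Λ then has a prescribed side at each
-- point j, namely −χ(Λ, j), which is zero exactly for j ∈ Λ. In each gap between consecutive points
-- the curves are ordered lexicographically by their sign words, with the order reversed after each
-- common zero; expansions in base 4 turn these words into rational heights, and linear
-- interpolation gives curves of which two cross exactly where their order changes from one gap to the
-- next.
--
-- Let u be the first point where the sides of Λ and M differ, and let T consist of u and the points
-- at which the order changes. Along T the order alternates, and at each point of T either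
-- both curves pass through it or their sides differ in the direction given by the order. If there were
-- k + 1 changes, the last k + 2 points of T would therefore form a tuple on which Λ forces one
-- value of χ and M the opposite one. That a tuple's sign is forced by a curve which weakly
-- alternates along it uses only that χ is alternating, uniform and of degree k.
--
-- A common point of two curves is a real number; it is located constructively because the curves are
-- apart at all gaps, so that it can be separated from each of them.

-- The curves cannot be drawn pair by pair: a single order in each gap has to serve all of them, and
-- the order at the leftmost gap is part of the choice. It is made so that nothing changes at u. In
-- the gap before u the backward reading and then the forward reading pass the same common zeros, so
-- the reversals cancel in pairs and the signs at u decide; they also decide in the gap after u.
-- Thus u is a point of alternation that costs no change of order, and k + 1 changes suffice to
-- produce the k + 2 points of a contradictory tuple. With any other choice at the left end the
-- count could fall short by one, allowing one crossing too many. Changes to the left of u do occur,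
-- but only at points common to both curves, where weak alternation asks for nothing. Heights at the
-- points need a rule of their own: at a common zero the encoding for the gaps reverses the order,
-- while at the point itself all curves through it must have exactly the same height.

indicator : ∀ {p} {P : Set p} → Dec P → ℕ
indicator (yes _) = 1
indicator (no  _) = 0

indicator-yes : ∀ {p} {P : Set p} (P? : Dec P) → P → indicator P? ≡ 1
indicator-yes (yes _) _ = refl
indicator-yes (no ¬p) p = contradiction p ¬p

indicator-no : ∀ {p} {P : Set p} (P? : Dec P) → ¬ P → indicator P? ≡ 0
indicator-no (yes p) ¬p = contradiction p ¬p
indicator-no (no _)  _  = refl

-- Increasing vectors

Asc : ∀ {n m} → Vec (Fin n) m → Set
Asc = AllPairs Fin._<_

Increasing⇒Asc : ∀ {n m} {v : Vec (Fin n) m} → Increasing v → Asc v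
Increasing⇒Asc []           = []
Increasing⇒Asc [-]          = [] ∷ []
Increasing⇒Asc (x<y ∷ v↑) = Linked⇒All Finₚ.<-trans x<y v↑ ∷ Increasing⇒Asc v↑

Asc⇒Increasing : ∀ {n m} {v : Vec (Fin n) m} → Asc v → Increasing v
Asc⇒Increasing []                        = []
Asc⇒Increasing (_ ∷ [])                  = [-]
Asc⇒Increasing ((x<y ∷ _) ∷ v↑@(_ ∷ _)) = x<y ∷ Asc⇒Increasing v↑

Asc-lookup : ∀ {n m} {v : Vec (Fin n) m} → Asc v →
             ∀ {i j} → i Fin.< j → lookup v i Fin.< lookup v j
Asc-lookup (x<v ∷ _)  {zero}  {suc j} _         = All.lookup x<v (∈-lookup j _)
Asc-lookup (_   ∷ v↑) {suc i} {suc j} (ℕ.s≤s i<j) = Asc-lookup v↑ i<j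

Asc-lookup⁻ : ∀ {n m} {v : Vec (Fin n) m} → Asc v →
              ∀ {i j} → lookup v i Fin.< lookup v j → i Fin.< j
Asc-lookup⁻ {v = v} v↑ {i} {j} vi<vj with Finₚ.<-cmp i j
... | tri< i<j _ _  = i<j
... | tri≈ _ refl _ = contradiction vi<vj (Finₚ.<-irrefl refl)
... | tri> _ _ j<i  = contradiction (Asc-lookup v↑ j<i) (Finₚ.<-asym vi<vj)

module _ {A : Set} where

  ∈-removeAt⁺ : ∀ {m} (v : Vec A (suc m)) i {x} → x ∈ v → x ≢ lookup v i → x ∈ removeAt v i
  ∈-removeAt⁺ (y ∷ v)     zero    (here x≡y)  x≢ = contradiction x≡y x≢
  ∈-removeAt⁺ (y ∷ v)     zero    (there x∈v) x≢ = x∈v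
  ∈-removeAt⁺ (y ∷ z ∷ v) (suc i) (here x≡y)  x≢ = here x≡y
  ∈-removeAt⁺ (y ∷ z ∷ v) (suc i) (there x∈v) x≢ = there (∈-removeAt⁺ (z ∷ v) i x∈v x≢)

  ∈-removeAt⁻ : ∀ {m} (v : Vec A (suc m)) i {x} → x ∈ removeAt v i → x ∈ v
  ∈-removeAt⁻ (y ∷ v)     zero    x∈v         = there x∈v
  ∈-removeAt⁻ (y ∷ z ∷ v) (suc i) (here x≡y)  = here x≡y
  ∈-removeAt⁻ (y ∷ z ∷ v) (suc i) (there x∈v) = there (∈-removeAt⁻ (z ∷ v) i x∈v)

  All-∈ : ∀ {P : Pred A 0ℓ} {m} {v : Vec A m} → (∀ {x} → x ∈ v → P x) → All P v
  All-∈ {v = []}    _ = []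
  All-∈ {v = _ ∷ _} p = p (here refl) ∷ All-∈ (p ∘ there)

  All-removeAt : ∀ {P : Pred A 0ℓ} {m} {v : Vec A (suc m)} → All P v → ∀ i → All P (removeAt v i)
  All-removeAt {v = v} Pv i = All-∈ λ x∈ → All.lookup Pv (∈-removeAt⁻ v i x∈)

module _ {n : ℕ} where

  private
    V : ℕ → Set
    V = Vec (Fin n)

  infix 4 _∈?_
  _∈?_ : ∀ {m} (x : Fin n) (v : V m) → Dec (x ∈ v)
  x ∈? v = any? (x Fin.≟_) v

  Asc-removeAt : ∀ {m} {v : V (suc m)} → Asc v → ∀ i → Asc (removeAt v i)
  Asc-removeAt {v = _ ∷ _}     (_   ∷ v↑) zero    = v↑
  Asc-removeAt {v = _ ∷ _ ∷ _} (x<v ∷ v↑) (suc i) = All-removeAt x<v i ∷ Asc-removeAt v↑ i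

  lookup∉removeAt : ∀ {m} {v : V (suc m)} → Asc v → ∀ i → lookup v i ∉ removeAt v i
  lookup∉removeAt {v = _ ∷ _} (x<v ∷ _) zero x∈v =
    Finₚ.<-irrefl refl (All.lookup x<v x∈v)
  lookup∉removeAt {v = _ ∷ y ∷ v} (x<v ∷ _) (suc i) (here vi≡x) =
    Finₚ.<-irrefl (sym vi≡x) (All.lookup x<v (∈-lookup i (y ∷ v)))
  lookup∉removeAt {v = _ ∷ _ ∷ _} (_ ∷ v↑) (suc i) (there vi∈) =
    lookup∉removeAt v↑ i vi∈

  -- Induction on `v`: its head occupies a place of `w`, and deleting that place leaves one place
  -- fewer for the rest. In `alternating-sign` the sizes of `Λ` and `T` are compared in this way.
  Asc-⊈-shorter : ∀ {m} (v : V (suc m)) (w : V m) → Asc v → ¬ (∀ {x} → x ∈ v → x ∈ w)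
  Asc-⊈-shorter (x ∷ v) []        _          v⊆w with v⊆w (here refl)
  ... | ()
  Asc-⊈-shorter (x ∷ v) w@(_ ∷ _) (x<v ∷ v↑) v⊆w =
    Asc-⊈-shorter v (removeAt w i) v↑ λ y∈v →
      ∈-removeAt⁺ w i (v⊆w (there y∈v)) λ y≡wi →
        Finₚ.<-irrefl (trans (lookup-index x∈w) (sym y≡wi)) (All.lookup x<v y∈v)
    where
    x∈w = v⊆w (here refl)
    i   = index x∈w

  Asc-⊆⇒≡ : ∀ {m} (v w : V m) → Asc v → Asc w → (∀ {x} → x ∈ v → x ∈ w) → v ≡ w
  Asc-⊆⇒≡ []      []      _          _          _   = refl
  Asc-⊆⇒≡ (x ∷ v) (y ∷ w) (x<v ∷ v↑) (y<w ∷ w↑) v⊆w with v⊆w (here refl)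
  ... | here refl = cong (x ∷_) (Asc-⊆⇒≡ v w v↑ w↑ λ {z} z∈v →
          above-head (v⊆w (there z∈v)) (All.lookup x<v z∈v))
    where
    above-head : ∀ {z} → z ∈ x ∷ w → x Fin.< z → z ∈ w
    above-head (here refl) x<x = contradiction x<x (Finₚ.<-irrefl refl)
    above-head (there z∈w) _   = z∈w
  ... | there x∈w = ⊥-elim (Asc-⊈-shorter (x ∷ v) w (x<v ∷ v↑) λ
          { (here refl) → x∈w
          ; (there z∈v) → above-head (v⊆w (there z∈v))
                            (Finₚ.<-trans (All.lookup y<w x∈w) (All.lookup x<v z∈v)) })
    where
    above-head : ∀ {z} → z ∈ y ∷ w → y Fin.< z → z ∈ w
    above-head (here refl) y<y = contradiction y<y (Finₚ.<-irrefl refl)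
    above-head (there z∈w) _   = z∈w

  insert : ∀ {m} → Fin n → V m → V (suc m)
  insert a []      = a ∷ []
  insert a (x ∷ v) with a Fin.<? x
  ... | yes _ = a ∷ x ∷ v
  ... | no  _ = x ∷ insert a v

  ∈-insert⁻ : ∀ {m} a (v : V m) {x} → x ∈ insert a v → x ≡ a ⊎ x ∈ v
  ∈-insert⁻ a []      (here x≡a) = inj₁ x≡a
  ∈-insert⁻ a (y ∷ v) x∈ with a Fin.<? y
  ∈-insert⁻ a (y ∷ v) (here x≡a)  | yes _ = inj₁ x≡a
  ∈-insert⁻ a (y ∷ v) (there x∈)  | yes _ = inj₂ x∈
  ∈-insert⁻ a (y ∷ v) (here x≡y)  | no  _ = inj₂ (here x≡y)
  ∈-insert⁻ a (y ∷ v) (there x∈)  | no  _ with ∈-insert⁻ a v x∈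
  ... | inj₁ x≡a = inj₁ x≡a
  ... | inj₂ x∈v = inj₂ (there x∈v)

  here-insert : ∀ {m} a (v : V m) → a ∈ insert a v
  here-insert a []      = here refl
  here-insert a (y ∷ v) with a Fin.<? y
  ... | yes _ = here refl
  ... | no  _ = there (here-insert a v)

  there-insert : ∀ {m} a (v : V m) {x} → x ∈ v → x ∈ insert a v
  there-insert a (y ∷ v) x∈ with a Fin.<? y
  there-insert a (y ∷ v) x∈          | yes _ = there x∈
  there-insert a (y ∷ v) (here x≡y)  | no  _ = here x≡y
  there-insert a (y ∷ v) (there x∈v) | no  _ = there (there-insert a v x∈v)

  Asc-insert : ∀ {m} {a} {v : V m} → a ∉ v → Asc v → Asc (insert a v)
  Asc-insert {v = []} _ _ = [] ∷ []
  Asc-insert {a = a} {v = x ∷ v} a∉v (x<v ∷ v↑) with a Fin.<? x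
  ... | yes a<x = (a<x ∷ All.map (Finₚ.<-trans a<x) x<v) ∷ x<v ∷ v↑
  ... | no  a≮x = All-∈ below ∷ Asc-insert (a∉v ∘ there) v↑
    where
    x<a : x Fin.< a
    x<a = Finₚ.≤∧≢⇒< (ℕₚ.≮⇒≥ a≮x) (a∉v ∘ here ∘ sym)
    below : ∀ {y} → y ∈ insert a v → x Fin.< y
    below y∈ with ∈-insert⁻ a v y∈
    ... | inj₁ refl = x<a
    ... | inj₂ y∈v  = All.lookup x<v y∈v

  insert-below : ∀ {m} {a} {v : V m} → All (a Fin.<_) v → insert a v ≡ a ∷ v
  insert-below []                  = refl
  insert-below {a = a} {v = x ∷ v} (a<x ∷ _) with a Fin.<? x
  ... | yes _   = refl
  ... | no  a≮x = contradiction a<x a≮x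

  -- An arbitrary `w`, because one exchange identity is needed for two counts: the entries outside
  -- `Λ`, which measure the induction, and the entries above `t`, which govern signs.
  weight : (Fin n → ℕ) → ∀ {m} → V m → ℕ
  weight w []      = 0
  weight w (x ∷ v) = w x ℕ.+ weight w v

  weight-insert : ∀ w {m} a (v : V m) → weight w (insert a v) ≡ w a ℕ.+ weight w v
  weight-insert w a []      = refl
  weight-insert w a (x ∷ v) with a Fin.<? x
  ... | yes _ = refl
  ... | no  _ = trans (cong (w x ℕ.+_) (weight-insert w a v)) (x∙yz≈y∙xz (w x) (w a) (weight w v))

  weight-removeAt : ∀ w {m} (v : V (suc m)) i →
                    weight w v ≡ w (lookup v i) ℕ.+ weight w (removeAt v i)
  weight-removeAt w (x ∷ v)     zero    = refl
  weight-removeAt w (x ∷ y ∷ v) (suc i) =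
    trans (cong (w x ℕ.+_) (weight-removeAt w (y ∷ v) i)) (x∙yz≈y∙xz (w x) (w (lookup (y ∷ v) i)) _)

  #above : Fin n → ∀ {m} → V m → ℕ
  #above t = weight λ x → indicator (t Fin.<? x)

-- Extremal elements of decidable subsets

least : ∀ {n} {P : Pred (Fin n) 0ℓ} → Decidable P →
        (∀ x → ¬ P x) ⊎ ∃ λ x → P x × (∀ y → P y → x Fin.≤ y)
least {zero}  P? = inj₁ λ ()
least {suc n} {P} P? with P? zero
... | yes p0 = inj₂ (zero , p0 , λ _ _ → ℕ.z≤n)
... | no ¬p0 with least {P = P ∘ suc} (P? ∘ suc)
...   | inj₁ none = inj₁ λ { zero → ¬p0 ; (suc x) → none x }
...   | inj₂ (x , px , min) =
        inj₂ (suc x , px , λ { zero p0 → contradiction p0 ¬p0 ; (suc y) py → ℕ.s≤s (min y py) })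

greatest : ∀ {n} {P : Pred (Fin n) 0ℓ} → Decidable P →
           (∀ x → ¬ P x) ⊎ ∃ λ x → P x × (∀ y → P y → y Fin.≤ x)
greatest {zero}  P? = inj₁ λ ()
greatest {suc n} {P} P? with greatest {P = P ∘ suc} (P? ∘ suc)
... | inj₂ (x , px , max) =
      inj₂ (suc x , px , λ { zero _ → ℕ.z≤n ; (suc y) py → ℕ.s≤s (max y py) })
... | inj₁ none with P? zero
...   | yes p0 = inj₂ (zero , p0 , λ { zero _ → ℕ.z≤n ; (suc y) py → contradiction py (none y) })
...   | no ¬p0 = inj₁ λ { zero → ¬p0 ; (suc x) → none x }

-- Signs

neg^ : ℕ → Sgn → Sgn
neg^ zero    s = s
neg^ (suc m) s = -ₛ neg^ m s

-ₛ-involutive : ∀ s → -ₛ -ₛ s ≡ s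
-ₛ-involutive [+] = refl
-ₛ-involutive [0] = refl
-ₛ-involutive [-] = refl

-ₛ-fixed : ∀ {s} → s ≡ -ₛ s → s ≡ [0]
-ₛ-fixed {[0]} _ = refl

-ₛ-injective : ∀ {s t} → -ₛ s ≡ -ₛ t → s ≡ t
-ₛ-injective {s} {t} eq = trans (sym (-ₛ-involutive s)) (trans (cong -ₛ_ eq) (-ₛ-involutive t))

≢⇒≡- : ∀ {s t} → s ≢ [0] → t ≢ [0] → s ≢ t → s ≡ -ₛ t
≢⇒≡- {[+]} {[+]} _  _  s≢t = contradiction refl s≢t
≢⇒≡- {[+]} {[0]} _  t≢ _   = contradiction refl t≢
≢⇒≡- {[+]} {[-]} _  _  _   = refl
≢⇒≡- {[0]} {_}   s≢ _  _   = contradiction refl s≢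
≢⇒≡- {[-]} {[+]} _  _  _   = refl
≢⇒≡- {[-]} {[0]} _  t≢ _   = contradiction refl t≢
≢⇒≡- {[-]} {[-]} _  _  s≢t = contradiction refl s≢t

neg^-neg : ∀ m s → neg^ m (-ₛ s) ≡ -ₛ neg^ m s
neg^-neg zero    s = refl
neg^-neg (suc m) s = cong -ₛ_ (neg^-neg m s)

neg^-involutive : ∀ m s → neg^ m (neg^ m s) ≡ s
neg^-involutive zero    s = refl
neg^-involutive (suc m) s =
  trans (cong -ₛ_ (neg^-neg m (neg^ m s))) (trans (-ₛ-involutive _) (neg^-involutive m s))

neg^-≢0 : ∀ m {s} → s ≢ [0] → neg^ m s ≢ [0]
neg^-≢0 m s≢0 eq = s≢0 (trans (sym (neg^-involutive m _)) (trans (cong (neg^ m) eq) (neg^-0 m)))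
  where
  neg^-0 : ∀ m → neg^ m [0] ≡ [0]
  neg^-0 zero    = refl
  neg^-0 (suc m) = cong -ₛ_ (neg^-0 m)

-- Adjacent transpositions

swapAt : ∀ {A : Set} {m} → Fin m → Vec A (suc m) → Vec A (suc m)
swapAt zero    (x ∷ y ∷ v) = y ∷ x ∷ v
swapAt (suc i) (x ∷ v)     = x ∷ swapAt i v

swapFin : ∀ {m} → Fin m → Fin (suc m) → Fin (suc m)
swapFin zero    zero          = suc zero
swapFin zero    (suc zero)    = zero
swapFin zero    (suc (suc j)) = suc (suc j)
swapFin (suc i) zero          = zero
swapFin (suc i) (suc j)       = suc (swapFin i j)

swapFin-involutive : ∀ {m} (i : Fin m) j → swapFin i (swapFin i j) ≡ j
swapFin-involutive zero    zero          = refl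
swapFin-involutive zero    (suc zero)    = refl
swapFin-involutive zero    (suc (suc j)) = refl
swapFin-involutive (suc i) zero          = refl
swapFin-involutive (suc i) (suc j)       = cong suc (swapFin-involutive i j)

adjacent : ∀ {m} → Fin m → Permutation′ (suc m)
adjacent i = permutation (swapFin i) (swapFin i) (swapFin-involutive i) (swapFin-involutive i)

lookup-swapAt : ∀ {A : Set} {m} (i : Fin m) (v : Vec A (suc m)) j →
                lookup (swapAt i v) j ≡ lookup v (swapFin i j)
lookup-swapAt zero    (x ∷ y ∷ v) zero          = refl
lookup-swapAt zero    (x ∷ y ∷ v) (suc zero)    = refl
lookup-swapAt zero    (x ∷ y ∷ v) (suc (suc j)) = refl
lookup-swapAt (suc i) (x ∷ v)     zero          = refl
lookup-swapAt (suc i) (x ∷ v)     (suc j)       = lookup-swapAt i v j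

permute-adjacent : ∀ {A : Set} {m} (i : Fin m) (v : Vec A (suc m)) →
                   permute (adjacent i) v ≡ swapAt i v
permute-adjacent i v =
  trans (tabulate-cong λ j → sym (lookup-swapAt i v j)) (tabulate∘lookup (swapAt i v))

adjacent-inversion : ∀ {m} (i : Fin m) → swapFin i (suc i) Fin.< swapFin i (inject₁ i)
adjacent-inversion zero    = ℕ.s≤s ℕ.z≤n
adjacent-inversion (suc i) = ℕ.s≤s (adjacent-inversion i)

adjacent-inversion! : ∀ {m} (i : Fin m) {j l} → j Fin.< l → swapFin i l Fin.< swapFin i j →
                      (j , l) ≡ (inject₁ i , suc i)
adjacent-inversion! zero    {zero}        {suc zero}    _ _ = refl
adjacent-inversion! zero    {suc zero}    {suc (suc l)} _ ()
adjacent-inversion! zero    {suc zero}    {suc zero} (ℕ.s≤s ()) _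
adjacent-inversion! zero    {suc (suc j)} {suc zero} (ℕ.s≤s ()) _
adjacent-inversion! zero    {zero}    {suc (suc l)} j<l (ℕ.s≤s ())
adjacent-inversion! zero    {suc (suc j)} {suc (suc l)} j<l l<j = contradiction l<j (Finₚ.<-asym j<l)
adjacent-inversion! (suc i) {suc j}       {suc l}       (ℕ.s≤s j<l) (ℕ.s≤s l<j)
  with refl ← adjacent-inversion! i j<l l<j = refl

filter-unique : ∀ {A : Set} {P : Pred A 0ℓ} (P? : Decidable P) {xs x} →
                Unique xs → x List∈.∈ xs → P x → (∀ {y} → P y → y ≡ x) →
                List.filter P? xs ≡ x ∷ []
filter-unique P? {_ ∷ xs} (x∉xs ∷ _) (here refl) px only =
  trans (Listₚ.filter-accept P? px)
    (cong (_ ∷_) (Listₚ.filter-none P? (Allₗ.map (λ x≢y py → x≢y (sym (only py))) x∉xs)))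
filter-unique P? {_ ∷ xs} (y∉xs ∷ xs!) (there x∈xs) px only =
  trans (Listₚ.filter-reject P? λ py → Allₗ.lookup y∉xs x∈xs (only py))
    (filter-unique P? xs! x∈xs px only)

-- Among all pairs of positions only the two swapped neighbours are inverted, so the fold negates
-- once.
sgn-adjacent : ∀ {m} (i : Fin m) → sgn (adjacent i) ≡ [-]
sgn-adjacent {m} i = cong (List.foldr (λ _ s → -ₛ s) [+])
  (filter-unique (λ (j , l) → (j Finₚ.<? l) ×-dec (swapFin i l Finₚ.<? swapFin i j))
    (cartesianProduct⁺ (allFin⁺ (suc m)) (allFin⁺ (suc m)))
    (∈-cartesianProduct⁺ (∈-allFin (inject₁ i)) (∈-allFin (suc i)))
    (inject₁<suc i , adjacent-inversion i)
    (λ (j<l , inv) → adjacent-inversion! i j<l inv))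
  where
  inject₁<suc : ∀ {m} (i : Fin m) → inject₁ i Fin.< suc i
  inject₁<suc zero    = ℕ.s≤s ℕ.z≤n
  inject₁<suc (suc i) = ℕ.s≤s (inject₁<suc i)

AdjacentAlternating : ∀ {E : Set} {m} → (Vec E (suc m) → Sgn) → Set
AdjacentAlternating φ = ∀ i v → φ (swapAt i v) ≡ -ₛ φ v

Alternating⇒Adjacent : ∀ {E : Set} {m} {χ : Vec E (suc m) → Sgn} →
                       Alternating χ → AdjacentAlternating χ
Alternating⇒Adjacent {χ = χ} alt i v = trans (cong χ (sym (permute-adjacent i v)))
  (trans (alt (adjacent i) v) (cong (_· χ v) (sgn-adjacent i)))

sgn≢0 : ∀ {r} (σ : Permutation′ r) → sgn σ ≢ [0]
sgn≢0 σ = go (inversions σ)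
  where
  go : ∀ {A : Set} (xs : List A) → List.foldr (λ _ s → -ₛ s) [+] xs ≢ [0]
  go (_ ∷ xs) eq = go xs (-ₛ-injective {t = [0]} eq)

·-zero : ∀ {s t} → s ≢ [0] → s · t ≡ [0] → t ≡ [0]
·-zero {[+]} _  eq = eq
·-zero {[0]} s≢ _  = contradiction refl s≢
·-zero {[-]} _  eq = -ₛ-injective {t = [0]} eq

swapAt-fixed : ∀ {A : Set} {m} (i : Fin m) (v : Vec A (suc m)) →
               lookup v (inject₁ i) ≡ lookup v (suc i) → swapAt i v ≡ v
swapAt-fixed zero    (x ∷ y ∷ v) refl = refl
swapAt-fixed (suc i) (x ∷ v)     eq   = cong (x ∷_) (swapAt-fixed i v eq)

Components-transpose-fixed : ∀ {n} {a b k : Fin n} → k ≢ a → k ≢ b → Components.transpose a b k ≡ k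
Components-transpose-fixed {a = a} {b} {k} k≢a k≢b
  rewrite dec-false (k Fin.≟ a) k≢a | dec-false (k Fin.≟ b) k≢b = refl

Components-transpose-left : ∀ {n} (a b : Fin n) → Components.transpose a b a ≡ b
Components-transpose-left a b rewrite dec-true (a Fin.≟ a) refl = refl

-- A transposition makes the two equal entries adjacent.
Alternating-repeated : ∀ {E : Set} {r} {χ : Vec E r → Sgn} → Alternating χ →
                       ∀ v {i j} → i Fin.< j → lookup v i ≡ lookup v j → χ v ≡ [0]
Alternating-repeated {r = suc r} {χ} alt v {i} {j} i<j vi≡vj =
  ·-zero (sgn≢0 σ) (trans (sym (alt σ v)) (-ₛ-fixed (trans (cong χ (sym fixed)) (Alternating⇒Adjacent alt i′ w))))
  where
  r≢i : r ≢ Fin.toℕ i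
  r≢i r≡i = ℕₚ.<⇒≱ i<j (ℕₚ.≤-trans (Finₚ.toℕ≤pred[n] j) (ℕₚ.≤-reflexive r≡i))
  i′ = Fin.lower₁ i r≢i
  σ = transpose (suc i′) j
  w = permute σ v
  i′≡i : inject₁ i′ ≡ i
  i′≡i = Finₚ.inject₁-lower₁ i r≢i
  i≢1+i′ : i ≢ suc i′
  i≢1+i′ i≡ = ℕₚ.1+n≢n (trans (cong Fin.toℕ (sym i≡)) (trans (cong Fin.toℕ (sym i′≡i)) (Finₚ.toℕ-inject₁ i′)))
  wi : ∀ l → lookup w l ≡ lookup v (σ ⟨$⟩ʳ l)
  wi = lookup∘tabulate λ l → lookup v (σ ⟨$⟩ʳ l)
  fixed : swapAt i′ w ≡ w
  fixed = swapAt-fixed i′ w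
    (trans (cong (lookup w) i′≡i)
    (trans (wi i)
    (trans (cong (lookup v) (Components-transpose-fixed i≢1+i′ (Finₚ.<⇒≢ i<j)))
    (trans vi≡vj
    (sym (trans (wi (suc i′)) (cong (lookup v) (Components-transpose-left (suc i′) j))))))))

Alternating-repeated≢ : ∀ {E : Set} {r} {χ : Vec E r → Sgn} → Alternating χ →
                        ∀ v i j → i ≢ j → lookup v i ≡ lookup v j → χ v ≡ [0]
Alternating-repeated≢ alt v i j i≢j eq with Finₚ.<-cmp i j
... | tri< i<j _ _ = Alternating-repeated alt v i<j eq
... | tri≈ _ i≡j _ = contradiction i≡j i≢j
... | tri> _ _ j<i = Alternating-repeated alt v j<i (sym eq)

-- Moving `t` leftwards into its place passes exactly the entries larger than `t`, each at the cost
-- of one sign. `φ` is arbitrary so that the recursion can absorb the head `x` into it.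
∷ʳ⇒insert : ∀ {n m} {φ : Vec (Fin n) (suc m) → Sgn} → AdjacentAlternating φ →
            ∀ {v} t → Asc v → φ (v ∷ʳ t) ≡ neg^ (#above t v) (φ (insert t v))
∷ʳ⇒insert         alt {[]}    t _          = refl
∷ʳ⇒insert {φ = φ} alt {x ∷ v} t (x<v ∷ v↑)
  with t Fin.<? x | ∷ʳ⇒insert {φ = φ ∘ (x ∷_)} (λ i → alt (suc i) ∘ (x ∷_)) t v↑
... | no  _   | ih = ih
... | yes t<x | ih = trans ih (trans
  (cong (λ w → neg^ (#above t v) (φ (x ∷ w))) (insert-below (All.map (Finₚ.<-trans t<x) x<v)))
  (trans (cong (neg^ (#above t v)) (alt zero (t ∷ x ∷ v))) (neg^-neg (#above t v) _)))

-- Deletion of a given member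

module _ {n : ℕ} where

  infixl 6 _⊖_
  _⊖_ : ∀ {m} (v : Vec (Fin n) (suc m)) {x} → x ∈ v → Vec (Fin n) m
  v ⊖ x∈v = removeAt v (index x∈v)

  ∈-⊖⁺ : ∀ {m} {v : Vec (Fin n) (suc m)} {x} (x∈v : x ∈ v) {y} → y ∈ v → y ≢ x → y ∈ v ⊖ x∈v
  ∈-⊖⁺ x∈v y∈v y≢x = ∈-removeAt⁺ _ (index x∈v) y∈v (y≢x ∘ λ y≡ → trans y≡ (sym (lookup-index x∈v)))

  ∈-⊖⁻ : ∀ {m} {v : Vec (Fin n) (suc m)} → Asc v → ∀ {x} (x∈v : x ∈ v) {y} →
         y ∈ v ⊖ x∈v → y ∈ v × y ≢ x
  ∈-⊖⁻ {v = v} v↑ x∈v y∈ = ∈-removeAt⁻ _ (index x∈v) y∈ ,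
    λ { refl → lookup∉removeAt v↑ (index x∈v) (subst (_∈ v ⊖ x∈v) (lookup-index x∈v) y∈) }

  weight-⊖ : ∀ w {m} {v : Vec (Fin n) (suc m)} {x} (x∈v : x ∈ v) →
             weight w v ≡ w x ℕ.+ weight w (v ⊖ x∈v)
  weight-⊖ w {v = v} x∈v = trans (weight-removeAt w v (index x∈v))
    (cong (λ y → w y ℕ.+ weight w (v ⊖ x∈v)) (sym (lookup-index x∈v)))

  Asc-⊖ : ∀ {m} {v : Vec (Fin n) (suc m)} → Asc v → ∀ {x} (x∈v : x ∈ v) → Asc (v ⊖ x∈v)
  Asc-⊖ v↑ x∈v = Asc-removeAt v↑ (index x∈v)

  index-< : ∀ {m} {v : Vec (Fin n) m} → Asc v → ∀ {x y} (x∈v : x ∈ v) (y∈v : y ∈ v) →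
            x Fin.< y → index x∈v Fin.< index y∈v
  index-< v↑ x∈v y∈v x<y =
    Asc-lookup⁻ v↑ (subst₂ Fin._<_ (lookup-index x∈v) (lookup-index y∈v) x<y)

-- Signs forced by alternation

module _ {k n : ℕ} {χ : Vec (Fin n) (suc (suc k)) → Sgn} (χ-degree : IsDegreeUniform k χ) where

  open IsDegreeUniform χ-degree
  open IsChirotope isChirotope using (alternating)

  χ≢0 : ∀ {v} → Asc v → χ v ≢ [0]
  χ≢0 v↑ = uniform _ (Asc⇒Increasing v↑)

  χ-∷ʳ : ∀ {v} t → Asc v → χ (v ∷ʳ t) ≡ neg^ (#above t v) (χ (insert t v))
  χ-∷ʳ = ∷ʳ⇒insert (Alternating⇒Adjacent alternating)

  module _ {S : Vec (Fin n) (suc (suc (suc k)))} (S↑ : Asc S)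
           {a b c} (a∈S : a ∈ S) (b∈S : b ∈ S) (c∈S : c ∈ S) (a<b : a Fin.< b) (b<c : b Fin.< c) where

    -- Deleting c, b, a in this order runs through the tuples lexicographically, and the degree
    -- condition says that the three signs change at most once. Each of the three lemmas here fills
    -- in the sign that the other two then determine.
    degree-first : ∀ {τ} → χ (S ⊖ c∈S) ≡ -ₛ τ → χ (S ⊖ b∈S) ≡ τ → χ (S ⊖ a∈S) ≡ τ
    degree-first c≡ b≡ = trans
      (degree S (Asc⇒Increasing S↑) _ _ _ (index-< S↑ a∈S b∈S a<b) (index-< S↑ b∈S c∈S b<c)
        (trans c≡ (cong -ₛ_ (sym b≡)))) b≡

    degree-middle : ∀ {τ} → τ ≢ [0] → χ (S ⊖ a∈S) ≡ τ → χ (S ⊖ c∈S) ≡ τ → χ (S ⊖ b∈S) ≡ τ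
    degree-middle {[0]} τ≢0 _ _ = contradiction refl τ≢0
    degree-middle {[+]} _ a≡ c≡ with χ (S ⊖ b∈S) in b≡
    ... | [+] = refl
    ... | [0] = contradiction b≡ (χ≢0 (Asc-⊖ S↑ b∈S))
    ... | [-] with () ← trans (sym a≡) (degree-first c≡ b≡)
    degree-middle {[-]} _ a≡ c≡ with χ (S ⊖ b∈S) in b≡
    ... | [-] = refl
    ... | [0] = contradiction b≡ (χ≢0 (Asc-⊖ S↑ b∈S))
    ... | [+] with () ← trans (sym a≡) (degree-first c≡ b≡)

    degree-last : ∀ {τ} → τ ≢ [0] → χ (S ⊖ a∈S) ≡ -ₛ τ → χ (S ⊖ b∈S) ≡ τ → χ (S ⊖ c∈S) ≡ τ
    degree-last {[0]} τ≢0 _ _ = contradiction refl τ≢0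
    degree-last {[+]} _ a≡ b≡ with χ (S ⊖ c∈S) in c≡
    ... | [+] = refl
    ... | [0] = contradiction c≡ (χ≢0 (Asc-⊖ S↑ c∈S))
    ... | [-] with () ← trans (sym a≡) (degree-first c≡ b≡)
    degree-last {[-]} _ a≡ b≡ with χ (S ⊖ c∈S) in c≡
    ... | [-] = refl
    ... | [0] = contradiction c≡ (χ≢0 (Asc-⊖ S↑ c∈S))
    ... | [+] with () ← trans (sym a≡) (degree-first c≡ b≡)

  module _ {Λ : Vec (Fin n) (suc k)} (Λ↑ : Asc Λ) where

    outside : Fin n → ℕ
    outside x = indicator (¬? (x ∈? Λ))

    -- Weak alternation: entries of `T` on the curve are unconstrained. Counting from the top makes
    -- `τ` the sign that the pattern assigns to the largest entry.
    AlternatesOn : Vec (Fin n) (suc (suc k)) → Sgn → Set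
    AlternatesOn T τ = ∀ {t} → t ∈ T → t ∉ Λ → χ (Λ ∷ʳ t) ≡ neg^ (#above t T) τ

    -- Induction on |T ∖ Λ|: in S = T + a with a ∈ Λ ∖ T, removing some u ∈ T ∖ Λ instead of a gives a
    -- smaller instance. The pattern keeps its sign for the u nearest to a on either side and is
    -- negated for the u farthest from a when all of T ∖ Λ lies on one side of a; two such
    -- values determine χ T by the degree condition on S.
    alternating-sign : ∀ c {T τ} → Asc T → τ ≢ [0] → weight outside T ≡ c →
                       AlternatesOn T τ → χ T ≡ τ
    alternating-sign c {T} {τ} T↑ τ≢0 |T∖Λ|≡c alt
      with greatest (λ x → (x ∈? Λ) ×-dec ¬? (x ∈? T))
    alternating-sign c {T} {τ} T↑ τ≢0 |T∖Λ|≡c alt | inj₁ Λ∖T≡∅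
      with greatest (λ x → (x ∈? T) ×-dec ¬? (x ∈? Λ))
    ... | inj₁ T∖Λ≡∅ = ⊥-elim (Asc-⊈-shorter T Λ T↑ λ {x} x∈T →
            decidable-stable (x ∈? Λ) λ x∉Λ → T∖Λ≡∅ x (x∈T , x∉Λ))
    -- Base case: `Λ` lies in `T`, so `u` is the only entry left over. The pattern at `u` and
    -- sorting `u` into `Λ` contribute the same power of the sign, and the two cancel.
    ... | inj₂ (u , (u∈T , u∉Λ) , _) = trans (cong χ (sym T≡))
            (trans (sym (neg^-involutive m _)) (trans (cong (neg^ m) flipped) (neg^-involutive m τ)))
      where
      m = #above u Λ
      Λ+u⊆T : ∀ {x} → x ∈ insert u Λ → x ∈ T
      Λ+u⊆T {x} x∈ with ∈-insert⁻ u Λ x∈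
      ... | inj₁ refl = u∈T
      ... | inj₂ x∈Λ  = decidable-stable (x ∈? T) λ x∉T → Λ∖T≡∅ x (x∈Λ , x∉T)
      T≡ : insert u Λ ≡ T
      T≡ = Asc-⊆⇒≡ _ _ (Asc-insert u∉Λ Λ↑) T↑ Λ+u⊆T
      #≡ : #above u T ≡ m
      #≡ = trans (cong (#above u) (sym T≡)) (trans (weight-insert _ u Λ)
             (cong (ℕ._+ m) (indicator-no (u Fin.<? u) (Finₚ.<-irrefl refl))))
      flipped : neg^ m (χ (insert u Λ)) ≡ neg^ m τ
      flipped = trans (sym (χ-∷ʳ u Λ↑)) (trans (alt u∈T u∉Λ) (cong (λ i → neg^ i τ) #≡))
    alternating-sign c {T} {τ} T↑ τ≢0 |T∖Λ|≡c alt | inj₂ (a , (a∈Λ , a∉T) , _) =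
      trans (cong χ (sym S⊖a≡T)) (exchange-sign (least right?) (greatest left?))
      where
      S = insert a T
      S↑ : Asc S
      S↑ = Asc-insert a∉T T↑
      a∈S : a ∈ S
      a∈S = here-insert a T
      S⊖a≡T : S ⊖ a∈S ≡ T
      S⊖a≡T = Asc-⊆⇒≡ _ _ (Asc-⊖ S↑ a∈S) T↑ λ x∈ →
        let x∈S , x≢a = ∈-⊖⁻ S↑ a∈S x∈ in [ (λ x≡a → contradiction x≡a x≢a) , id ]′ (∈-insert⁻ a T x∈S)

      Free : Pred (Fin n) 0ℓ
      Free t = t ∈ T × t ∉ Λ
      free? : Decidable Free
      free? t = (t ∈? T) ×-dec ¬? (t ∈? Λ)
      Left Right : Pred (Fin n) 0ℓ
      Left  t = Free t × t Fin.< a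
      Right t = Free t × a Fin.< t
      left? : Decidable Left
      left? t = free? t ×-dec (t Fin.<? a)
      right? : Decidable Right
      right? t = free? t ×-dec (a Fin.<? t)

      side : ∀ {t} → Free t → t Fin.< a ⊎ a Fin.< t
      side {t} (t∈T , _) with Finₚ.<-cmp t a
      ... | tri< t<a _ _  = inj₁ t<a
      ... | tri≈ _ refl _ = contradiction t∈T a∉T
      ... | tri> _ _ a<t  = inj₂ a<t

      module Remove {u} (free-u : Free u) where
        u∈S : u ∈ S
        u∈S = there-insert a T (proj₁ free-u)
        Tᵤ = S ⊖ u∈S
        Tᵤ↑ : Asc Tᵤ
        Tᵤ↑ = Asc-⊖ S↑ u∈S

        weight-Tᵤ : ∀ w → w u ℕ.+ weight w Tᵤ ≡ w a ℕ.+ weight w T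
        weight-Tᵤ w = trans (sym (weight-⊖ w u∈S)) (weight-insert w a T)

        |Tᵤ∖Λ| : suc (weight outside Tᵤ) ≡ c
        |Tᵤ∖Λ| = trans (cong (ℕ._+ weight outside Tᵤ) (sym (indicator-yes (¬? (u ∈? Λ)) (proj₂ free-u))))
          (trans (weight-Tᵤ outside)
          (trans (cong (ℕ._+ weight outside T) (indicator-no (¬? (a ∈? Λ)) λ a∉Λ → a∉Λ a∈Λ)) |T∖Λ|≡c))

        free-Tᵤ : ∀ {t} → t ∈ Tᵤ → t ∉ Λ → Free t × t ≢ u
        free-Tᵤ t∈ t∉Λ with t∈S , t≢u ← ∈-⊖⁻ S↑ u∈S t∈ with ∈-insert⁻ a T t∈S
        ... | inj₁ refl = contradiction a∈Λ t∉Λ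
        ... | inj₂ t∈T  = (t∈T , t∉Λ) , t≢u

        #-same : ∀ {t} → (t Fin.< u × t Fin.< a) ⊎ (¬ t Fin.< u × ¬ t Fin.< a) →
                 #above t Tᵤ ≡ #above t T
        #-same {t} same with t Fin.<? u | t Fin.<? a | weight-Tᵤ (λ x → indicator (t Fin.<? x))
        #-same same                   | yes _   | yes _   | eq = ℕₚ.suc-injective eq
        #-same same                   | no  _   | no  _   | eq = eq
        #-same (inj₁ (_ , t<a))       | yes _   | no  t≮a | _  = contradiction t<a t≮a
        #-same (inj₂ (t≮u , _))       | yes t<u | no  _   | _  = contradiction t<u t≮u
        #-same (inj₁ (t<u , _))       | no  t≮u | yes _   | _  = contradiction t<u t≮u
        #-same (inj₂ (_ , t≮a))       | no  _   | yes t<a | _  = contradiction t<a t≮a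

        #-between : ∀ {t} → (t Fin.< u × ¬ t Fin.< a) ⊎ (¬ t Fin.< u × t Fin.< a) →
                    neg^ (#above t T) τ ≡ neg^ (#above t Tᵤ) (-ₛ τ)
        #-between {t} between with t Fin.<? u | t Fin.<? a | weight-Tᵤ (λ x → indicator (t Fin.<? x))
        #-between _                 | yes _ | no  _ | eq =
          trans (cong (λ i → neg^ i τ) (sym eq)) (sym (neg^-neg (#above _ Tᵤ) τ))
        #-between {t} _             | no  _ | yes _ | eq =
          trans (sym (trans (neg^-neg (suc (#above t T)) τ) (-ₛ-involutive _)))
            (cong (λ i → neg^ i (-ₛ τ)) (sym eq))
        #-between (inj₁ (_ , t≮a))  | yes _   | yes t<a | _ = contradiction t<a t≮a
        #-between (inj₂ (t≮u , _))  | yes t<u | yes _   | _ = contradiction t<u t≮u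
        #-between (inj₁ (t<u , _))  | no  t≮u | no  _   | _ = contradiction t<u t≮u
        #-between (inj₂ (_ , t<a))  | no  _   | no  t≮a | _ = contradiction t<a t≮a

      smaller : ∀ {u} (free-u : Free u) {σ} → σ ≢ [0] →
                AlternatesOn (Remove.Tᵤ free-u) σ → χ (Remove.Tᵤ free-u) ≡ σ
      smaller free-u σ≢0 alt′ = go c (Remove.|Tᵤ∖Λ| free-u)
        where
        go : ∀ c → suc (weight outside (Remove.Tᵤ free-u)) ≡ c → χ (Remove.Tᵤ free-u) ≡ _
        go zero    ()
        go (suc c) eq = alternating-sign c (Remove.Tᵤ↑ free-u) σ≢0 (ℕₚ.suc-injective eq) alt′

      keeps-sign : ∀ {u} (free-u : Free u) →
        (∀ {t} → Free t → t ≢ u → (t Fin.< u × t Fin.< a) ⊎ (¬ t Fin.< u × ¬ t Fin.< a)) →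
        χ (Remove.Tᵤ free-u) ≡ τ
      keeps-sign free-u same = smaller free-u τ≢0 λ t∈ t∉Λ →
        let free-t , t≢u = free-Tᵤ t∈ t∉Λ in
        trans (alt (proj₁ free-t) t∉Λ) (cong (λ i → neg^ i τ) (sym (#-same (same free-t t≢u))))
        where open Remove free-u

      flips-sign : ∀ {u} (free-u : Free u) →
        (∀ {t} → Free t → t ≢ u → (t Fin.< u × ¬ t Fin.< a) ⊎ (¬ t Fin.< u × t Fin.< a)) →
        χ (Remove.Tᵤ free-u) ≡ -ₛ τ
      flips-sign free-u between = smaller free-u (neg^-≢0 1 τ≢0) λ t∈ t∉Λ →
        let free-t , t≢u = free-Tᵤ t∈ t∉Λ in
        trans (alt (proj₁ free-t) t∉Λ) (#-between (between free-t t≢u))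
        where open Remove free-u

      -- Otherwise the k + 1 remaining entries of `T` would all be among the k entries of `Λ` other
      -- than `a`. This is why the nearest and the farthest free entry differ when all lie on one
      -- side of `a`.
      not-single : ∀ {u} → Free u → ¬ (∀ {t} → Free t → t ≡ u)
      not-single {u} (u∈T , u∉Λ) single = Asc-⊈-shorter (T ⊖ u∈T) (Λ ⊖ a∈Λ) (Asc-⊖ T↑ u∈T) λ {x} x∈ →
        let x∈T , x≢u = ∈-⊖⁻ T↑ u∈T x∈ in
        ∈-⊖⁺ a∈Λ (decidable-stable (x ∈? Λ) λ x∉Λ → x≢u (single (x∈T , x∉Λ)))
          λ { refl → a∉T x∈T }

      exchange-sign : (∀ x → ¬ Right x) ⊎ (∃ λ x → Right x × (∀ y → Right y → x Fin.≤ y)) →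
                      (∀ x → ¬ Left x) ⊎ (∃ λ x → Left x × (∀ y → Left y → y Fin.≤ x)) →
                      χ (S ⊖ a∈S) ≡ τ
      exchange-sign (inj₂ (r , (fr , a<r) , r-min)) (inj₂ (l , (fl , l<a) , l-max)) =
        degree-middle S↑ (Remove.u∈S fl) a∈S (Remove.u∈S fr) l<a a<r τ≢0
          (keeps-sign fl λ ft t≢l → [ (λ t<a → inj₁ (Finₚ.≤∧≢⇒< (l-max _ (ft , t<a)) t≢l , t<a))
                                    , (λ a<t → inj₂ (Finₚ.<-asym (Finₚ.<-trans l<a a<t) , Finₚ.<-asym a<t)) ]′ (side ft))
          (keeps-sign fr λ ft t≢r → [ (λ t<a → inj₁ (Finₚ.<-trans t<a a<r , t<a))
                                    , (λ a<t → inj₂ (ℕₚ.≤⇒≯ (r-min _ (ft , a<t)) , Finₚ.<-asym a<t)) ]′ (side ft))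
      exchange-sign (inj₁ no-right) (inj₁ no-left) = ⊥-elim (Asc-⊈-shorter T Λ T↑ λ {x} x∈T →
        decidable-stable (x ∈? Λ) λ x∉Λ →
          [ (λ x<a → no-left x ((x∈T , x∉Λ) , x<a)) , (λ a<x → no-right x ((x∈T , x∉Λ) , a<x)) ]′ (side (x∈T , x∉Λ)))
      exchange-sign (inj₂ (r , (fr , a<r) , r-min)) (inj₁ no-left) with greatest right?
      ... | inj₁ none = contradiction (fr , a<r) (none r)
      ... | inj₂ (g , (fg , a<g) , g-max) =
        degree-first S↑ a∈S (Remove.u∈S fr) (Remove.u∈S fg) a<r r<g
          (flips-sign fg λ ft t≢g → inj₁ (Finₚ.≤∧≢⇒< (g-max _ (right ft)) t≢g , Finₚ.<-asym (proj₂ (right ft))))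
          (keeps-sign fr λ ft t≢r → inj₂ (ℕₚ.≤⇒≯ (r-min _ (right ft)) , Finₚ.<-asym (proj₂ (right ft))))
        where
        right : ∀ {t} → Free t → Right t
        right ft = [ (λ t<a → contradiction (ft , t<a) (no-left _)) , (ft ,_) ]′ (side ft)
        r<g : r Fin.< g
        r<g = Finₚ.≤∧≢⇒< (g-max _ (fr , a<r)) λ { refl → not-single fr λ ft →
                Finₚ.≤-antisym (g-max _ (right ft)) (r-min _ (right ft)) }
      exchange-sign (inj₁ no-right) (inj₂ (l , (fl , l<a) , l-max)) with least left?
      ... | inj₁ none = contradiction (fl , l<a) (none l)
      ... | inj₂ (s , (fs , s<a) , s-min) =
        degree-last S↑ (Remove.u∈S fs) (Remove.u∈S fl) a∈S s<l l<a τ≢0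
          (flips-sign fs λ ft t≢s → inj₂ (ℕₚ.≤⇒≯ (s-min _ (left ft)) , proj₂ (left ft)))
          (keeps-sign fl λ ft t≢l → inj₁ (Finₚ.≤∧≢⇒< (l-max _ (left ft)) t≢l , proj₂ (left ft)))
        where
        left : ∀ {t} → Free t → Left t
        left ft = [ (ft ,_) , (λ a<t → contradiction (ft , a<t) (no-right _)) ]′ (side ft)
        s<l : s Fin.< l
        s<l = Finₚ.≤∧≢⇒< (l-max _ (fs , s<a)) λ { refl → not-single fl λ ft →
                Finₚ.≤-antisym (l-max _ (left ft)) (s-min _ (left ft)) }

-- Rational inequalities

≤-by-difference : ∀ {p q} r → 0ℚ ℚ.≤ r → r ≡ q ℚ.- p → p ℚ.≤ q
≤-by-difference {p} {q} r 0≤r r≡ =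
  subst₂ ℚ._≤_ (ℚₚ.+-identityˡ p) (trans (cong (_+ p) r≡) (cancel p q)) (ℚₚ.+-monoˡ-≤ p 0≤r)
  where
  cancel : ∀ p q → (q ℚ.- p) + p ≡ q
  cancel = solve 2 (λ p q → (q :- p) :+ p := q) refl

<-by-difference : ∀ {p q} r → 0ℚ ℚ.< r → r ≡ q ℚ.- p → p ℚ.< q
<-by-difference {p} {q} r 0<r r≡ =
  subst₂ ℚ._<_ (ℚₚ.+-identityˡ p) (trans (cong (_+ p) r≡) (cancel p q)) (ℚₚ.+-monoˡ-< p 0<r)
  where
  cancel : ∀ p q → (q ℚ.- p) + p ≡ q
  cancel = solve 2 (λ p q → (q :- p) :+ p := q) refl

p≤q⇒0≤q-p : ∀ {p q} → p ℚ.≤ q → 0ℚ ℚ.≤ q ℚ.- p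
p≤q⇒0≤q-p {p} {q} p≤q = subst (ℚ._≤ q ℚ.- p) (ℚₚ.+-inverseʳ p) (ℚₚ.+-monoˡ-≤ (ℚ.- p) p≤q)

p<q⇒0<q-p : ∀ {p q} → p ℚ.< q → 0ℚ ℚ.< q ℚ.- p
p<q⇒0<q-p {p} {q} p<q = subst (ℚ._< q ℚ.- p) (ℚₚ.+-inverseʳ p) (ℚₚ.+-monoˡ-< (ℚ.- p) p<q)

0≤p+q : ∀ {p q} → 0ℚ ℚ.≤ p → 0ℚ ℚ.≤ q → 0ℚ ℚ.≤ p + q
0≤p+q = ℚₚ.+-mono-≤

0≤p*q : ∀ {p q} → 0ℚ ℚ.≤ p → 0ℚ ℚ.≤ q → 0ℚ ℚ.≤ p * q
0≤p*q {p} {q} 0≤p 0≤q = ℚₚ.nonNegative⁻¹ (p * q)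
  {{ℚₚ.nonNeg*nonNeg⇒nonNeg p {{ℚ.nonNegative 0≤p}} q {{ℚ.nonNegative 0≤q}}}}

0<p*q : ∀ {p q} → 0ℚ ℚ.< p → 0ℚ ℚ.< q → 0ℚ ℚ.< p * q
0<p*q {p} {q} 0<p 0<q = ℚₚ.positive⁻¹ (p * q)
  {{ℚₚ.pos*pos⇒pos p {{ℚ.positive 0<p}} q {{ℚ.positive 0<q}}}}

0<1 : 0ℚ ℚ.< 1ℚ
0<1 = ℚₚ.positive⁻¹ 1ℚ

0<½*p : ∀ {p} → 0ℚ ℚ.< p → 0ℚ ℚ.< ½ * p
0<½*p = 0<p*q (ℚₚ.positive⁻¹ ½)

½+½ : ∀ p → ½ * p + ½ * p ≡ p
½+½ p = trans (sym (ℚₚ.*-distribʳ-+ p ½ ½)) (ℚₚ.*-identityˡ p)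

-- The factor two is for `overtakes`: a point of a unit of length two can be at distance almost two
-- from the crossing.
common-half : ∀ {p q} → 0ℚ ℚ.< p → 0ℚ ℚ.< q →
              ∃ λ c → 0ℚ ℚ.< c × c + c ℚ.≤ p × c + c ℚ.≤ q
common-half {p} {q} 0<p 0<q =
  ½ * (p ℚ.⊓ q) , 0<½*p 0<p⊓q ,
  subst (ℚ._≤ p) (sym (½+½ _)) (ℚₚ.p⊓q≤p p q) , subst (ℚ._≤ q) (sym (½+½ _)) (ℚₚ.p⊓q≤q p q)
  where
  0<p⊓q : 0ℚ ℚ.< p ℚ.⊓ q
  0<p⊓q with ℚₚ.⊓-sel p q
  ... | inj₁ eq = subst (0ℚ ℚ.<_) (sym eq) 0<p
  ... | inj₂ eq = subst (0ℚ ℚ.<_) (sym eq) 0<q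

c≤c+c : ∀ {c} → 0ℚ ℚ.< c → c ℚ.≤ c + c
c≤c+c {c} 0<c = subst (ℚ._≤ c + c) (ℚₚ.+-identityʳ c) (ℚₚ.+-monoʳ-≤ c (ℚₚ.<⇒≤ 0<c))

quotient : ∀ p {q} → 0ℚ ℚ.< q → ∃ λ r → r * q ≡ p
quotient p {q} 0<q = p * ℚ.1/ q , trans (ℚₚ.*-assoc p (ℚ.1/ q) q)
    (trans (cong (p *_) (ℚₚ.*-inverseˡ q)) (ℚₚ.*-identityʳ p))
  where
  instance
    q≢0 : ℚ.NonZero q
    q≢0 = ℚ.>-nonZero 0<q

-- Lipschitz functions

record Lipschitz (f : ℚ → ℚ) : Set where
  constructor lipschitz
  field
    constant   : ℚ
    constant≥0 : 0ℚ ℚ.≤ constant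
    bound      : ∀ p q → ℚ.∣ f p ℚ.- f q ∣ ℚ.≤ constant * ℚ.∣ p ℚ.- q ∣

-- A rational modulus that is independent of the point is what allows a function on ℚ to be applied
-- to Cauchy sequences term by term.
record UniformlyContinuous (f : ℚ → ℚ) : Set where
  constructor uniformly
  field
    modulus : ∀ ε → 0ℚ ℚ.< ε →
      ∃ λ δ → 0ℚ ℚ.< δ × (∀ p q → ℚ.∣ p ℚ.- q ∣ ℚ.< δ → ℚ.∣ f p ℚ.- f q ∣ ℚ.< ε)
open UniformlyContinuous

Lipschitz⇒UniformlyContinuous : ∀ {f} → Lipschitz f → UniformlyContinuous f
modulus (Lipschitz⇒UniformlyContinuous {f} (lipschitz K 0≤K f-lip)) ε 0<ε = δ , 0<δ , λ p q ∣p-q∣<δ →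
  ℚₚ.≤-<-trans (f-lip p q) (ℚₚ.≤-<-trans
    (≤-by-difference ℚ.∣ p ℚ.- q ∣ (ℚₚ.0≤∣p∣ _) (solve 2 (λ K d → d := (K :+ con 1ℚ) :* d :- K :* d) refl K _))
    (subst ((K + 1ℚ) * ℚ.∣ p ℚ.- q ∣ ℚ.<_) (trans (ℚₚ.*-comm (K + 1ℚ) δ) δ*≡)
      (ℚₚ.*-monoʳ-<-pos (K + 1ℚ) {{ℚ.positive 0<K+1}} ∣p-q∣<δ)))
  where
  0<K+1 : 0ℚ ℚ.< K + 1ℚ
  0<K+1 = ℚₚ.+-mono-≤-< 0≤K 0<1
  δ = proj₁ (quotient ε 0<K+1)
  δ*≡ : δ * (K + 1ℚ) ≡ ε
  δ*≡ = proj₂ (quotient ε 0<K+1)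
  0<δ : 0ℚ ℚ.< δ
  0<δ = ℚₚ.*-cancelʳ-<-nonNeg (K + 1ℚ) {{ℚₚ.pos⇒nonNeg (K + 1ℚ) {{ℚ.positive 0<K+1}}}}
          (subst₂ ℚ._<_ (sym (ℚₚ.*-zeroˡ (K + 1ℚ))) (sym δ*≡) 0<ε)

Lipschitz-const : ∀ c → Lipschitz (λ _ → c)
Lipschitz-const c = lipschitz 0ℚ ℚₚ.≤-refl λ p q → ℚₚ.≤-reflexive
  (trans (cong ℚ.∣_∣ (ℚₚ.+-inverseʳ c)) (sym (ℚₚ.*-zeroˡ ℚ.∣ p ℚ.- q ∣)))

Lipschitz-+ : ∀ {f g} → Lipschitz f → Lipschitz g → Lipschitz (λ p → f p + g p)
Lipschitz-+ {f} {g} (lipschitz K 0≤K f-lip) (lipschitz L 0≤L g-lip) = lipschitz (K + L) (0≤p+q 0≤K 0≤L) λ p q →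
  subst₂ ℚ._≤_
    (cong ℚ.∣_∣ (solve 4 (λ a b c d → (a :- c) :+ (b :- d) := (a :+ b) :- (c :+ d)) refl
                  (f p) (g p) (f q) (g q)))
    (sym (ℚₚ.*-distribʳ-+ ℚ.∣ p ℚ.- q ∣ K L))
    (ℚₚ.≤-trans (ℚₚ.∣p+q∣≤∣p∣+∣q∣ (f p ℚ.- f q) (g p ℚ.- g q)) (ℚₚ.+-mono-≤ (f-lip p q) (g-lip p q)))

Lipschitz-scale : ∀ c {f} → Lipschitz f → Lipschitz (λ p → c * f p)
Lipschitz-scale c {f} (lipschitz K 0≤K f-lip) = lipschitz (ℚ.∣ c ∣ * K) (0≤p*q (ℚₚ.0≤∣p∣ c) 0≤K) λ p q →
  subst₂ ℚ._≤_
    (trans (sym (ℚₚ.∣p*q∣≡∣p∣*∣q∣ c _))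
      (cong ℚ.∣_∣ (solve 3 (λ c a b → c :* (a :- b) := c :* a :- c :* b) refl c (f p) (f q))))
    (sym (ℚₚ.*-assoc ℚ.∣ c ∣ K _))
    (ℚₚ.*-monoˡ-≤-nonNeg ℚ.∣ c ∣ {{ℚₚ.∣-∣-nonNeg c}} (f-lip p q))

Lipschitz-translate : ∀ c {f} → Lipschitz f → Lipschitz (λ p → f (p ℚ.- c))
Lipschitz-translate c {f} (lipschitz K 0≤K f-lip) = lipschitz K 0≤K λ p q →
  subst (λ d → ℚ.∣ f (p ℚ.- c) ℚ.- f (q ℚ.- c) ∣ ℚ.≤ K * ℚ.∣ d ∣)
    (solve 3 (λ p q c → (p :- c) :- (q :- c) := p :- q) refl p q c) (f-lip (p ℚ.- c) (q ℚ.- c))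

clamp : ℚ → ℚ
clamp p = 0ℚ ℚ.⊔ (p ℚ.⊓ 1ℚ)

clamp-≤0 : ∀ {p} → p ℚ.≤ 0ℚ → clamp p ≡ 0ℚ
clamp-≤0 {p} p≤0 = ℚₚ.p≥q⇒p⊔q≡p (ℚₚ.p≤q⇒p⊓r≤q 1ℚ p≤0)

clamp-≥1 : ∀ {p} → 1ℚ ℚ.≤ p → clamp p ≡ 1ℚ
clamp-≥1 {p} 1≤p = cong (0ℚ ℚ.⊔_) (ℚₚ.p≥q⇒p⊓q≡q 1≤p)

clamp-unit : ∀ {p} → 0ℚ ℚ.≤ p → p ℚ.≤ 1ℚ → clamp p ≡ p
clamp-unit {p} 0≤p p≤1 = trans (cong (0ℚ ℚ.⊔_) (ℚₚ.p≤q⇒p⊓q≡p p≤1)) (ℚₚ.p≤q⇒p⊔q≡q 0≤p)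

clamp-mono : ∀ {p q} → p ℚ.≤ q → clamp p ℚ.≤ clamp q
clamp-mono p≤q = ℚₚ.⊔-monoʳ-≤ 0ℚ (ℚₚ.⊓-monoˡ-≤ 1ℚ p≤q)

clamp-growth : ∀ {p q} → p ℚ.≤ q → clamp q ℚ.≤ clamp p + (q ℚ.- p)
clamp-growth {p} {q} p≤q = ℚₚ.⊔-lub (0≤p+q (ℚₚ.p≤p⊔q 0ℚ (p ℚ.⊓ 1ℚ)) 0≤q-p)
    (ℚₚ.≤-trans capped (ℚₚ.+-monoˡ-≤ (q ℚ.- p) (ℚₚ.p≤q⊔p 0ℚ (p ℚ.⊓ 1ℚ))))
  where
  0≤q-p = p≤q⇒0≤q-p p≤q
  capped : q ℚ.⊓ 1ℚ ℚ.≤ p ℚ.⊓ 1ℚ + (q ℚ.- p)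
  capped with ℚₚ.⊓-sel p 1ℚ
  ... | inj₁ eq = ℚₚ.≤-trans (ℚₚ.p⊓q≤p q 1ℚ) (ℚₚ.≤-reflexive
          (trans (solve 2 (λ p q → q := p :+ (q :- p)) refl p q) (cong (_+ (q ℚ.- p)) (sym eq))))
  ... | inj₂ eq = ℚₚ.≤-trans (ℚₚ.p⊓q≤q q 1ℚ)
          (subst (λ r → 1ℚ ℚ.≤ r + (q ℚ.- p)) (sym eq)
            (≤-by-difference _ 0≤q-p (solve 1 (λ d → d := (con 1ℚ :+ d) :- con 1ℚ) refl _)))

Lipschitz-clamp : Lipschitz clamp
Lipschitz-clamp = lipschitz 1ℚ (ℚₚ.<⇒≤ 0<1) λ p q →
  subst (ℚ.∣ clamp p ℚ.- clamp q ∣ ℚ.≤_) (sym (ℚₚ.*-identityˡ _)) (bound p q)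
  where
  ordered : ∀ {p q} → p ℚ.≤ q → ℚ.∣ clamp q ℚ.- clamp p ∣ ℚ.≤ ℚ.∣ q ℚ.- p ∣
  ordered {p} {q} p≤q = subst₂ ℚ._≤_
    (sym (ℚₚ.0≤p⇒∣p∣≡p (p≤q⇒0≤q-p (clamp-mono p≤q)))) (sym (ℚₚ.0≤p⇒∣p∣≡p (p≤q⇒0≤q-p p≤q)))
    (≤-by-difference _ (p≤q⇒0≤q-p (clamp-growth p≤q))
      (solve 3 (λ a b d → (a :+ d) :- b := d :- (b :- a)) refl (clamp p) (clamp q) (q ℚ.- p)))
  ∣-∣-comm : ∀ p q → ℚ.∣ p ℚ.- q ∣ ≡ ℚ.∣ q ℚ.- p ∣
  ∣-∣-comm p q = trans (sym (ℚₚ.∣-p∣≡∣p∣ (p ℚ.- q)))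
    (cong ℚ.∣_∣ (solve 2 (λ p q → :- (p :- q) := q :- p) refl p q))
  bound : ∀ p q → ℚ.∣ clamp p ℚ.- clamp q ∣ ℚ.≤ ℚ.∣ p ℚ.- q ∣
  bound p q with ℚₚ.≤-total p q
  ... | inj₁ p≤q = subst₂ ℚ._≤_ (∣-∣-comm (clamp q) (clamp p)) (∣-∣-comm q p) (ordered p≤q)
  ... | inj₂ q≤p = ordered q≤p

-- Piecewise linear functions

-- Gaps sit at the even integers and points at the odd ones. A unit is the interval between
-- consecutive gaps, with one point in its middle.
gap mid : ℕ → ℚ
gap zero    = 0ℚ
gap (suc j) = mid j + 1ℚ
mid j = gap j + 1ℚ

p≤p+1 : ∀ p → p ℚ.≤ p + 1ℚ
p≤p+1 p = ≤-by-difference 1ℚ (ℚₚ.<⇒≤ 0<1) (solve 1 (λ p → con 1ℚ := (p :+ con 1ℚ) :- p) refl p)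

gap≤mid : ∀ j → gap j ℚ.≤ mid j
gap≤mid j = p≤p+1 (gap j)

mid≤gap : ∀ j → mid j ℚ.≤ gap (suc j)
mid≤gap j = p≤p+1 (mid j)

gap-mono : ∀ {i j} → i ℕ.≤ j → gap i ℚ.≤ gap j
gap-mono {i} i≤j = go (ℕₚ.≤⇒≤′ i≤j)
  where
  go : ∀ {j} → i ℕ.≤′ j → gap i ℚ.≤ gap j
  go ℕ.≤′-refl            = ℚₚ.≤-refl
  go (ℕ.≤′-step {j} i≤j) = ℚₚ.≤-trans (go i≤j) (ℚₚ.≤-trans (gap≤mid j) (mid≤gap j))

≤-shift-down : ∀ {p q r} → p ℚ.≤ q + r → p ℚ.- q ℚ.≤ r
≤-shift-down {p} {q} {r} p≤q+r = ≤-by-difference _ (p≤q⇒0≤q-p p≤q+r)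
  (solve 3 (λ p q r → (q :+ r) :- p := r :- (p :- q)) refl p q r)

≤-shift-up : ∀ {p q r} → q + r ℚ.≤ p → r ℚ.≤ p ℚ.- q
≤-shift-up {p} {q} {r} q+r≤p = ≤-by-difference _ (p≤q⇒0≤q-p q+r≤p)
  (solve 3 (λ p q r → p :- (q :+ r) := (p :- q) :- r) refl p q r)

p≤q⇒p-q≤0 : ∀ {p q} → p ℚ.≤ q → p ℚ.- q ℚ.≤ 0ℚ
p≤q⇒p-q≤0 {p} {q} p≤q = ≤-shift-down (subst (p ℚ.≤_) (sym (ℚₚ.+-identityʳ q)) p≤q)

-- The function with value G j at gap j and h j at mid j, constant outside [gap 0, gap m].
module _ (G h : ℕ → ℚ) where

  -- Clamped ramps instead of a definition by cases: the Lipschitz bound follows from the summands,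
  -- and a ramp stays constant once it is passed.
  rise : ℕ → ℚ → ℚ
  rise j y = (h j ℚ.- G j) * clamp (y ℚ.- gap j) + (G (suc j) ℚ.- h j) * clamp (y ℚ.- mid j)

  piecewise : ℕ → ℚ → ℚ
  piecewise zero    y = G 0
  piecewise (suc m) y = piecewise m y + rise m y

  Lipschitz-piecewise : ∀ m → Lipschitz (piecewise m)
  Lipschitz-piecewise zero    = Lipschitz-const (G 0)
  Lipschitz-piecewise (suc m) = Lipschitz-+ (Lipschitz-piecewise m)
    (Lipschitz-+ (Lipschitz-scale (h m ℚ.- G m) (Lipschitz-translate (gap m) Lipschitz-clamp))
                 (Lipschitz-scale (G (suc m) ℚ.- h m) (Lipschitz-translate (mid m) Lipschitz-clamp)))

  rise-left : ∀ j {y} → y ℚ.≤ gap j → rise j y ≡ 0ℚ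
  rise-left j {y} y≤g = trans
    (cong₂ (λ c d → (h j ℚ.- G j) * c + (G (suc j) ℚ.- h j) * d)
      (clamp-≤0 (p≤q⇒p-q≤0 y≤g)) (clamp-≤0 (p≤q⇒p-q≤0 (ℚₚ.≤-trans y≤g (gap≤mid j)))))
    (solve 2 (λ a b → a :* con 0ℚ :+ b :* con 0ℚ := con 0ℚ) refl (h j ℚ.- G j) (G (suc j) ℚ.- h j))

  rise-first : ∀ j {y} → gap j ℚ.≤ y → y ℚ.≤ mid j → rise j y ≡ (h j ℚ.- G j) * (y ℚ.- gap j)
  rise-first j {y} g≤y y≤m = trans
    (cong₂ (λ c d → (h j ℚ.- G j) * c + (G (suc j) ℚ.- h j) * d)
      (clamp-unit (p≤q⇒0≤q-p g≤y) (≤-shift-down y≤m)) (clamp-≤0 (p≤q⇒p-q≤0 y≤m)))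
    (solve 2 (λ a b → a :+ b :* con 0ℚ := a) refl _ (G (suc j) ℚ.- h j))

  rise-second : ∀ j {y} → mid j ℚ.≤ y → y ℚ.≤ gap (suc j) →
                rise j y ≡ (h j ℚ.- G j) + (G (suc j) ℚ.- h j) * (y ℚ.- mid j)
  rise-second j {y} m≤y y≤g = trans
    (cong₂ (λ c d → (h j ℚ.- G j) * c + (G (suc j) ℚ.- h j) * d)
      (clamp-≥1 (≤-shift-up m≤y)) (clamp-unit (p≤q⇒0≤q-p m≤y) (≤-shift-down y≤g)))
    (solve 2 (λ a b → a :* con 1ℚ :+ b := a :+ b) refl (h j ℚ.- G j) _)

  rise-right : ∀ j {y} → gap (suc j) ℚ.≤ y → rise j y ≡ G (suc j) ℚ.- G j
  rise-right j {y} g≤y = trans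
    (cong₂ (λ c d → (h j ℚ.- G j) * c + (G (suc j) ℚ.- h j) * d)
      (clamp-≥1 (≤-shift-up (ℚₚ.≤-trans (mid≤gap j) g≤y))) (clamp-≥1 (≤-shift-up g≤y)))
    (solve 3 (λ a b c → (a :- b) :* con 1ℚ :+ (c :- a) :* con 1ℚ := c :- b) refl (h j) (G j) (G (suc j)))

  piecewise-right : ∀ m {y} → gap m ℚ.≤ y → piecewise m y ≡ G m
  piecewise-right zero    _   = refl
  piecewise-right (suc m) g≤y = trans
    (cong₂ _+_ (piecewise-right m (ℚₚ.≤-trans (gap-mono (ℕₚ.n≤1+n m)) g≤y)) (rise-right m g≤y))
    (solve 2 (λ a b → a :+ (b :- a) := b) refl (G m) (G (suc m)))

  piecewise-left : ∀ {i m y} → i ℕ.≤ m → y ℚ.≤ gap i → piecewise m y ≡ piecewise i y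
  piecewise-left {i} {y = y} i≤m y≤g = go (ℕₚ.≤⇒≤′ i≤m)
    where
    go : ∀ {m} → i ℕ.≤′ m → piecewise m y ≡ piecewise i y
    go ℕ.≤′-refl           = refl
    go (ℕ.≤′-step {m} i≤m) = trans
      (cong₂ _+_ (go i≤m) (rise-left m (ℚₚ.≤-trans y≤g (gap-mono (ℕₚ.≤′⇒≤ i≤m)))))
      (ℚₚ.+-identityʳ _)

  piecewise-first : ∀ {j m} → j ℕ.< m → ∀ {y} → gap j ℚ.≤ y → y ℚ.≤ mid j →
                    piecewise m y ≡ G j + (h j ℚ.- G j) * (y ℚ.- gap j)
  piecewise-first {j} j<m g≤y y≤m = trans (piecewise-left j<m (ℚₚ.≤-trans y≤m (mid≤gap j)))
    (cong₂ _+_ (piecewise-right j g≤y) (rise-first j g≤y y≤m))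

  piecewise-second : ∀ {j m} → j ℕ.< m → ∀ {y} → mid j ℚ.≤ y → y ℚ.≤ gap (suc j) →
                     piecewise m y ≡ h j + (G (suc j) ℚ.- h j) * (y ℚ.- mid j)
  piecewise-second {j} j<m {y} m≤y y≤g = trans (piecewise-left j<m y≤g)
    (trans (cong₂ _+_ (piecewise-right j (ℚₚ.≤-trans (gap≤mid j) m≤y)) (rise-second j m≤y y≤g))
      (solve 3 (λ a b c → a :+ ((b :- a) :+ c) := b :+ c) refl (G j) (h j) _))

  piecewise-mid : ∀ {j m} → j ℕ.< m → piecewise m (mid j) ≡ h j
  piecewise-mid {j} j<m = trans (piecewise-second j<m ℚₚ.≤-refl (mid≤gap j))
    (solve 3 (λ a b c → a :+ b :* (c :- c) := a) refl (h j) (G (suc j) ℚ.- h j) (mid j))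

  piecewise-gap : ∀ {j m} → j ℕ.≤ m → piecewise m (gap j) ≡ G j
  piecewise-gap {j} j≤m = trans (piecewise-left j≤m ℚₚ.≤-refl) (piecewise-right j ℚₚ.≤-refl)

-- Comparison of two functions on an interval

-- The margin must be uniform in y: a strict inequality between terms of two sequences alone would
-- not survive in the limit.
Exceeds : (ℚ → ℚ) → (ℚ → ℚ) → ℚ → ℚ → Set
Exceeds f g l r = ∃ λ c → 0ℚ ℚ.< c × (∀ {y} → l ℚ.≤ y → y ℚ.≤ r → c + g y ℚ.≤ f y)

-- The linear bound away from the zero serves twice: it pins every common point of the unit to
-- `zero#`, and it yields the margins required for a crossing.
record Overtakes (f g : ℚ → ℚ) (l r : ℚ) : Set where
  field
    zero# rate : ℚ
    l<z    : l ℚ.< zero#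
    z<r    : zero# ℚ.< r
    rate>0 : 0ℚ ℚ.< rate
    after  : ∀ {y} → zero# ℚ.≤ y → y ℚ.≤ r → rate * (y ℚ.- zero#) + g y ℚ.≤ f y
    before : ∀ {y} → l ℚ.≤ y → y ℚ.≤ zero# → rate * (zero# ℚ.- y) + f y ℚ.≤ g y

module _ (P h : ℕ → ℚ) (Q k : ℕ → ℚ) {j m : ℕ} (j<m : j ℕ.< m) where

  private
    f g : ℚ → ℚ
    f = piecewise P h m
    g = piecewise Q k m
    α β γ : ℚ
    α = P j ℚ.- Q j
    β = h j ℚ.- k j
    γ = P (suc j) ℚ.- Q (suc j)

    first : ∀ {y} → gap j ℚ.≤ y → y ℚ.≤ mid j → f y ℚ.- g y ≡ α + (β ℚ.- α) * (y ℚ.- gap j)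
    first g≤y y≤m = trans (cong₂ ℚ._-_ (piecewise-first P h j<m g≤y y≤m) (piecewise-first Q k j<m g≤y y≤m))
      (solve 5 (λ a b c d w → (a :+ (b :- a) :* w) :- (c :+ (d :- c) :* w)
        := (a :- c) :+ ((b :- d) :- (a :- c)) :* w) refl (P j) (h j) (Q j) (k j) _)

    second : ∀ {y} → mid j ℚ.≤ y → y ℚ.≤ gap (suc j) → f y ℚ.- g y ≡ β + (γ ℚ.- β) * (y ℚ.- mid j)
    second m≤y y≤g = trans (cong₂ ℚ._-_ (piecewise-second P h j<m m≤y y≤g) (piecewise-second Q k j<m m≤y y≤g))
      (solve 5 (λ a b c d w → (a :+ (b :- a) :* w) :- (c :+ (d :- c) :* w)
        := (a :- c) :+ ((b :- d) :- (a :- c)) :* w) refl (h j) (P (suc j)) (k j) (Q (suc j)) _)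

    halves : ∀ {R : ℚ → Set} →
      (∀ {y} → gap j ℚ.≤ y → y ℚ.≤ mid j → R y) → (∀ {y} → mid j ℚ.≤ y → y ℚ.≤ gap (suc j) → R y) →
      ∀ {y} → gap j ℚ.≤ y → y ℚ.≤ gap (suc j) → R y
    halves r₁ r₂ {y} g≤y y≤g with ℚₚ.≤-total y (mid j)
    ... | inj₁ y≤m = r₁ g≤y y≤m
    ... | inj₂ m≤y = r₂ m≤y y≤g

  -- The difference is linear on each half, with values α, β, γ at the three nodes, so a lower bound
  -- at the nodes holds in between.
  exceeds : 0ℚ ℚ.< α → 0ℚ ℚ.< β → 0ℚ ℚ.< γ → Exceeds f g (gap j) (gap (suc j))
  exceeds 0<α 0<β 0<γ =
    d , 0<d , halves {λ y → d + g y ℚ.≤ f y}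
      (λ {y} g≤y y≤m → ≤-by-difference ((α ℚ.- d) * (mid j ℚ.- y) + (β ℚ.- d) * (y ℚ.- gap j))
        (0≤p+q (0≤p*q (p≤q⇒0≤q-p d≤α) (p≤q⇒0≤q-p y≤m)) (0≤p*q (p≤q⇒0≤q-p d≤β) (p≤q⇒0≤q-p g≤y)))
        (trans (solve 5 (λ a b d y g → (a :- d) :* ((g :+ con 1ℚ) :- y) :+ (b :- d) :* (y :- g)
                 := (a :+ (b :- a) :* (y :- g)) :- d) refl α β d y (gap j))
          (trans (cong (ℚ._- d) (sym (first g≤y y≤m)))
            (solve 3 (λ f g d → (f :- g) :- d := f :- (d :+ g)) refl (f y) (g y) d))))
      (λ {y} m≤y y≤g → ≤-by-difference ((β ℚ.- d) * (gap (suc j) ℚ.- y) + (γ ℚ.- d) * (y ℚ.- mid j))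
        (0≤p+q (0≤p*q (p≤q⇒0≤q-p d≤β) (p≤q⇒0≤q-p y≤g)) (0≤p*q (p≤q⇒0≤q-p d≤γ) (p≤q⇒0≤q-p m≤y)))
        (trans (solve 5 (λ a b d y g → (a :- d) :* ((g :+ con 1ℚ) :- y) :+ (b :- d) :* (y :- g)
                 := (a :+ (b :- a) :* (y :- g)) :- d) refl β γ d y (mid j))
          (trans (cong (ℚ._- d) (sym (second m≤y y≤g)))
            (solve 3 (λ f g d → (f :- g) :- d := f :- (d :+ g)) refl (f y) (g y) d))))
    where
    c = proj₁ (common-half 0<α 0<β)
    0<c = proj₁ (proj₂ (common-half 0<α 0<β))
    2c≤α = proj₁ (proj₂ (proj₂ (common-half 0<α 0<β)))
    2c≤β = proj₂ (proj₂ (proj₂ (common-half 0<α 0<β)))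
    d = proj₁ (common-half 0<c 0<γ)
    0<d = proj₁ (proj₂ (common-half 0<c 0<γ))
    2d≤c = proj₁ (proj₂ (proj₂ (common-half 0<c 0<γ)))
    2d≤γ = proj₂ (proj₂ (proj₂ (common-half 0<c 0<γ)))
    d≤c = ℚₚ.≤-trans (c≤c+c 0<d) 2d≤c
    d≤α = ℚₚ.≤-trans d≤c (ℚₚ.≤-trans (c≤c+c 0<c) 2c≤α)
    d≤β = ℚₚ.≤-trans d≤c (ℚₚ.≤-trans (c≤c+c 0<c) 2c≤β)
    d≤γ = ℚₚ.≤-trans (c≤c+c 0<d) 2d≤γ

  -- With s = β − α and ρ = β / s the difference vanishes at gap j + (1 − ρ).
  overtakes : α ℚ.< 0ℚ → 0ℚ ℚ.≤ β → 0ℚ ℚ.< γ → Overtakes f g (gap j) (gap (suc j))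
  overtakes α<0 0≤β 0<γ = record
    { zero# = z ; rate = c ; l<z = l<z ; z<r = ℚₚ.≤-<-trans z≤m m<r ; rate>0 = 0<c
    ; after = λ {y} z≤y → after (ℚₚ.≤-trans (ℚₚ.<⇒≤ l<z) z≤y) z≤y
    ; before = before }
    where
    s = β ℚ.- α
    -α = 0ℚ ℚ.- α
    0<-α : 0ℚ ℚ.< -α
    0<-α = p<q⇒0<q-p α<0
    -α≤s : -α ℚ.≤ s
    -α≤s = ≤-by-difference β 0≤β (solve 2 (λ a b → b := (b :- a) :- (con 0ℚ :- a)) refl α β)
    0<s : 0ℚ ℚ.< s
    0<s = ℚₚ.<-≤-trans 0<-α -α≤s
    ρ = proj₁ (quotient β 0<s)
    ρs≡β : ρ * s ≡ β
    ρs≡β = proj₂ (quotient β 0<s)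
    0≤ρ : 0ℚ ℚ.≤ ρ
    0≤ρ = ℚₚ.*-cancelʳ-≤-pos s {{ℚ.positive 0<s}} (subst₂ ℚ._≤_ (sym (ℚₚ.*-zeroˡ s)) (sym ρs≡β) 0≤β)
    ρ<1 : ρ ℚ.< 1ℚ
    ρ<1 = ℚₚ.*-cancelʳ-<-nonNeg s {{ℚₚ.pos⇒nonNeg s {{ℚ.positive 0<s}}}}
      (subst₂ ℚ._<_ (sym ρs≡β) (sym (ℚₚ.*-identityˡ s))
        (<-by-difference _ 0<-α (solve 2 (λ a b → con 0ℚ :- a := (b :- a) :- b) refl α β)))
    c = proj₁ (common-half 0<-α 0<γ)
    0<c = proj₁ (proj₂ (common-half 0<-α 0<γ))
    c≤s : c ℚ.≤ s
    c≤s = ℚₚ.≤-trans (c≤c+c 0<c) (ℚₚ.≤-trans (proj₁ (proj₂ (proj₂ (common-half 0<-α 0<γ)))) -α≤s)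
    2c≤γ = proj₂ (proj₂ (proj₂ (common-half 0<-α 0<γ)))
    z = gap j + (1ℚ ℚ.- ρ)
    l<z : gap j ℚ.< z
    l<z = <-by-difference _ (p<q⇒0<q-p ρ<1) (solve 2 (λ g w → w := (g :+ w) :- g) refl (gap j) _)
    z≤m : z ℚ.≤ mid j
    z≤m = ≤-by-difference ρ 0≤ρ (solve 2 (λ g r → r := (g :+ con 1ℚ) :- (g :+ (con 1ℚ :- r))) refl (gap j) ρ)
    m<r : mid j ℚ.< gap (suc j)
    m<r = <-by-difference 1ℚ 0<1 (solve 1 (λ m → con 1ℚ := (m :+ con 1ℚ) :- m) refl (mid j))

    first-slope : ∀ {y} → gap j ℚ.≤ y → y ℚ.≤ mid j → f y ℚ.- g y ≡ s * (y ℚ.- z)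
    first-slope {y} g≤y y≤m = trans (first g≤y y≤m)
      (trans (solve 4 (λ a b y g → a :+ (b :- a) :* (y :- g) := (b :- a) :* (y :- g) :-
              (b :- a) :+ b) refl α β y (gap j))
      (trans (cong (s * (y ℚ.- gap j) ℚ.- s +_) (sym ρs≡β))
        (solve 4 (λ s y g r → s :* (y :- g) :- s :+ r :* s := s :* (y :- (g :+ (con 1ℚ :- r)))) refl s y (gap j) ρ)))

    after : ∀ {y} → gap j ℚ.≤ y → z ℚ.≤ y → y ℚ.≤ gap (suc j) → c * (y ℚ.- z) + g y ℚ.≤ f y
    after {y} l≤y z≤y y≤r = halves {λ y → z ℚ.≤ y → c * (y ℚ.- z) + g y ℚ.≤ f y}
      (λ {y} l≤y y≤m z≤y → ≤-by-difference ((s ℚ.- c) * (y ℚ.- z))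
        (0≤p*q (p≤q⇒0≤q-p c≤s) (p≤q⇒0≤q-p z≤y))
        (trans (solve 3 (λ s c w → (s :- c) :* w := s :* w :- c :* w) refl s c (y ℚ.- z))
        (trans (cong (ℚ._- c * (y ℚ.- z)) (sym (first-slope l≤y y≤m)))
          (solve 3 (λ f g w → (f :- g) :- w := f :- (w :+ g)) refl (f y) (g y) (c * (y ℚ.- z))))))
      -- Right of the middle the difference minus c (y - z) is again linear: ρ (s - c) at `mid j`
      -- and (γ - 2c) + c (1 - ρ) at the right end, both nonnegative.
      (λ {y} m≤y y≤r z≤y → ≤-by-difference
        ((ρ * (s ℚ.- c)) * (gap (suc j) ℚ.- y) + ((γ ℚ.- (c + c)) + c * (1ℚ ℚ.- ρ)) * (y ℚ.- mid j))
        (0≤p+q (0≤p*q (0≤p*q 0≤ρ (p≤q⇒0≤q-p c≤s)) (p≤q⇒0≤q-p y≤r))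
          (0≤p*q (0≤p+q (p≤q⇒0≤q-p 2c≤γ) (0≤p*q (ℚₚ.<⇒≤ 0<c) (p≤q⇒0≤q-p (ℚₚ.<⇒≤ ρ<1)))) (p≤q⇒0≤q-p m≤y)))
        (trans (solve 6 (λ r s c t y g →
            (r :* (s :- c)) :* (((g :+ con 1ℚ) :+ con 1ℚ) :- y) :+ ((t :- (c :+ c)) :+ c :*
                    (con 1ℚ :- r)) :* (y :- (g :+ con 1ℚ))
            := (r :* s :+ (t :- r :* s) :* (y :- (g :+ con 1ℚ))) :- c :* (y :- (g :+ (con 1ℚ :- r))))
            refl ρ s c γ y (gap j))
        (trans (cong (λ b → (b + (γ ℚ.- b) * (y ℚ.- mid j)) ℚ.- c * (y ℚ.- z)) ρs≡β)
        (trans (cong (ℚ._- c * (y ℚ.- z)) (sym (second m≤y y≤r)))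
          (solve 3 (λ f g w → (f :- g) :- w := f :- (w :+ g)) refl (f y) (g y) (c * (y ℚ.- z)))))))
      l≤y y≤r z≤y

    before : ∀ {y} → gap j ℚ.≤ y → y ℚ.≤ z → c * (z ℚ.- y) + f y ℚ.≤ g y
    before {y} l≤y y≤z = ≤-by-difference ((s ℚ.- c) * (z ℚ.- y))
      (0≤p*q (p≤q⇒0≤q-p c≤s) (p≤q⇒0≤q-p y≤z))
      (trans (solve 4 (λ s c z y → (s :- c) :* (z :- y) := (:- (s :* (y :- z))) :- c :* (z :- y)) refl s c z y)
      (trans (cong (λ d → (ℚ.- d) ℚ.- c * (z ℚ.- y)) (sym (first-slope l≤y (ℚₚ.≤-trans y≤z z≤m))))
        (solve 3 (λ f g w → (:- (f :- g)) :- w := g :- (w :+ f)) refl (f y) (g y) (c * (z ℚ.- y)))))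

-- Absolute values of differences

p≤∣p∣ : ∀ p → p ℚ.≤ ℚ.∣ p ∣
p≤∣p∣ p with ℚₚ.≤-total 0ℚ p
... | inj₁ 0≤p = ℚₚ.≤-reflexive (sym (ℚₚ.0≤p⇒∣p∣≡p 0≤p))
... | inj₂ p≤0 = ℚₚ.≤-trans p≤0 (ℚₚ.0≤∣p∣ p)

∣p-q∣-sym : ∀ p q → ℚ.∣ p ℚ.- q ∣ ≡ ℚ.∣ q ℚ.- p ∣
∣p-q∣-sym p q = trans (sym (ℚₚ.∣-p∣≡∣p∣ (p ℚ.- q)))
  (cong ℚ.∣_∣ (solve 2 (λ p q → :- (p :- q) := q :- p) refl p q))

p≢q⇒0<∣p-q∣ : ∀ {p q} → p ≢ q → 0ℚ ℚ.< ℚ.∣ p ℚ.- q ∣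
p≢q⇒0<∣p-q∣ {p} {q} p≢q with ℚₚ.<-cmp p q
... | tri< p<q _ _ = subst (0ℚ ℚ.<_) (∣p-q∣-sym q p) (ℚₚ.<-≤-trans (p<q⇒0<q-p p<q) (p≤∣p∣ _))
... | tri≈ _ p≡q _ = contradiction p≡q p≢q
... | tri> _ _ q<p = ℚₚ.<-≤-trans (p<q⇒0<q-p q<p) (p≤∣p∣ _)

∣p-q∣<r⇒p<q+r : ∀ p q {r} → ℚ.∣ p ℚ.- q ∣ ℚ.< r → p ℚ.< q + r
∣p-q∣<r⇒p<q+r p q {r} lt = <-by-difference _ (p<q⇒0<q-p (ℚₚ.≤-<-trans (p≤∣p∣ _) lt))
  (solve 3 (λ p q r → r :- (p :- q) := (q :+ r) :- p) refl p q r)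

∣p-q∣<r⇒q<p+r : ∀ p q {r} → ℚ.∣ p ℚ.- q ∣ ℚ.< r → q ℚ.< p + r
∣p-q∣<r⇒q<p+r p q lt = ∣p-q∣<r⇒p<q+r q p (subst (ℚ._< _) (∣p-q∣-sym p q) lt)

-- Eventual properties of sequences

Eventually : (ℕ → Set) → Set
Eventually P = ∃ λ N → ∀ n → N ℕ.≤ n → P n

module _ {P Q : ℕ → Set} where

  Eventually-map : (∀ {n} → P n → Q n) → Eventually P → Eventually Q
  Eventually-map f (N , p) = N , λ n N≤n → f (p n N≤n)

  Eventually-zip : ∀ {R : ℕ → Set} → (∀ {n} → P n → Q n → R n) → Eventually P → Eventually Q → Eventually R
  Eventually-zip f (M , p) (N , q) = M ℕ.⊔ N , λ n ≤n →
    f (p n (ℕₚ.m⊔n≤o⇒m≤o M N ≤n)) (q n (ℕₚ.m⊔n≤o⇒n≤o M N ≤n))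

Eventually-∃ : ∀ {P : Set} → Eventually (λ _ → P) → P
Eventually-∃ (N , p) = p N ℕₚ.≤-refl

-- Curves from uniformly continuous functions

module _ {f : ℚ → ℚ} (f-uc : UniformlyContinuous f) where

  extend : ℝ → ℝ
  extend x = mkℝ (λ n → f (seq x n)) λ ε 0<ε →
    let δ , 0<δ , close = modulus f-uc ε 0<ε
        N , near        = cauchy x δ 0<δ
    in N , λ m n N≤m N≤n → close _ _ (near m n N≤m N≤n)

  extend-cong : ∀ {x y} → x ≈ y → extend x ≈ extend y
  extend-cong x≈y ε 0<ε = let δ , 0<δ , close = modulus f-uc ε 0<ε in
    Eventually-map (close _ _) (x≈y δ 0<δ)

  0<fromℚ : ∀ {d} → 0ℚ ℚ.< d → 0ℝ < fromℚ d
  0<fromℚ {d} 0<d = d , 0<d , 0 , λ _ _ → ℚₚ.≤-reflexive (ℚₚ.+-identityˡ d)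

  extend-continuous : Continuous extend
  extend-continuous x ε (e , 0<e , ε≥e) =
    let δ , 0<δ , close = modulus f-uc (½ * e) (0<½*p 0<e) in
    fromℚ δ , 0<fromℚ 0<δ , λ t (d , 0<d , ∣t-x∣≤δ-d) →
      ½ * e , 0<½*p 0<e , Eventually-zip
        (λ {n} 0+e≤ε le → ℚₚ.≤-trans
          (ℚₚ.<⇒≤ (subst (ℚ.∣ f (seq t n) ℚ.- f (seq x n) ∣ + ½ * e ℚ.<_) (½+½ e)
            (ℚₚ.+-monoˡ-< (½ * e) (close _ _
              (ℚₚ.<-≤-trans (subst (ℚ._< ℚ.∣ seq t n ℚ.- seq x n ∣ + d) (ℚₚ.+-identityʳ _)
                      (ℚₚ.+-monoʳ-< ℚ.∣ seq t n ℚ.- seq x n ∣ 0<d)) le)))))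
          (subst (ℚ._≤ seq ε n) (ℚₚ.+-identityˡ e) 0+e≤ε))
        ε≥e ∣t-x∣≤δ-d

  graph : Curve
  graph = record
    { func       = record { to = extend ; cong = λ {x} {y} → extend-cong {x} {y} }
    ; continuous = extend-continuous
    }

-- Reals at which two functions meet

module _ {f g : ℚ → ℚ} (x : ℝ) where

  MeetAt : Set
  MeetAt = ∀ ε → 0ℚ ℚ.< ε → Eventually λ n → ℚ.∣ f (seq x n) ℚ.- g (seq x n) ∣ ℚ.< ε

  -- Within `δ₃` of `p` each function moves by less than a quarter of `e`, so the difference cannot
  -- fall below e / 2 there, as it does at late terms of x. These terms are thus at least `δ₃` away
  -- from `p`, and the Cauchy bound `δ₃` keeps them on the side of `xN`.
  apart-from : UniformlyContinuous f → UniformlyContinuous g → MeetAt → ∀ {p} → f p ≢ g p →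
               Eventually (λ n → seq x n ℚ.≤ p) ⊎ Eventually (λ n → p ℚ.≤ seq x n)
  apart-from f-uc g-uc meet {p} fp≢gp = side (ℚₚ.≤-total xN p)
    where
    e = ℚ.∣ f p ℚ.- g p ∣
    0<e : 0ℚ ℚ.< e
    0<e = p≢q⇒0<∣p-q∣ fp≢gp
    0<e/2 = 0<½*p 0<e
    0<e/4 = 0<½*p 0<e/2
    δ₁ = proj₁ (modulus f-uc (½ * (½ * e)) 0<e/4)
    δ₂ = proj₁ (modulus g-uc (½ * (½ * e)) 0<e/4)
    0<δ₁ = proj₁ (proj₂ (modulus f-uc (½ * (½ * e)) 0<e/4))
    0<δ₂ = proj₁ (proj₂ (modulus g-uc (½ * (½ * e)) 0<e/4))
    δ₃ = proj₁ (common-half 0<δ₁ 0<δ₂)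
    0<δ₃ = proj₁ (proj₂ (common-half 0<δ₁ 0<δ₂))
    δ₃≤δ₁ = ℚₚ.≤-trans (c≤c+c 0<δ₃) (proj₁ (proj₂ (proj₂ (common-half 0<δ₁ 0<δ₂))))
    δ₃≤δ₂ = ℚₚ.≤-trans (c≤c+c 0<δ₃) (proj₂ (proj₂ (proj₂ (common-half 0<δ₁ 0<δ₂))))

    far : ∀ {y} → ℚ.∣ f y ℚ.- g y ∣ ℚ.< ½ * e → δ₃ ℚ.≤ ℚ.∣ p ℚ.- y ∣
    far {y} ∣fy-gy∣< = ℚₚ.≮⇒≥ λ near → ℚₚ.<-irrefl refl (ℚₚ.≤-<-trans
      (subst (λ d → ℚ.∣ d ∣ ℚ.≤ ℚ.∣ f p ℚ.- f y ∣ + (ℚ.∣ f y ℚ.- g y ∣ + ℚ.∣ g y ℚ.- g p ∣))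
        (solve 4 (λ a b c d → (a :- c) :+ ((c :- d) :+ (d :- b)) := a :- b) refl (f p) (g p) (f y) (g y))
        (ℚₚ.≤-trans (ℚₚ.∣p+q∣≤∣p∣+∣q∣ (f p ℚ.- f y) _)
          (ℚₚ.+-monoʳ-≤ ℚ.∣ f p ℚ.- f y ∣ (ℚₚ.∣p+q∣≤∣p∣+∣q∣ (f y ℚ.- g y) (g y ℚ.- g p)))))
      (subst (ℚ.∣ f p ℚ.- f y ∣ + (ℚ.∣ f y ℚ.- g y ∣ + ℚ.∣ g y ℚ.- g p ∣) ℚ.<_) quarters
        (ℚₚ.+-mono-< (proj₂ (proj₂ (modulus f-uc (½ * (½ * e)) 0<e/4)) p y (ℚₚ.<-≤-trans near δ₃≤δ₁))
          (ℚₚ.+-mono-< ∣fy-gy∣<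
            (subst (ℚ._< _) (∣p-q∣-sym (g p) (g y)) (proj₂ (proj₂ (modulus g-uc (½ *
                    (½ * e)) 0<e/4)) p y (ℚₚ.<-≤-trans near δ₃≤δ₂)))))))
      where
      quarters : ½ * (½ * e) + (½ * e + ½ * (½ * e)) ≡ e
      quarters = trans (solve 2 (λ a b → a :+ (b :+ a) := (a :+ a) :+ b) refl (½ * (½ * e)) (½ * e))
        (trans (cong (_+ ½ * e) (½+½ (½ * e))) (½+½ e))

    N = proj₁ (meet (½ * e) 0<e/2) ℕ.⊔ proj₁ (cauchy x δ₃ 0<δ₃)
    xN = seq x N
    near-xN : ∀ n → N ℕ.≤ n → ℚ.∣ xN ℚ.- seq x n ∣ ℚ.< ℚ.∣ p ℚ.- xN ∣
    near-xN n N≤n = ℚₚ.<-≤-trans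
      (proj₂ (cauchy x δ₃ 0<δ₃) N n (ℕₚ.m≤n⊔m (proj₁ (meet (½ * e) 0<e/2)) _)
        (ℕₚ.≤-trans (ℕₚ.m≤n⊔m (proj₁ (meet (½ * e) 0<e/2)) _) N≤n))
      (far (proj₂ (meet (½ * e) 0<e/2) N (ℕₚ.m≤m⊔n _ _)))

    side : xN ℚ.≤ p ⊎ p ℚ.≤ xN → Eventually (λ n → seq x n ℚ.≤ p) ⊎ Eventually (λ n → p ℚ.≤ seq x n)
    side (inj₁ xN≤p) = inj₁ (N , λ n N≤n → ℚₚ.<⇒≤ (subst (seq x n ℚ.<_)
      (trans (cong (xN +_) (ℚₚ.0≤p⇒∣p∣≡p (p≤q⇒0≤q-p xN≤p))) (solve 2 (λ a b → a :+ (b :- a) := b) refl xN p))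
      (∣p-q∣<r⇒q<p+r xN (seq x n) (near-xN n N≤n))))
    side (inj₂ p≤xN) = inj₂ (N , λ n N≤n → ℚₚ.<⇒≤ (<-by-difference _
      (p<q⇒0<q-p (subst (λ r → xN ℚ.< seq x n + r)
        (trans (∣p-q∣-sym p xN) (ℚₚ.0≤p⇒∣p∣≡p (p≤q⇒0≤q-p p≤xN)))
        (∣p-q∣<r⇒p<q+r xN (seq x n) (near-xN n N≤n))))
      (solve 3 (λ a b c → (b :+ (a :- c)) :- a := b :- c) refl xN (seq x n) p)))

  not-eventually-apart : MeetAt → ∀ {c} → 0ℚ ℚ.< c →
                         ¬ Eventually (λ n → c ℚ.≤ ℚ.∣ f (seq x n) ℚ.- g (seq x n) ∣)
  not-eventually-apart meet 0<c apart =
    Eventually-∃ (Eventually-zip (λ lt le → ℚₚ.<-irrefl refl (ℚₚ.<-≤-trans lt le)) (meet _ 0<c) apart)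

module _ {f g : ℚ → ℚ} (x : ℝ) {l r : ℚ} (meet : MeetAt {f} {g} x)
         (x∈[l,r] : Eventually λ n → l ℚ.≤ seq x n × seq x n ℚ.≤ r) where

  ¬Exceeds : ¬ Exceeds f g l r
  ¬Exceeds (c , 0<c , excess) = not-eventually-apart {f} {g} x meet 0<c (Eventually-map
    (λ {n} (l≤x , x≤r) → ℚₚ.≤-trans
      (≤-by-difference _ (p≤q⇒0≤q-p (excess l≤x x≤r))
        (solve 3 (λ a b c → a :- (c :+ b) := (a :- b) :- c) refl (f (seq x n)) (g (seq x n)) c))
      (p≤∣p∣ _))
    x∈[l,r])

  module _ (ov : Overtakes f g l r) where
    open Overtakes ov

    -- The two functions differ at y by at least `rate` times the distance from y to the zero, so
    -- closeness of values forces closeness to the zero.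
    meet-at-zero : x ≈ fromℚ zero#
    meet-at-zero ε 0<ε = Eventually-zip
        (λ {n} (l≤x , x≤r) lt → close (seq x n) l≤x x≤r lt)
        x∈[l,r] (meet (rate * ε) (0<p*q rate>0 0<ε))
      where
      instance
        rate⁺ : ℚ.NonNegative rate
        rate⁺ = ℚₚ.pos⇒nonNeg rate {{ℚ.positive rate>0}}
      close : ∀ y → l ℚ.≤ y → y ℚ.≤ r → ℚ.∣ f y ℚ.- g y ∣ ℚ.< rate * ε → ℚ.∣ y ℚ.- zero# ∣ ℚ.< ε
      close y l≤y y≤r lt with ℚₚ.≤-total y zero#
      ... | inj₁ y≤z = subst (ℚ._< ε) (trans (sym (ℚₚ.0≤p⇒∣p∣≡p (p≤q⇒0≤q-p y≤z))) (∣p-q∣-sym zero# y))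
            (ℚₚ.*-cancelˡ-<-nonNeg rate (ℚₚ.≤-<-trans
              (≤-by-difference _ (p≤q⇒0≤q-p (before l≤y y≤z))
                (solve 3 (λ a b c → b :- (c :+ a) := (b :- a) :- c) refl (f y) (g y) _))
              (ℚₚ.≤-<-trans (p≤∣p∣ _) (subst (ℚ._< rate * ε) (∣p-q∣-sym (f y) (g y)) lt))))
      ... | inj₂ z≤y = subst (ℚ._< ε) (sym (ℚₚ.0≤p⇒∣p∣≡p (p≤q⇒0≤q-p z≤y)))
            (ℚₚ.*-cancelˡ-<-nonNeg rate (ℚₚ.≤-<-trans
              (≤-by-difference _ (p≤q⇒0≤q-p (after z≤y y≤r))
                (solve 3 (λ a b c → a :- (c :+ b) := (a :- b) :- c) refl (f y) (g y) _))
              (ℚₚ.≤-<-trans (p≤∣p∣ _) lt)))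

    l<x : fromℚ l < x
    l<x = ½ * (zero# ℚ.- l) , 0<half , Eventually-map
        (λ {n} near → ℚₚ.<⇒≤ (<-by-difference _ (p<q⇒0<q-p (∣p-q∣<r⇒q<p+r (seq x n) zero# near))
          (trans (solve 4 (λ x h z l → (x :+ h) :- z := (x :- (l :+ h)) :+ ((h :+ h) :- (z :- l))) refl
                   (seq x n) (½ * (zero# ℚ.- l)) zero# l)
            (trans (cong (λ d → (seq x n ℚ.- (l + ½ * (zero# ℚ.- l))) + (d ℚ.- (zero# ℚ.- l))) (½+½ (zero# ℚ.- l)))
              (solve 2 (λ a b → a :+ (b :- b) := a) refl _ (zero# ℚ.- l))))))
        (meet-at-zero _ 0<half)
      where 0<half = 0<½*p (p<q⇒0<q-p l<z)

    x<r : x < fromℚ r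
    x<r = ½ * (r ℚ.- zero#) , 0<half , Eventually-map
        (λ {n} near → ℚₚ.<⇒≤ (<-by-difference _ (p<q⇒0<q-p (∣p-q∣<r⇒p<q+r (seq x n) zero# near))
          (trans (solve 4 (λ x h z r → (z :+ h) :- x := (r :- (x :+ h)) :+ ((h :+ h) :- (r :- z))) refl
                   (seq x n) (½ * (r ℚ.- zero#)) zero# r)
            (trans (cong (λ d → (r ℚ.- (seq x n + ½ * (r ℚ.- zero#))) + (d ℚ.- (r ℚ.- zero#))) (½+½ (r ℚ.- zero#)))
              (solve 2 (λ a b → a :+ (b :- b) := a) refl _ (r ℚ.- zero#))))))
        (meet-at-zero _ 0<half)
      where 0<half = 0<½*p (p<q⇒0<q-p z<r)

    module _ (f-uc : UniformlyContinuous f) (g-uc : UniformlyContinuous g) where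

      -- Terms of x only tend to `zero#`. Half of the margin between t and x pays for passing to
      -- `zero#`; the other half, multiplied by `rate`, becomes the margin between the heights.
      crosses-up : CrossesUp (fromℚ l) x (fromℚ r) (graph f-uc) (graph g-uc)
      crosses-up =
        (λ t (d , 0<d , l+d≤t) (e , 0<e , t+e≤x) → rate * (½ * e) , 0<p*q rate>0 (0<½*p 0<e) ,
          Eventually-zip
            (λ {n} (l+d≤tₙ , t+e≤xₙ) near →
              let t+h≤z = below-zero {seq t n} {seq x n} (subst (λ e → seq t n + e ℚ.≤ seq x n)
                      (sym (½+½ e)) t+e≤xₙ) near in
              growth {½ * e} (≤-shift-up {q = seq t n} t+h≤z)
                (before (ℚₚ.≤-trans (p≤p+q 0<d) l+d≤tₙ) (ℚₚ.≤-trans (p≤p+q (0<½*p 0<e)) t+h≤z)))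
            (Eventually-zip _,_ l+d≤t t+e≤x) (meet-at-zero _ (0<½*p 0<e))) ,
        (λ t (e , 0<e , x+e≤t) (d , 0<d , t+d≤r) → rate * (½ * e) , 0<p*q rate>0 (0<½*p 0<e) ,
          Eventually-zip
            (λ {n} (x+e≤tₙ , t+d≤rₙ) near →
              let z+h≤t = above-zero {seq t n} {seq x n} (subst (λ e → seq x n + e ℚ.≤ seq t n)
                      (sym (½+½ e)) x+e≤tₙ) near in
              growth {½ * e} (≤-shift-up {q = zero#} z+h≤t)
                (after (ℚₚ.≤-trans (p≤p+q (0<½*p 0<e)) z+h≤t) (ℚₚ.≤-trans (p≤p+q 0<d) t+d≤rₙ)))
            (Eventually-zip _,_ x+e≤t t+d≤r) (meet-at-zero _ (0<½*p 0<e)))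
        where
        p≤p+q : ∀ {p q} → 0ℚ ℚ.< q → p ℚ.≤ p + q
        p≤p+q {p} {q} 0<q = subst (ℚ._≤ p + q) (ℚₚ.+-identityʳ p) (ℚₚ.+-monoʳ-≤ p (ℚₚ.<⇒≤ 0<q))
        below-zero : ∀ {t x h} → t + (h + h) ℚ.≤ x → ℚ.∣ x ℚ.- zero# ∣ ℚ.< h → t + h ℚ.≤ zero#
        below-zero {t} {x} {h} t+2h≤x near = ℚₚ.<⇒≤ (<-by-difference _
          (ℚₚ.+-mono-≤-< (p≤q⇒0≤q-p t+2h≤x) (p<q⇒0<q-p (∣p-q∣<r⇒p<q+r x zero# near)))
          (solve 4 (λ x t z h → (x :- (t :+ (h :+ h))) :+ ((z :+ h) :- x) := z :- (t :+ h)) refl x t zero# h))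
        above-zero : ∀ {t x h} → x + (h + h) ℚ.≤ t → ℚ.∣ x ℚ.- zero# ∣ ℚ.< h → zero# + h ℚ.≤ t
        above-zero {t} {x} {h} x+2h≤t near = ℚₚ.<⇒≤ (<-by-difference _
          (ℚₚ.+-mono-≤-< (p≤q⇒0≤q-p x+2h≤t) (p<q⇒0<q-p (∣p-q∣<r⇒q<p+r x zero# near)))
          (solve 4 (λ x t z h → (t :- (x :+ (h :+ h))) :+ ((x :+ h) :- z) := t :- (z :+ h)) refl x t zero# h))
        growth : ∀ {h d u v} → h ℚ.≤ d → rate * d + u ℚ.≤ v → u + rate * h ℚ.≤ v
        growth {h} {d} {u} {v} h≤d ≤v = ≤-by-difference _
          (0≤p+q (0≤p*q (ℚₚ.<⇒≤ rate>0) (p≤q⇒0≤q-p h≤d)) (p≤q⇒0≤q-p ≤v))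
          (solve 5 (λ r h d u v → r :* (d :- h) :+ (v :- (r :* d :+ u)) := v :- (u :+ r :* h)) refl rate h d u v)

-- Locating common points of two piecewise linear functions

module _ (G h G′ h′ : ℕ → ℚ) (m : ℕ) (G≢G′ : ∀ j → j ℕ.≤ m → G j ≢ G′ j) where

  private
    f g : ℚ → ℚ
    f = piecewise G h m
    g = piecewise G′ h′ m
    f-uc : UniformlyContinuous f
    f-uc = Lipschitz⇒UniformlyContinuous (Lipschitz-piecewise G h m)
    g-uc : UniformlyContinuous g
    g-uc = Lipschitz⇒UniformlyContinuous (Lipschitz-piecewise G′ h′ m)

  module _ (x : ℝ) (meet : MeetAt {f} {g} x) where

    private
      ¬constant : ∀ {a b} → a ≢ b → ¬ Eventually (λ n → f (seq x n) ≡ a × g (seq x n) ≡ b)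
      ¬constant a≢b const = not-eventually-apart {f} {g} x meet (p≢q⇒0<∣p-q∣ a≢b)
        (Eventually-map (λ (fx≡a , gx≡b) → ℚₚ.≤-reflexive (cong₂ (λ a b → ℚ.∣ a ℚ.- b ∣)
                (sym fx≡a) (sym gx≡b))) const)

    -- The search moves right from gap to gap. Left of the first gap and right of the last one both
    -- functions are constant with different values, so it has to stop in between.
    meeting-unit : ∃ λ j → j ℕ.< m × Eventually (λ n → gap j ℚ.≤ seq x n × seq x n ℚ.≤ gap (suc j))
    meeting-unit = start (apart-from {f} {g} x f-uc g-uc meet
        (λ eq → G≢G′ 0 ℕ.z≤n (trans (sym (piecewise-gap G h {m = m} ℕ.z≤n)) (trans eq
                (piecewise-gap G′ h′ {m = m} ℕ.z≤n)))))
      where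
      search : ∀ d j → d ℕ.+ j ≡ m → Eventually (λ n → gap j ℚ.≤ seq x n) →
               ∃ λ j → j ℕ.< m × Eventually (λ n → gap j ℚ.≤ seq x n × seq x n ℚ.≤ gap (suc j))
      search zero    j refl right = ⊥-elim (¬constant (G≢G′ j ℕₚ.≤-refl)
        (Eventually-map (λ g≤x → piecewise-right G h m g≤x , piecewise-right G′ h′ m g≤x) right))
      search (suc d) j eq   right = step (apart-from {f} {g} x f-uc g-uc meet
          (λ eq → G≢G′ (suc j) j<m (trans (sym (piecewise-gap G h j<m)) (trans eq (piecewise-gap G′ h′ j<m)))))
        where
        j<m : j ℕ.< m
        j<m = subst (j ℕ.<_) eq (ℕ.s≤s (ℕₚ.m≤n+m j d))
        step : Eventually (λ n → seq x n ℚ.≤ gap (suc j)) ⊎ Eventually (λ n → gap (suc j) ℚ.≤ seq x n) → _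
        step (inj₁ left)   = j , j<m , Eventually-zip _,_ right left
        step (inj₂ right′) = search d (suc j) (trans (ℕₚ.+-suc d j) eq) right′

      start : Eventually (λ n → seq x n ℚ.≤ gap 0) ⊎ Eventually (λ n → gap 0 ℚ.≤ seq x n) → _
      start (inj₁ left)  = ⊥-elim (¬constant (G≢G′ 0 ℕ.z≤n)
        (Eventually-map (λ x≤g → piecewise-left G h {m = m} ℕ.z≤n x≤g , piecewise-left G′ h′ {m = m} ℕ.z≤n x≤g) left))
      start (inj₂ right) = search m 0 (ℕₚ.+-identityʳ m) right

_≟ₛ_ : DecidableEquality Sgn
[+] ≟ₛ [+] = yes refl
[+] ≟ₛ [0] = no λ ()
[+] ≟ₛ [-] = no λ ()
[0] ≟ₛ [+] = no λ ()
[0] ≟ₛ [0] = yes refl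
[0] ≟ₛ [-] = no λ ()
[-] ≟ₛ [+] = no λ ()
[-] ≟ₛ [0] = no λ ()
[-] ≟ₛ [-] = yes refl

-- Values of sign sequences

value turn keep : Sgn → ℚ
value [+] = 1ℚ
value [0] = 0ℚ
value [-] = ℚ.- 1ℚ

turn [+] = 1ℚ
turn [0] = ℚ.- 1ℚ
turn [-] = 1ℚ

keep [+] = 1ℚ
keep [0] = 0ℚ
keep [-] = 1ℚ

¼ : ℚ
¼ = ½ * ½

-- `step` gives heights at gaps: a zero negates the rest of the word, which reverses the order of
-- curves through the point. `middle` gives heights at points: a zero erases the rest, so that these
-- curves meet. For the other two signs both agree.
step middle : Sgn → ℚ → ℚ
step   s p = value s + ¼ * (turn s * p)
middle s p = value s + ¼ * (keep s * p)

-- Any b with 4/3 ≤ b < 2 would do: 1 + b/4 ≤ b makes the bound invariant under `step`, and 1 - b/2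
-- > 0 lets the greater leading sign dominate. In base 3 the two corresponding conditions contradict
-- each other.
bound : ℚ
bound = 1ℚ + ½

Small : ℚ → Set
Small p = ℚ.- bound ℚ.≤ p × p ℚ.≤ bound

Small-0 : Small 0ℚ
Small-0 = ℚₚ.≤ᵇ⇒≤ tt , ℚₚ.≤ᵇ⇒≤ tt

Small-neg : ∀ {p} → Small p → Small ((ℚ.- 1ℚ) * p)
Small-neg {p} (-b≤p , p≤b) =
  ≤-by-difference _ (p≤q⇒0≤q-p p≤b) (solve 2 (λ b p → b :- p := (:- con 1ℚ) :* p :- :- b) refl bound p) ,
  ≤-by-difference _ (p≤q⇒0≤q-p -b≤p) (solve 2 (λ b p → p :- :- b := b :- (:- con 1ℚ) :* p) refl bound p)

Small-id : ∀ {p} → Small p → Small (1ℚ * p)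
Small-id {p} = subst Small (sym (ℚₚ.*-identityˡ p))

Small-turn : ∀ s {p} → Small p → Small (turn s * p)
Small-turn [+] = Small-id
Small-turn [0] = Small-neg
Small-turn [-] = Small-id

Small-keep : ∀ s {p} → Small p → Small (keep s * p)
Small-keep [+]     = Small-id
Small-keep [0] {p} _ = subst Small (sym (ℚₚ.*-zeroˡ p)) Small-0
Small-keep [-]     = Small-id

Small-add : ∀ s {p} → Small p → Small (value s + ¼ * p)
Small-add s {p} (-b≤p , p≤b) =
    ≤-by-difference _ (0≤p+q (0≤p*q 0≤¼ (p≤q⇒0≤q-p -b≤p)) (lower s))
      (solve 3 (λ v b p → con ¼ :* (p :- :- b) :+ (b :+ v :- con ¼ :* b) :=
              (v :+ con ¼ :* p) :- :- b) refl (value s) bound p) ,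
    ≤-by-difference _ (0≤p+q (0≤p*q 0≤¼ (p≤q⇒0≤q-p p≤b)) (upper s))
      (solve 3 (λ v b p → con ¼ :* (b :- p) :+ (b :- v :- con ¼ :* b) := b :-
              (v :+ con ¼ :* p)) refl (value s) bound p)
  where
  0≤¼ : 0ℚ ℚ.≤ ¼
  0≤¼ = ℚₚ.≤ᵇ⇒≤ tt
  lower : ∀ s → 0ℚ ℚ.≤ bound + value s ℚ.- ¼ * bound
  lower [+] = ℚₚ.≤ᵇ⇒≤ tt
  lower [0] = ℚₚ.≤ᵇ⇒≤ tt
  lower [-] = ℚₚ.≤ᵇ⇒≤ tt
  upper : ∀ s → 0ℚ ℚ.≤ bound ℚ.- value s ℚ.- ¼ * bound
  upper [+] = ℚₚ.≤ᵇ⇒≤ tt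
  upper [0] = ℚₚ.≤ᵇ⇒≤ tt
  upper [-] = ℚₚ.≤ᵇ⇒≤ tt

Small-step : ∀ s {p} → Small p → Small (step s p)
Small-step s = Small-add s ∘ Small-turn s

data Greater : Sgn → Sgn → Set where
  +>0 : Greater [+] [0]
  +>- : Greater [+] [-]
  0>- : Greater [0] [-]

Greater⇒≢ : ∀ {s t} → Greater s t → s ≢ t
Greater⇒≢ +>0 ()
Greater⇒≢ +>- ()
Greater⇒≢ 0>- ()

data Compare : Sgn → Sgn → Set where
  zeros   : Compare [0] [0]
  equal   : ∀ {s} → s ≢ [0] → Compare s s
  greater : ∀ {s t} → Greater s t → Compare s t
  less    : ∀ {s t} → Greater t s → Compare s t

compareₛ : ∀ s t → Compare s t
compareₛ [+] [+] = equal λ ()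
compareₛ [+] [0] = greater +>0
compareₛ [+] [-] = greater +>-
compareₛ [0] [+] = less +>0
compareₛ [0] [0] = zeros
compareₛ [0] [-] = greater 0>-
compareₛ [-] [+] = less +>-
compareₛ [-] [0] = less 0>-
compareₛ [-] [-] = equal λ ()

dominates : ∀ {s t} → Greater s t → ∀ {p q} → Small p → Small q → value t + ¼ * q ℚ.< value s + ¼ * p
dominates {s} {t} s>t {p} {q} (-b≤p , _) (_ , q≤b) = <-by-difference _
  (ℚₚ.+-mono-<-≤ (leads s>t) (0≤p*q 0≤¼ (0≤p+q (p≤q⇒0≤q-p -b≤p) (p≤q⇒0≤q-p q≤b))))
  (solve 5 (λ v w b p q → (v :- w :- con ¼ :* (b :+ b)) :+ con ¼ :* ((p :- :- b) :+ (b :- q))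
    := (v :+ con ¼ :* p) :- (w :+ con ¼ :* q)) refl (value s) (value t) bound p q)
  where
  0≤¼ : 0ℚ ℚ.≤ ¼
  0≤¼ = ℚₚ.≤ᵇ⇒≤ tt
  leads : ∀ {s t} → Greater s t → 0ℚ ℚ.< value s ℚ.- value t ℚ.- ¼ * (bound + bound)
  leads +>0 = ℚₚ.positive⁻¹ _
  leads +>- = ℚₚ.positive⁻¹ _
  leads 0>- = ℚₚ.positive⁻¹ _

scale-< : ∀ v {c} → 0ℚ ℚ.< c → ∀ {p q} → p ℚ.< q → v + ¼ * (c * p) ℚ.< v + ¼ * (c * q)
scale-< v {c} 0<c {p} {q} p<q = <-by-difference _
  (0<p*q (0<p*q (ℚₚ.positive⁻¹ ¼) 0<c) (p<q⇒0<q-p p<q))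
  (solve 4 (λ v c p q → (con ¼ :* c) :* (q :- p) := (v :+ con ¼ :* (c :* q)) :- (v :+ con ¼ :*
          (c :* p))) refl v c p q)

step-nonzero : ∀ {s} → s ≢ [0] → ∀ {p q} → p ℚ.< q → step s p ℚ.< step s q
step-nonzero {[+]} _  = scale-< 1ℚ 0<1
step-nonzero {[0]} s≢ = contradiction refl s≢
step-nonzero {[-]} _  = scale-< (ℚ.- 1ℚ) 0<1

middle-nonzero : ∀ {s} → s ≢ [0] → ∀ {p q} → p ℚ.< q → middle s p ℚ.< middle s q
middle-nonzero {[+]} _  = scale-< 1ℚ 0<1
middle-nonzero {[0]} s≢ = contradiction refl s≢
middle-nonzero {[-]} _  = scale-< (ℚ.- 1ℚ) 0<1

step-zero : ∀ {p q} → p ℚ.< q → step [0] q ℚ.< step [0] p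
step-zero {p} {q} p<q = <-by-difference _
  (0<p*q (ℚₚ.positive⁻¹ ¼) (p<q⇒0<q-p p<q))
  (solve 2 (λ p q → con ¼ :* (q :- p) := (con 0ℚ :+ con ¼ :* ((:- con 1ℚ) :* p)) :-
          (con 0ℚ :+ con ¼ :* ((:- con 1ℚ) :* q))) refl p q)

-- Order of encoded words

order : ℚ → ℚ → Sgn
order p q with ℚₚ.<-cmp p q
... | tri< _ _ _ = [-]
... | tri≈ _ _ _ = [0]
... | tri> _ _ _ = [+]

data Order (p q : ℚ) : Sgn → Set where
  above : q ℚ.< p → Order p q [+]
  meets : p ≡ q → Order p q [0]
  below : p ℚ.< q → Order p q [-]

order-spec : ∀ p q → Order p q (order p q)
order-spec p q with ℚₚ.<-cmp p q
... | tri< p<q _ _ = below p<q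
... | tri≈ _ p≡q _ = meets p≡q
... | tri> _ _ q<p = above q<p

order-unique : ∀ {p q σ} → Order p q σ → order p q ≡ σ
order-unique {p} {q} ord with ℚₚ.<-cmp p q
order-unique (above q<p) | tri< p<q _ _ = contradiction p<q (ℚₚ.<-asym q<p)
order-unique (meets p≡q) | tri< p<q _ _ = contradiction p<q (ℚₚ.<-irrefl p≡q)
order-unique (below _)   | tri< _ _ _   = refl
order-unique (above q<p) | tri≈ _ p≡q _ = contradiction q<p (ℚₚ.<-irrefl (sym p≡q))
order-unique (meets _)   | tri≈ _ _ _   = refl
order-unique (below p<q) | tri≈ _ p≡q _ = contradiction p<q (ℚₚ.<-irrefl p≡q)
order-unique (above _)   | tri> _ _ _   = refl
order-unique (meets p≡q) | tri> _ _ q<p = contradiction q<p (ℚₚ.<-irrefl (sym p≡q))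
order-unique (below p<q) | tri> _ _ q<p = contradiction p<q (ℚₚ.<-asym q<p)

order-greater : ∀ {s t} → Greater s t → ∀ {p q} → Small p → Small q → order (step s p) (step t q) ≡ [+]
order-greater {s} {t} s>t sp sq = order-unique (above (dominates s>t (Small-turn s sp) (Small-turn t sq)))

order-less : ∀ {s t} → Greater t s → ∀ {p q} → Small p → Small q → order (step s p) (step t q) ≡ [-]
order-less {s} {t} t>s sp sq = order-unique (below (dominates t>s (Small-turn t sq) (Small-turn s sp)))

order-equal : ∀ {s} → s ≢ [0] → ∀ p q → order (step s p) (step s q) ≡ order p q
order-equal s≢0 p q with order p q | order-spec p q
... | _ | above q<p  = order-unique (above (step-nonzero s≢0 q<p))
... | _ | meets refl = order-unique (meets refl)
... | _ | below p<q  = order-unique (below (step-nonzero s≢0 p<q))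

order-zeros : ∀ p q → order (step [0] p) (step [0] q) ≡ -ₛ order p q
order-zeros p q with order p q | order-spec p q
... | _ | above q<p  = order-unique (below (step-zero q<p))
... | _ | meets refl = order-unique (meets refl)
... | _ | below p<q  = order-unique (above (step-zero p<q))

-- The order of two curves in the gap before unit j is decided by reading the signs
-- j - 1, j - 2, ..., 0 and then 0, 1, 2, ..., n - 1: the first difference decides,
-- and each common zero met on the way reverses the order.
module _ (n : ℕ) (s : ℕ → Sgn) where

  suffix-value : ℕ → ℕ → ℚ
  suffix-value zero    j = 0ℚ
  suffix-value (suc d) j = step (s j) (suffix-value d (suc j))

  gap-value mid-value : ℕ → ℚ
  gap-value zero    = suffix-value n 0
  gap-value (suc j) = step (s j) (gap-value j)
  mid-value j       = middle (s j) (gap-value j)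

  Small-suffix : ∀ d j → Small (suffix-value d j)
  Small-suffix zero    j = Small-0
  Small-suffix (suc d) j = Small-step (s j) (Small-suffix d (suc j))

  Small-gap : ∀ j → Small (gap-value j)
  Small-gap zero    = Small-suffix n 0
  Small-gap (suc j) = Small-step (s j) (Small-gap j)

module _ (n : ℕ) (s t : ℕ → Sgn) where

  gap-order : ℕ → Sgn
  gap-order j = order (gap-value n s j) (gap-value n t j)

  data Unit (j : ℕ) : Set where
    zeros   : s j ≡ [0] → t j ≡ [0] → gap-order (suc j) ≡ -ₛ gap-order j → Unit j
    equal   : s j ≡ t j → s j ≢ [0] → gap-order (suc j) ≡ gap-order j → Unit j
    greater : Greater (s j) (t j) → gap-order (suc j) ≡ [+] → Unit j
    less    : Greater (t j) (s j) → gap-order (suc j) ≡ [-] → Unit j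

  unit : ∀ j → Unit j
  unit j = go (compareₛ (s j) (t j)) refl refl
    where
    go : ∀ {a b} → Compare a b → s j ≡ a → t j ≡ b → Unit j
    go zeros         s≡ t≡ = zeros s≡ t≡
      (trans (cong₂ (λ a b → order (step a (gap-value n s j)) (step b (gap-value n t j))) s≡ t≡)
        (order-zeros (gap-value n s j) (gap-value n t j)))
    go (equal a≢0)   refl t≡ = equal (sym t≡) a≢0
      (trans (cong (λ b → order (step (s j) (gap-value n s j)) (step b (gap-value n t j))) t≡)
        (order-equal a≢0 (gap-value n s j) (gap-value n t j)))
    go (greater s>t) refl refl = greater s>t (order-greater s>t (Small-gap n s j) (Small-gap n t j))
    go (less t>s)    refl refl = less t>s (order-less t>s (Small-gap n s j) (Small-gap n t j))

  private
    suffix-order : ℕ → ℕ → Sgn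
    suffix-order d j = order (suffix-value n s d j) (suffix-value n t d j)

  order-tie : ∀ s → ∃ λ i → ∀ p q → order (step s p) (step s q) ≡ neg^ i (order p q)
  order-tie s with s ≟ₛ [0]
  ... | yes refl = 1 , order-zeros
  ... | no  s≢0  = 0 , order-equal s≢0

  -- Passing a common sign puts it in front of the backward reading, and it is met again on the way
  -- forward. A common zero therefore reverses the order twice.
  gap-order≡suffix-order : ∀ j d → j ℕ.+ d ≡ n → (∀ i → i ℕ.< j → s i ≡ t i) → gap-order j ≡ suffix-order d j
  gap-order≡suffix-order zero    d refl _     = refl
  gap-order≡suffix-order (suc j) d eq   agree = begin
    gap-order (suc j)                   ≡⟨ cong (λ σ → order (step (s j) (gap-value n s j))
            (step σ (gap-value n t j))) (agree j ℕₚ.≤-refl) ⟨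
    order (step (s j) _) (step (s j) _) ≡⟨ tie _ _ ⟩
    neg^ i (gap-order j)                ≡⟨ cong (neg^ i) ih ⟩
    neg^ i (suffix-order (suc d) j)     ≡⟨ cong (λ σ → neg^ i (order (suffix-value n s (suc d) j)
            (step σ (suffix-value n t d (suc j))))) (agree j ℕₚ.≤-refl) ⟨
    neg^ i (order (step (s j) _) (step (s j) _)) ≡⟨ cong (neg^ i) (tie _ _) ⟩
    neg^ i (neg^ i (suffix-order d (suc j))) ≡⟨ neg^-involutive i _ ⟩
    suffix-order d (suc j) ∎
    where
    open ≡-Reasoning
    i = proj₁ (order-tie (s j))
    tie = proj₂ (order-tie (s j))
    ih = gap-order≡suffix-order j (suc d) (trans (ℕₚ.+-suc j d) eq) (λ i i<j → agree i (ℕₚ.m<n⇒m<1+n i<j))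

  module FirstDifference {u} (u<n : u ℕ.< n) (agree : ∀ i → i ℕ.< u → s i ≡ t i) (differ : s u ≢ t u) where

    private
      d = proj₁ (ℕₚ.m≤n⇒∃[o]m+o≡n u<n)
      u+1+d≡n : u ℕ.+ suc d ≡ n
      u+1+d≡n = trans (ℕₚ.+-suc u d) (proj₂ (ℕₚ.m≤n⇒∃[o]m+o≡n u<n))

    -- Before `u` the forward reading, after `u` the backward reading arrives first at the two signs
    -- at `u`, and these differ.
    no-change : gap-order (suc u) ≡ gap-order u
    no-change = trans (decided (compareₛ (s u) (t u)))
        (sym (gap-order≡suffix-order u (suc d) u+1+d≡n agree))
      where
      decided : Compare (s u) (t u) → gap-order (suc u) ≡ suffix-order (suc d) u
      decided cmp with s u in su | t u in tu | cmp
      ... | _ | _ | zeros       = contradiction (trans su (sym tu)) differ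
      ... | _ | _ | equal _     = contradiction (trans su (sym tu)) differ
      ... | _ | _ | greater s>t = trans (order-greater s>t (Small-gap n s u) (Small-gap n t u))
              (sym (order-greater s>t (Small-suffix n s d (suc u)) (Small-suffix n t d (suc u))))
      ... | _ | _ | less t>s = trans (order-less t>s (Small-gap n s u) (Small-gap n t u))
              (sym (order-less t>s (Small-suffix n s d (suc u)) (Small-suffix n t d (suc u))))

    private
      at-u : gap-order u ≢ [0]
      at-u eq with unit u
      ... | zeros s≡0 t≡0 _ = differ (trans s≡0 (sym t≡0))
      ... | equal s≡t _ _   = differ s≡t
      ... | greater _ o≡    with () ← trans (sym o≡) (trans no-change eq)
      ... | less _ o≡       with () ← trans (sym o≡) (trans no-change eq)

      j<u : ∀ {d j} → suc d ℕ.+ j ≡ u → j ℕ.< u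
      j<u {d} {j} refl = ℕ.s≤s (ℕₚ.m≤n+m j d)

      backward : ∀ d j → d ℕ.+ j ≡ u → gap-order j ≢ [0]
      backward zero    j refl = at-u
      backward (suc d) j eq o≡0 with unit j
      ... | zeros _ _ o≡   = backward d (suc j) (trans (ℕₚ.+-suc d j) eq) (trans o≡ (cong -ₛ_ o≡0))
      ... | equal _ _ o≡   = backward d (suc j) (trans (ℕₚ.+-suc d j) eq) (trans o≡ o≡0)
      ... | greater s>t _ = Greater⇒≢ s>t (agree j (j<u eq))
      ... | less t>s _    = Greater⇒≢ t>s (sym (agree j (j<u eq)))

      forward : ∀ d → gap-order (d ℕ.+ u) ≢ [0]
      forward zero    = at-u
      forward (suc d) eq with unit (d ℕ.+ u)
      ... | zeros _ _ o≡ = forward d (-ₛ-injective {t = [0]} (trans (sym o≡) eq))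
      ... | equal _ _ o≡ = forward d (trans (sym o≡) eq)
      ... | greater _ o≡ with () ← trans (sym o≡) eq
      ... | less _ o≡    with () ← trans (sym o≡) eq

    -- Equal signs keep or negate the order, which carries nonvanishing from `u` in both directions.
    -- Different signs do not occur before `u`, and after it they force a nonzero order.
    gap-order≢0 : ∀ j → gap-order j ≢ [0]
    gap-order≢0 j with ℕₚ.≤-total j u
    ... | inj₁ j≤u = backward (u ℕ.∸ j) j (ℕₚ.m∸n+n≡m j≤u)
    ... | inj₂ u≤j = subst (λ j → gap-order j ≢ [0]) (ℕₚ.m∸n+n≡m u≤j) (forward (j ℕ.∸ u))

-- Enumerations of decidable subsets

Flips : ∀ {n} → Pred (Fin n) 0ℓ → (ℕ → Sgn) → Fin n → Set
Flips P o i = (P i → o (suc (toℕ i)) ≡ -ₛ o (toℕ i)) × (¬ P i → o (suc (toℕ i)) ≡ o (toℕ i))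

-- `total` and `parity` express the number of elements through a sign sequence that flips exactly at
-- them, so they can be proved by the recursion that builds the list. `total` is the case of
-- `parity` at zero, where all elements of the tail lie above.
record Enumeration {n} (P : Pred (Fin n) 0ℓ) : Set where
  field
    {size}   : ℕ
    elements : Vec (Fin n) size
    ascends  : Asc elements
    sound    : ∀ {x} → x ∈ elements → P x
    complete : ∀ {x} → P x → x ∈ elements
    total    : ∀ o → (∀ i → Flips P o i) → o n ≡ neg^ size (o 0)
    parity   : ∀ o t → (∀ i → t Fin.< i → Flips P o i) → o n ≡ neg^ (#above t elements) (o (suc (toℕ t)))

∈-map-suc⁻ : ∀ {n m} (v : Vec (Fin n) m) {x} → suc x ∈ Vec.map (Fin.suc {n}) v → x ∈ v
∈-map-suc⁻ (y ∷ v) (here refl) = here refl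
∈-map-suc⁻ (y ∷ v) (there x∈)  = there (∈-map-suc⁻ v x∈)

zero∉map-suc : ∀ {n m} (v : Vec (Fin n) m) → Fin.zero {n} ∉ Vec.map (Fin.suc {n}) v
zero∉map-suc (y ∷ v) (there 0∈) = zero∉map-suc v 0∈

zero<map-suc : ∀ {n m} (v : Vec (Fin n) m) → All (Fin.zero {n} Fin.<_) (Vec.map (Fin.suc {n}) v)
zero<map-suc []      = []
zero<map-suc (y ∷ v) = ℕ.s≤s ℕ.z≤n ∷ zero<map-suc v

Asc-map-suc : ∀ {n m} {v : Vec (Fin n) m} → Asc v → Asc (Vec.map (Fin.suc {n}) v)
Asc-map-suc []         = []
Asc-map-suc (x<v ∷ v↑) = raise x<v ∷ Asc-map-suc v↑
  where
  raise : ∀ {n m} {x : Fin n} {v : Vec (Fin n) m} → All (x Fin.<_) v → All (suc x Fin.<_) (Vec.map (Fin.suc {n}) v)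
  raise []          = []
  raise (x<y ∷ x<v) = ℕ.s≤s x<y ∷ raise x<v

#above-zero : ∀ {n m} (v : Vec (Fin n) m) → #above Fin.zero (Vec.map (Fin.suc {n}) v) ≡ m
#above-zero []      = refl
#above-zero {n} (y ∷ v) = cong₂ ℕ._+_ (indicator-yes (Fin.zero {n} Fin.<? suc y) (ℕ.s≤s ℕ.z≤n)) (#above-zero v)

#above-suc : ∀ {n m} t (v : Vec (Fin n) m) → #above (suc t) (Vec.map (Fin.suc {n}) v) ≡ #above t v
#above-suc t []      = refl
#above-suc t (y ∷ v) = cong₂ ℕ._+_ head (#above-suc t v)
  where
  head : indicator (suc t Fin.<? suc y) ≡ indicator (t Fin.<? y)
  head with t Fin.<? y
  ... | yes t<y = indicator-yes (suc t Fin.<? suc y) (ℕ.s≤s t<y)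
  ... | no  t≮y = indicator-no (suc t Fin.<? suc y) (t≮y ∘ ℕ.s≤s⁻¹)

enumerate : ∀ {n} {P : Pred (Fin n) 0ℓ} → Decidable P → Enumeration P
enumerate {zero} P? = record
  { elements = [] ; ascends = [] ; sound = λ () ; complete = λ { {()} }
  ; total = λ _ _ → refl ; parity = λ _ () }
enumerate {suc n} {P} P? with P? zero | enumerate (P? ∘ suc)
... | yes p0 | E = record
  { elements = zero ∷ Vec.map Fin.suc elements
  ; ascends  = zero<map-suc elements ∷ Asc-map-suc ascends
  ; sound    = λ { {zero} _ → p0 ; {suc x} (there x∈) → sound (∈-map-suc⁻ elements x∈) }
  ; complete = λ { {zero} _ → here refl ; {suc x} px → there (∈-map⁺ Fin.suc (complete px)) }
  ; total    = λ o flips → trans (total (o ∘ suc) (flips ∘ suc))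
                 (trans (cong (neg^ size) (proj₁ (flips zero) p0)) (neg^-neg size (o 0)))
  ; parity   = λ
    { o zero flips → trans (total (o ∘ suc) λ i → flips (suc i) (ℕ.s≤s ℕ.z≤n))
        (cong (λ i → neg^ i (o 1)) (sym (#above-zero elements)))
    ; o (suc t) flips → trans (parity (o ∘ suc) t λ i t<i → flips (suc i) (ℕ.s≤s t<i))
        (cong (λ i → neg^ i (o (suc (suc (toℕ t))))) (sym (#above-suc t elements))) }
  }
  where open Enumeration E
... | no ¬p0 | E = record
  { elements = Vec.map Fin.suc elements
  ; ascends  = Asc-map-suc ascends
  ; sound    = λ { {zero} 0∈ → contradiction 0∈ (zero∉map-suc elements)
                 ; {suc x} x∈ → sound (∈-map-suc⁻ elements x∈) }
  ; complete = λ { {zero} p0 → contradiction p0 ¬p0 ; {suc x} px → ∈-map⁺ Fin.suc (complete px) }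
  ; total    = λ o flips → trans (total (o ∘ suc) (flips ∘ suc)) (cong (neg^ size) (proj₂ (flips zero) ¬p0))
  ; parity   = λ
    { o zero flips → trans (total (o ∘ suc) λ i → flips (suc i) (ℕ.s≤s ℕ.z≤n))
        (cong (λ i → neg^ i (o 1)) (sym (#above-zero elements)))
    ; o (suc t) flips → trans (parity (o ∘ suc) t λ i t<i → flips (suc i) (ℕ.s≤s t<i))
        (cong (λ i → neg^ i (o (suc (suc (toℕ t))))) (sym (#above-suc t elements))) }
  }
  where open Enumeration E

-- Small entries are dropped, so the number of entries above a remaining one is unaffected. This is
-- why alternation is counted from the top.
greatest-elements : ∀ {n r} d (T : Vec (Fin n) (d ℕ.+ r)) → Asc T →
  ∃ λ (T′ : Vec (Fin n) r) → Asc T′ × (∀ {t} → t ∈ T′ → t ∈ T × #above t T′ ≡ #above t T)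
greatest-elements zero    T       T↑         = T , T↑ , λ t∈T → t∈T , refl
greatest-elements (suc d) (x ∷ T) (x<T ∷ T↑) =
  let T′ , T′↑ , incl = greatest-elements d T T↑ in
  T′ , T′↑ , λ {t} t∈T′ → let t∈T , eq = incl t∈T′ in there t∈T ,
    trans eq (cong (ℕ._+ #above t T) (sym (indicator-no (t Fin.<? x) (Finₚ.<-asym (All.lookup x<T t∈T)))))

-- Sides of the points with respect to the curves

ext : ∀ {n} → (Fin n → Sgn) → ℕ → Sgn
ext {zero}  s j       = [+]
ext {suc n} s zero    = s zero
ext {suc n} s (suc j) = ext (s ∘ suc) j

ext-toℕ : ∀ {n} (s : Fin n → Sgn) i → ext s (toℕ i) ≡ s i
ext-toℕ s zero    = refl
ext-toℕ s (suc i) = ext-toℕ (s ∘ suc) i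

Change : ∀ {n} → (ℕ → Sgn) → Fin n → Set
Change o i = o (suc (toℕ i)) ≢ o (toℕ i)

module _ {k n : ℕ} {χ : Vec (Fin n) (suc (suc k)) → Sgn} (χ-degree : IsDegreeUniform k χ) where

  open IsDegreeUniform χ-degree
  open IsChirotope isChirotope using (alternating)

  -- The side of the curve relative to the point t; χ records that of t relative to the curve.
  side : Vec (Fin n) (suc k) → Fin n → Sgn
  side Λ t = -ₛ χ (Λ ∷ʳ t)

  sides : Vec (Fin n) (suc k) → ℕ → Sgn
  sides Λ = ext (side Λ)

  χ-repeated : ∀ v i j → i ≢ j → lookup v i ≡ lookup v j → χ v ≡ [0]
  χ-repeated = Alternating-repeated≢ alternating

  side-∈ : ∀ {Λ t} → t ∈ Λ → side Λ t ≡ [0]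
  side-∈ {Λ} {t} t∈Λ = cong -ₛ_ (χ-repeated (Λ ∷ʳ t) (inject₁ (index t∈Λ)) (Fin.fromℕ (suc k))
      (λ eq → Finₚ.fromℕ≢inject₁ (sym eq))
      (trans (lookup-inject₁ Λ t (index t∈Λ)) (trans (sym (lookup-index t∈Λ)) (sym (lookup-fromℕ Λ t)))))
    where
    lookup-inject₁ : ∀ {A : Set} {m} (v : Vec A m) x i → lookup (v ∷ʳ x) (inject₁ i) ≡ lookup v i
    lookup-inject₁ (y ∷ v) x zero    = refl
    lookup-inject₁ (y ∷ v) x (suc i) = lookup-inject₁ v x i
    lookup-fromℕ : ∀ {A : Set} {m} (v : Vec A m) x → lookup (v ∷ʳ x) (Fin.fromℕ m) ≡ x
    lookup-fromℕ []      x = refl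
    lookup-fromℕ (y ∷ v) x = lookup-fromℕ v x

  side-∉ : ∀ {Λ t} → Asc Λ → t ∉ Λ → side Λ t ≢ [0]
  side-∉ {Λ} {t} Λ↑ t∉Λ eq = neg^-≢0 (#above t Λ) (χ≢0 χ-degree (Asc-insert t∉Λ Λ↑))
    (trans (sym (χ-∷ʳ χ-degree t Λ↑)) (-ₛ-injective {t = [0]} eq))

  side-0 : ∀ {Λ t} → Asc Λ → side Λ t ≡ [0] → t ∈ Λ
  side-0 {Λ} {t} Λ↑ eq = decidable-stable (t ∈? Λ) λ t∉Λ → side-∉ Λ↑ t∉Λ eq

  -- Changes of order between two curves

  module Pair {Λ M : Vec (Fin n) (suc k)} (Λ↑ : Asc Λ) (M↑ : Asc M) (Λ≢M : Λ ≢ M) where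

    o : ℕ → Sgn
    o = gap-order n (sides Λ) (sides M)

    first : ∃ λ u → side Λ u ≢ side M u × (∀ y → side Λ y ≢ side M y → u Fin.≤ y)
    first with least (λ x → ¬? (side Λ x ≟ₛ side M x))
    ... | inj₂ found = found
    ... | inj₁ none  = contradiction (Asc-⊆⇒≡ Λ M Λ↑ M↑ λ {x} x∈Λ → side-0 M↑
            (trans (sym (decidable-stable (side Λ x ≟ₛ side M x) (none x))) (side-∈ x∈Λ))) Λ≢M

    u : Fin n
    u = proj₁ first

    sides-agree : ∀ i → i ℕ.< toℕ u → sides Λ i ≡ sides M i
    sides-agree i i<u = subst (λ j → sides Λ j ≡ sides M j) (Finₚ.toℕ-fromℕ< i<n)
        (trans (ext-toℕ (side Λ) (Fin.fromℕ< i<n))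
        (trans (decidable-stable (side Λ _ ≟ₛ side M _) λ differ →
                 ℕₚ.<⇒≱ i<u (subst (toℕ u ℕ.≤_) (Finₚ.toℕ-fromℕ< i<n) (proj₂ (proj₂ first) _ differ)))
          (sym (ext-toℕ (side M) (Fin.fromℕ< i<n)))))
      where
      i<n : i ℕ.< n
      i<n = ℕₚ.<-trans i<u (Finₚ.toℕ<n u)

    sides-differ : sides Λ (toℕ u) ≢ sides M (toℕ u)
    sides-differ eq = proj₁ (proj₂ first) (trans (sym (ext-toℕ (side Λ) u)) (trans eq (ext-toℕ (side M) u)))

    open FirstDifference n (sides Λ) (sides M) (Finₚ.toℕ<n u) sides-agree sides-differ
      public using (gap-order≢0; no-change)

    -- `u` has to be added by hand, since the order does not change there.
    Selected : Pred (Fin n) 0ℓ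
    Selected t = Change o t ⊎ t ≡ u

    selected? : Decidable Selected
    selected? t = ¬? (o (suc (toℕ t)) ≟ₛ o (toℕ t)) ⊎-dec (t Fin.≟ u)

    open Enumeration (enumerate selected?)

    -- Beyond a point t with u ≤ t, being selected means a change of order, and a change between
    -- nonzero signs is a negation; `parity` counts these.
    final-order : ∀ {t} → u Fin.≤ t → o (suc (toℕ t)) ≡ neg^ (#above t elements) (o n)
    final-order {t} u≤t = trans (sym (neg^-involutive (#above t elements) _))
      (cong (neg^ (#above t elements)) (sym (parity o t λ i t<i →
        [ (λ change → ≢⇒≡- (gap-order≢0 (suc (toℕ i))) (gap-order≢0 (toℕ i)) change)
        , (λ { refl → contradiction t<i (ℕₚ.≤⇒≯ u≤t) }) ]′ ,
        λ ¬sel → decidable-stable (o (suc (toℕ i)) ≟ₛ o (toℕ i)) (¬sel ∘ inj₁))))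

    -- Only the crossings carry u ≤ t. A selected point before `u` is common to both curves, and
    -- there `AlternatesOn` has nothing to check.
    data Exchange (t : Fin n) : Set where
      common   : t ∈ Λ → t ∈ M → Exchange t
      crossing : u Fin.≤ t → Greater (side Λ t) (side M t) → o (suc (toℕ t)) ≡ [+] → Exchange t
      crossing⁻ : u Fin.≤ t → Greater (side M t) (side Λ t) → o (suc (toℕ t)) ≡ [-] → Exchange t

    exchange-at : ∀ {t} → Selected t → Exchange t
    exchange-at {t} sel with unit n (sides Λ) (sides M) (toℕ t)
    ... | zeros s≡0 t≡0 _ = common (side-0 Λ↑ (trans (sym (ext-toℕ _ t)) s≡0)) (side-0 M↑ (trans
            (sym (ext-toℕ _ t)) t≡0))
    ... | equal s≡t _ o≡  = contradiction sel λ
            { (inj₁ change) → change o≡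
            ; (inj₂ refl)   → sides-differ s≡t }
    ... | greater g o≡ = let g′ = subst₂ Greater (ext-toℕ (side Λ) t) (ext-toℕ (side M) t) g in
            crossing (proj₂ (proj₂ first) t (Greater⇒≢ g′)) g′ o≡
    ... | less g o≡ = let g′ = subst₂ Greater (ext-toℕ (side M) t) (ext-toℕ (side Λ) t) g in
            crossing⁻ (proj₂ (proj₂ first) t (Greater⇒≢ g′ ∘ sym)) g′ o≡

    Greater⇒+ : ∀ {s t} → Greater s t → s ≢ [0] → s ≡ [+]
    Greater⇒+ +>0 _   = refl
    Greater⇒+ +>- _   = refl
    Greater⇒+ 0>- s≢0 = contradiction refl s≢0

    Greater⇒- : ∀ {s t} → Greater s t → t ≢ [0] → t ≡ [-]
    Greater⇒- +>0 t≢0 = contradiction refl t≢0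
    Greater⇒- +>- _   = refl
    Greater⇒- 0>- _   = refl

    -- On the k + 2 greatest selected points both curves alternate weakly, with opposite patterns.
    -- They force the values `-ₛ o n` and `o n` on the same tuple, although `o n` is nonzero.
    few-selected : ∀ d → ¬ size ≡ d ℕ.+ suc (suc k)
    few-selected d size≡ = gap-order≢0 n (-ₛ-fixed (trans (sym signM) signΛ))
      where
      truncated : ∃ λ (T′ : Vec (Fin n) (suc (suc k))) →
                  Asc T′ × (∀ {t} → t ∈ T′ → t ∈ elements × #above t T′ ≡ #above t elements)
      truncated = go size≡ elements ascends
        where
        go : ∀ {m} → m ≡ d ℕ.+ suc (suc k) → (T : Vec (Fin n) m) → Asc T →
             ∃ λ (T′ : Vec (Fin n) (suc (suc k))) →
             Asc T′ × (∀ {t} → t ∈ T′ → t ∈ T × #above t T′ ≡ #above t T)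
        go refl = greatest-elements d
      T = proj₁ truncated
      T↑ = proj₁ (proj₂ truncated)
      inclusion = proj₂ (proj₂ truncated)

      order-at : ∀ {t} → t ∈ T → u Fin.≤ t → o (suc (toℕ t)) ≡ neg^ (#above t T) (o n)
      order-at {t} t∈T u≤t = trans (final-order u≤t) (cong (λ i → neg^ i (o n)) (sym (proj₂ (inclusion t∈T))))

      alternatesΛ : AlternatesOn χ-degree Λ↑ T (-ₛ o n)
      alternatesΛ {t} t∈T t∉Λ with exchange-at (sound (proj₁ (inclusion t∈T)))
      ... | common t∈Λ _ = contradiction t∈Λ t∉Λ
      ... | crossing u≤t g o≡ = trans (-ₛ-injective (trans (Greater⇒+ g (side-∉ Λ↑ t∉Λ)) (trans
              (sym o≡) (sym (-ₛ-involutive _)))))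
              (trans (cong -ₛ_ (order-at t∈T u≤t)) (sym (neg^-neg (#above t T) (o n))))
      ... | crossing⁻ u≤t g o≡ = trans (-ₛ-injective (trans (Greater⇒- g (side-∉ Λ↑ t∉Λ)) (trans
              (sym o≡) (sym (-ₛ-involutive _)))))
              (trans (cong -ₛ_ (order-at t∈T u≤t)) (sym (neg^-neg (#above t T) (o n))))

      alternatesM : AlternatesOn χ-degree M↑ T (o n)
      alternatesM {t} t∈T t∉M with exchange-at (sound (proj₁ (inclusion t∈T)))
      ... | common _ t∈M = contradiction t∈M t∉M
      ... | crossing u≤t g o≡ = trans (-ₛ-injective (trans (Greater⇒- g (side-∉ M↑ t∉M)) (cong -ₛ_
              (sym o≡)))) (order-at t∈T u≤t)
      ... | crossing⁻ u≤t g o≡ = trans (-ₛ-injective (trans (Greater⇒+ g (side-∉ M↑ t∉M))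
              (cong -ₛ_ (sym o≡)))) (order-at t∈T u≤t)

      signΛ : χ T ≡ -ₛ o n
      signΛ = alternating-sign χ-degree Λ↑ _ T↑ (neg^-≢0 1 (gap-order≢0 n)) refl alternatesΛ
      signM : χ T ≡ o n
      signM = alternating-sign χ-degree M↑ _ T↑ (gap-order≢0 n) refl alternatesM

    -- `u` occupies one of at most k + 1 places, and no change can share it because of `no-change`.
    -- So the k + 1 changes are left with at most k places.
    changes-collide : (q : Fin (suc k) → Fin n) → (∀ i → Change o (q i)) → ∃₂ λ i j → i ≢ j × q i ≡ q j
    changes-collide q change with size ℕ.≤? suc k
    ... | no  size≰ = contradiction (sym (ℕₚ.m∸n+n≡m (ℕₚ.≰⇒> size≰))) (few-selected _)
    ... | yes size≤ with Finₚ.pigeonhole (ℕ.s≤s size≤) position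
      where
      position : Fin (suc (suc k)) → Fin size
      position zero    = index (complete {u} (inj₂ refl))
      position (suc i) = index (complete {q i} (inj₁ (change i)))
    ... | zero  , suc j , _       , eq = contradiction
            (subst (Change o) (sym (trans (lookup-index (complete {u} (inj₂ refl)))
              (trans (cong (lookup elements) eq) (sym (lookup-index (complete {q j} (inj₁
                      (change j)))))))) (change j))
            λ change-u → change-u no-change
    ... | suc i , suc j , ℕ.s≤s i<j , eq = i , j , Finₚ.<⇒≢ i<j ,
            trans (lookup-index (complete {q i} (inj₁ (change i))))
              (trans (cong (lookup elements) eq) (sym (lookup-index (complete {q j} (inj₁ (change j))))))

-- Constant reals

fromℚ-<⁺ : ∀ {p q} → p ℚ.< q → fromℚ p < fromℚ q
fromℚ-<⁺ {p} {q} p<q = q ℚ.- p , p<q⇒0<q-p p<q , 0 , λ _ _ →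
  ℚₚ.≤-reflexive (solve 2 (λ p q → p :+ (q :- p) := q) refl p q)

fromℚ-<⁻ : ∀ {p q} → fromℚ p < fromℚ q → p ℚ.< q
fromℚ-<⁻ {p} {q} (ε , 0<ε , N , le) =
  ℚₚ.<-≤-trans (subst (ℚ._< p + ε) (ℚₚ.+-identityʳ p) (ℚₚ.+-monoʳ-< p 0<ε)) (le N ℕₚ.≤-refl)

fromℚ-≈⁻ : ∀ {p q} → fromℚ p ≈ fromℚ q → p ≡ q
fromℚ-≈⁻ {p} {q} p≈q = decidable-stable (p ℚₚ.≟ q) λ p≢q →
  ℚₚ.<-irrefl refl (Eventually-∃ (p≈q _ (p≢q⇒0<∣p-q∣ p≢q)))

fromℚ-≈⁺ : ∀ {p q} → p ≡ q → fromℚ p ≈ fromℚ q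
fromℚ-≈⁺ {p} refl = Setoid.refl ℝ-setoid {fromℚ p}

on-curve-unique : ∀ l p q → p ∈ᶜ l → q ∈ᶜ l → xcoord p ≈ xcoord q → p ≈ₚ q
on-curve-unique l p q p∈l q∈l x≈ = x≈ ,
  ℝ-≈.trans {ycoord p} {height l (xcoord p)} {ycoord q} p∈l
    (ℝ-≈.trans {height l (xcoord p)} {height l (xcoord q)} {ycoord q}
      (Func.cong (Curve.func l) {xcoord p} {xcoord q} x≈)
      (ℝ-≈.sym {ycoord q} {height l (xcoord q)} q∈l))
  where module ℝ-≈ = Setoid ℝ-setoid

-- The curve with prescribed sides

module _ (n : ℕ) (s : ℕ → Sgn) where

  profile : ℚ → ℚ
  profile = piecewise (gap-value n s) (mid-value n s) n

  profile-uc : UniformlyContinuous profile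
  profile-uc = Lipschitz⇒UniformlyContinuous (Lipschitz-piecewise _ _ n)

middle-order : ∀ s {p} → Small p → order (middle s p) 0ℚ ≡ s
middle-order [+]     sp = order-unique (above (dominates +>0 (Small-keep [+] sp) Small-0))
middle-order [0] {p} sp = order-unique (meets (solve 1 (λ p → con 0ℚ :+ con ¼ :* (con 0ℚ :* p) := con 0ℚ) refl p))
middle-order [-]     sp = order-unique (below (dominates 0>- Small-0 (Small-keep [-] sp)))

from-order : ∀ {p q σ} → order p q ≡ σ → Order p q σ
from-order {p} {q} refl = order-spec p q

-- Two curves over one unit

module _ (n : ℕ) (s t : ℕ → Sgn) {j} (j<n : j ℕ.< n) where

  private
    f g : ℚ → ℚ
    f = profile n s
    g = profile n t
    l r : ℚ
    l = gap j
    r = gap (suc j)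
    G H : ℕ → ℚ
    G = gap-value n s
    H = gap-value n t

  -- The heights at the point are ordered, at least weakly, as at the gap on its right. A change of
  -- order thus happens at the point or before it, and a single form of crossing covers all cases.
  settle : G j ≢ H j → mid-value n t j ℚ.≤ mid-value n s j →
           (H j ℚ.< G j → mid-value n t j ℚ.< mid-value n s j) → H (suc j) ℚ.< G (suc j) →
           Exceeds f g l r ⊎ (G j ℚ.< H j × Overtakes f g l r)
  settle G≢H mid≤ mid< next< with ℚₚ.<-cmp (G j) (H j)
  ... | tri< G<H _ _ = inj₂ (G<H , overtakes G (mid-value n s) H (mid-value n t) j<n
          (subst (G j ℚ.- H j ℚ.<_) (ℚₚ.+-inverseʳ (H j)) (ℚₚ.+-monoˡ-< (ℚ.- H j) G<H))
          (p≤q⇒0≤q-p mid≤) (p<q⇒0<q-p next<))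
  ... | tri≈ _ G≡H _ = contradiction G≡H G≢H
  ... | tri> _ _ H<G = inj₁ (exceeds G (mid-value n s) H (mid-value n t) j<n
          (p<q⇒0<q-p H<G) (p<q⇒0<q-p (mid< H<G)) (p<q⇒0<q-p next<))

data Shape (n : ℕ) (s t : ℕ → Sgn) (j : ℕ) : Set where
  apart  : Exceeds (profile n s) (profile n t) (gap j) (gap (suc j)) → Shape n s t j
  apart⁻ : Exceeds (profile n t) (profile n s) (gap j) (gap (suc j)) → Shape n s t j
  cross  : gap-order n s t (suc j) ≢ gap-order n s t j →
           Overtakes (profile n s) (profile n t) (gap j) (gap (suc j)) → Shape n s t j
  cross⁻ : gap-order n s t (suc j) ≢ gap-order n s t j →
           Overtakes (profile n t) (profile n s) (gap j) (gap (suc j)) → Shape n s t j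

module _ (n : ℕ) (s t : ℕ → Sgn) {j} (j<n : j ℕ.< n) (o≢0 : gap-order n s t j ≢ [0]) where

  private
    G≢H : gap-value n s j ≢ gap-value n t j
    G≢H eq = o≢0 (order-unique (meets eq))

    upward : mid-value n t j ℚ.≤ mid-value n s j →
             (gap-value n t j ℚ.< gap-value n s j → mid-value n t j ℚ.< mid-value n s j) →
             gap-value n t (suc j) ℚ.< gap-value n s (suc j) → Shape n s t j
    upward mid≤ mid< next< with settle n s t j<n G≢H mid≤ mid< next<
    ... | inj₁ ex         = apart ex
    ... | inj₂ (G<H , ov) = cross change ov
      where
      change : gap-order n s t (suc j) ≢ gap-order n s t j
      change eq with () ← trans (sym (order-unique (above next<))) (trans eq (order-unique (below G<H)))

    downward : mid-value n s j ℚ.≤ mid-value n t j →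
               (gap-value n s j ℚ.< gap-value n t j → mid-value n s j ℚ.< mid-value n t j) →
               gap-value n s (suc j) ℚ.< gap-value n t (suc j) → Shape n s t j
    downward mid≤ mid< next< with settle n t s j<n (G≢H ∘ sym) mid≤ mid< next<
    ... | inj₁ ex         = apart⁻ ex
    ... | inj₂ (H<G , ov) = cross⁻ change ov
      where
      change : gap-order n s t (suc j) ≢ gap-order n s t j
      change eq with () ← trans (sym (order-unique (below next<))) (trans eq (order-unique (above H<G)))

    mid-zero : ∀ s → s j ≡ [0] → mid-value n s j ≡ 0ℚ
    mid-zero s s≡0 with from-order (trans (middle-order (s j) (Small-gap n s j)) s≡0)
    ... | meets eq = eq

  shape : Shape n s t j
  shape with unit n s t j
  ... | greater s>t o≡ with above next< ← from-order o≡ = upward (ℚₚ.<⇒≤ mid<) (λ _ → mid<) next<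
    where mid< = dominates s>t (Small-keep (s j) (Small-gap n s j)) (Small-keep (t j) (Small-gap n t j))
  ... | less t>s o≡ with below next< ← from-order o≡ = downward (ℚₚ.<⇒≤ mid<) (λ _ → mid<) next<
    where mid< = dominates t>s (Small-keep (t j) (Small-gap n t j)) (Small-keep (s j) (Small-gap n s j))
  ... | equal s≡t s≢0 o≡ = go (from-order {σ = gap-order n s t j} refl) (from-order o≡)
    where
    rewrite-t : ∀ {P : Sgn → Set} → P (s j) → P (t j)
    rewrite-t {P} = subst P s≡t
    go : ∀ {σ} → Order (gap-value n s j) (gap-value n t j) σ →
         Order (gap-value n s (suc j)) (gap-value n t (suc j)) σ → Shape n s t j
    go (above H<G) (above next<) = upward (ℚₚ.<⇒≤ mid<) (λ _ → mid<) next<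
      where mid< = rewrite-t {λ τ → middle τ (gap-value n t j) ℚ.< mid-value n s j} (middle-nonzero s≢0 H<G)
    go (meets eq)  _             = contradiction eq G≢H
    go (below G<H) (below next<) = downward (ℚₚ.<⇒≤ mid<) (λ _ → mid<) next<
      where mid< = rewrite-t {λ τ → mid-value n s j ℚ.< middle τ (gap-value n t j)} (middle-nonzero s≢0 G<H)
  -- Both curves pass through the point, so the middle heights are equal and the reversal in the
  -- next gap makes this point the crossing.
  ... | zeros s≡0 t≡0 o≡ = go (from-order {σ = gap-order n s t j} refl) (from-order o≡)
    where
    mid≡ : mid-value n s j ≡ mid-value n t j
    mid≡ = trans (mid-zero s s≡0) (sym (mid-zero t t≡0))
    go : ∀ {σ} → Order (gap-value n s j) (gap-value n t j) σ →
         Order (gap-value n s (suc j)) (gap-value n t (suc j)) (-ₛ σ) → Shape n s t j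
    go (above H<G) (below next<) = downward (ℚₚ.≤-reflexive mid≡) (λ G<H → contradiction G<H (ℚₚ.<-asym H<G)) next<
    go (meets eq)  _             = contradiction eq G≢H
    go (below G<H) (above next<) = upward (ℚₚ.≤-reflexive (sym mid≡)) (λ H<G → contradiction H<G
            (ℚₚ.<-asym G<H)) next<

-- The pseudoconfiguration of a degree-k uniform oriented matroid

module _ {k n : ℕ} {χ : Vec (Fin n) (suc (suc k)) → Sgn} (χ-degree : IsDegreeUniform k χ) where

  open IsDegreeUniform χ-degree
  open IsChirotope isChirotope using (alternating)

  private
    module ℝ-≈ = Setoid ℝ-setoid

  curve : Vec (Fin n) (suc k) → Curve
  curve Λ = graph (profile-uc n (sides χ-degree Λ))

  vertex : Fin n → Point
  vertex i = fromℚ (mid (toℕ i)) ,ₚ 0ℝ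

  height-at : Vec (Fin n) (suc k) → Fin n → ℚ
  height-at Λ i = profile n (sides χ-degree Λ) (mid (toℕ i))

  height-order : ∀ Λ i → order (height-at Λ i) 0ℚ ≡ side χ-degree Λ i
  height-order Λ i = trans (cong (λ h → order h 0ℚ) (piecewise-mid (gap-value n
          (sides χ-degree Λ)) (mid-value n (sides χ-degree Λ)) (Finₚ.toℕ<n i)))
    (trans (middle-order (sides χ-degree Λ (toℕ i)) (Small-gap n (sides χ-degree Λ) (toℕ i)))
      (ext-toℕ (side χ-degree Λ) i))

  height-zero : ∀ {Λ i} → i ∈ Λ → 0ℚ ≡ height-at Λ i
  height-zero {Λ} {i} i∈Λ = meeting (from-order (trans (height-order Λ i) (side-∈ χ-degree i∈Λ)))
    where
    meeting : ∀ {p q} → Order p q [0] → q ≡ p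
    meeting (meets eq) = sym eq

  vertex-on⁺ : ∀ {Λ i} → i ∈ Λ → vertex i ∈ᶜ curve Λ
  vertex-on⁺ {Λ} {i} i∈Λ = fromℚ-≈⁺ (height-zero i∈Λ)

  vertex-on⁻ : ∀ {Λ i} → Asc Λ → vertex i ∈ᶜ curve Λ → i ∈ Λ
  vertex-on⁻ {Λ} {i} Λ↑ on = side-0 χ-degree Λ↑
    (trans (sym (height-order Λ i)) (order-unique (meets (sym (fromℚ-≈⁻ on)))))

  Curves : Pred Curve 0ℓ
  Curves l = ∃ λ Λ → Increasing Λ × l ≡ curve Λ

  curve-through : ∀ {v Λ} → Increasing v → Increasing Λ →
                  All (λ i → vertex i ∈ᶜ curve Λ) v → v ≡ Λ
  curve-through v↑ Λ↑ on = Asc-⊆⇒≡ _ _ (Increasing⇒Asc v↑) (Increasing⇒Asc Λ↑)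
    λ i∈v → vertex-on⁻ (Increasing⇒Asc Λ↑) (All.lookup on i∈v)

  module _ {Λ M : Vec (Fin n) (suc k)} (Λ↑ : Asc Λ) (M↑ : Asc M) (Λ≢M : Λ ≢ M) where

    open Pair χ-degree Λ↑ M↑ Λ≢M using (o; gap-order≢0; changes-collide)

    private
      s t : ℕ → Sgn
      s = sides χ-degree Λ
      t = sides χ-degree M

    Common : ℝ → Set
    Common x = height (curve Λ) x ≈ height (curve M) x

    InUnit : ℝ → ℕ → Set
    InUnit x j = Eventually λ n → gap j ℚ.≤ seq x n × seq x n ℚ.≤ gap (suc j)

    swap-Common : ∀ x → Common x → height (curve M) x ≈ height (curve Λ) x
    swap-Common x = ℝ-≈.sym {height (curve Λ) x} {height (curve M) x}

    opaque
      locate : ∀ {x} → Common x → ∃ λ (i : Fin n) → InUnit x (toℕ i)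
      locate {x} common =
        let j , j<n , in-unit = meeting-unit (gap-value n s) (mid-value n s) (gap-value n t) (mid-value n t) n
                                  (λ j _ eq → gap-order≢0 j (order-unique (meets eq))) x common
        in Fin.fromℕ< j<n , subst (InUnit x) (sym (Finₚ.toℕ-fromℕ< j<n)) in-unit

    shape-at : ∀ i → Shape n s t (toℕ i)
    shape-at i = shape n s t (Finₚ.toℕ<n i) (gap-order≢0 (toℕ i))

    unit-changes : ∀ {x} → Common x → ∀ i → InUnit x (toℕ i) → Change o i
    unit-changes {x} common i in-unit with shape-at i
    ... | apart  ex       = contradiction ex (¬Exceeds x common in-unit)
    ... | apart⁻ ex       = contradiction ex (¬Exceeds x (swap-Common x common) in-unit)
    ... | cross  change _ = change
    ... | cross⁻ change _ = change

    -- Both reals equal the one rational zero of the crossing in this unit.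
    common-unique : ∀ {x y} → Common x → Common y → ∀ i → InUnit x (toℕ i) → InUnit y (toℕ i) → x ≈ y
    common-unique {x} {y} cx cy i ix iy with shape-at i
    ... | apart  ex   = contradiction ex (¬Exceeds x cx ix)
    ... | apart⁻ ex   = contradiction ex (¬Exceeds x (swap-Common x cx) ix)
    ... | cross  _ ov = ℝ-≈.trans {x} {fromℚ (Overtakes.zero# ov)} {y} (meet-at-zero x cx ix ov)
                          (ℝ-≈.sym {y} {fromℚ (Overtakes.zero# ov)} (meet-at-zero y cy iy ov))
    ... | cross⁻ _ ov = ℝ-≈.trans {x} {fromℚ (Overtakes.zero# ov)} {y} (meet-at-zero x (swap-Common x cx) ix ov)
                          (ℝ-≈.sym {y} {fromℚ (Overtakes.zero# ov)} (meet-at-zero y (swap-Common y cy) iy ov))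

    transversal-in : ∀ {x} → Common x → ∀ (i : Fin n) → InUnit x (toℕ i) → Shape n s t (toℕ i) →
                     TransversalAt x (curve Λ) (curve M)
    transversal-in {x} common i in-unit (apart  ex)   = contradiction ex (¬Exceeds x common in-unit)
    transversal-in {x} common i in-unit (apart⁻ ex)   = contradiction ex (¬Exceeds x (swap-Common x common) in-unit)
    transversal-in {x} common i in-unit (cross  _ ov) =
      fromℚ (gap (toℕ i)) , fromℚ (gap (suc (toℕ i))) , l<x x common in-unit ov , x<r x common in-unit ov ,
      inj₁ (crosses-up x common in-unit ov (profile-uc n s) (profile-uc n t))
    transversal-in {x} common i in-unit (cross⁻ _ ov) =
      fromℚ (gap (toℕ i)) , fromℚ (gap (suc (toℕ i))) , l<x x common′ in-unit ov , x<r x common′ in-unit ov ,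
      inj₂ (crosses-up x common′ in-unit ov (profile-uc n t) (profile-uc n s))
      where common′ = swap-Common x common

    transversal : ∀ {x} → Common x → TransversalAt x (curve Λ) (curve M)
    transversal {x} common = let i , in-unit = locate {x} common in
      transversal-in {x} common i in-unit (shape-at i)

    on-both : ∀ p → p ∈ᶜ curve Λ → p ∈ᶜ curve M → Common (xcoord p)
    on-both p onΛ onM = ℝ-≈.trans {height (curve Λ) (xcoord p)} {ycoord p} {height (curve M) (xcoord p)}
      (ℝ-≈.sym {ycoord p} {height (curve Λ) (xcoord p)} onΛ) onM

    -- Each common point sits in a unit where the order changes, and k + 1 such units cannot be
    -- distinct. Two common points in one unit have the same x-coordinate, hence coincide.
    meet-at-most : MeetAtMost k (curve Λ) (curve M)
    meet-at-most q on distinct = collide (changes-collide unit-at λ i →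
        unit-changes {xcoord (q i)} (common i) (unit-at i) (proj₂ (unit-of i)))
      where
      common : ∀ i → Common (xcoord (q i))
      common i = on-both (q i) (proj₁ (on i)) (proj₂ (on i))
      unit-of : ∀ i → ∃ λ (j : Fin n) → InUnit (xcoord (q i)) (toℕ j)
      unit-of i = locate {xcoord (q i)} (common i)
      unit-at : Fin (suc k) → Fin n
      unit-at i = proj₁ (unit-of i)
      collide : ¬ ∃₂ λ i j → i ≢ j × unit-at i ≡ unit-at j
      collide (i , j , i≢j , same) = distinct i j i≢j (on-curve-unique (curve Λ) (q i) (q j)
              (proj₁ (on i)) (proj₁ (on j))
        (common-unique {xcoord (q i)} {xcoord (q j)} (common i) (common j) (unit-at j)
          (subst (λ l → InUnit (xcoord (q i)) (toℕ l)) same (proj₂ (unit-of i))) (proj₂ (unit-of j))))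

  configuration : PseudoConfiguration k n
  configuration = record
    { point        = vertex
    ; L            = Curves
    ; x-increasing = λ i j i<j → fromℚ-<⁺ (ℚₚ.<-≤-trans (mid<gap (toℕ i)) (ℚₚ.≤-trans
            (gap-mono i<j) (gap≤mid (toℕ j))))
    ; pp1          = λ { _ (Λ , Λ↑ , refl) → Λ , Λ↑ , All-∈ vertex-on⁺ }
    ; pp2          = λ v v↑ → curve v , ((v , v↑ , refl) , All-∈ vertex-on⁺) ,
        λ { _ (Λ , Λ↑ , refl) through x →
            subst (λ w → height (curve Λ) x ≈ height (curve w) x) (sym (curve-through v↑ Λ↑ through))
              (ℝ-≈.refl {height (curve Λ) x}) }
    ; pp3          = λ { _ _ (Λ , Λ↑ , refl) (M , M↑ , refl) distinct →
        let Λ≢M = λ Λ≡M → distinct λ x → subst (λ w → height (curve Λ) x ≈ height (curve w) x) Λ≡M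
                                             (ℝ-≈.refl {height (curve Λ) x}) in
        meet-at-most (Increasing⇒Asc Λ↑) (Increasing⇒Asc M↑) Λ≢M ,
        λ p onΛ onM → transversal (Increasing⇒Asc Λ↑) (Increasing⇒Asc M↑) Λ≢M {xcoord p}
                        (on-both (Increasing⇒Asc Λ↑) (Increasing⇒Asc M↑) Λ≢M p onΛ onM) }
    }
    where
    mid<gap : ∀ j → mid j ℚ.< gap (suc j)
    mid<gap j = <-by-difference 1ℚ 0<1 (solve 1 (λ m → con 1ℚ := (m :+ con 1ℚ) :- m) refl (mid j))

  general-position : GeneralPosition configuration
  general-position _ (Λ , Λ↑ , refl) = Λ , Λ↑ , λ i → mk⇔ (vertex-on⁻ (Increasing⇒Asc Λ↑)) vertex-on⁺

  -- The point has height 0, so it is above the curve when the curve is negative there; the sign in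
  -- the definition of `side` undoes this reversal.
  vertex-above : ∀ {Λ i} → vertex i ∈⁺ curve Λ ⇔ χ (Λ ∷ʳ i) ≡ [+]
  vertex-above {Λ} {i} = mk⇔
    (λ lt → -ₛ-injective (trans (sym (height-order Λ i)) (order-unique (below (fromℚ-<⁻ lt)))))
    (λ χ≡ → negative (from-order (trans (height-order Λ i) (cong -ₛ_ χ≡))))
    where
    negative : Order (height-at Λ i) 0ℚ [-] → vertex i ∈⁺ curve Λ
    negative (below lt) = fromℚ-<⁺ lt

  vertex-below : ∀ {Λ i} → vertex i ∈⁻ curve Λ ⇔ χ (Λ ∷ʳ i) ≡ [-]
  vertex-below {Λ} {i} = mk⇔
    (λ lt → -ₛ-injective (trans (sym (height-order Λ i)) (order-unique (above (fromℚ-<⁻ lt)))))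
    (λ χ≡ → positive (from-order (trans (height-order Λ i) (cong -ₛ_ χ≡))))
    where
    positive : Order (height-at Λ i) 0ℚ [+] → vertex i ∈⁻ curve Λ
    positive (above lt) = fromℚ-<⁺ lt

  χ-of-configuration : IsχOf configuration χ
  χ-of-configuration = record
    { above = λ { v v↑ j _ _ (Λ , Λ↑ , refl) through →
        subst (λ w → vertex j ∈⁺ curve Λ ⇔ χ (w ∷ʳ j) ≡ [+]) (sym (curve-through v↑ Λ↑ through)) vertex-above }
    ; below = λ { v v↑ j _ _ (Λ , Λ↑ , refl) through →
        subst (λ w → vertex j ∈⁻ curve Λ ⇔ χ (w ∷ʳ j) ≡ [-]) (sym (curve-through v↑ Λ↑ through)) vertex-below }
    ; repeated    = χ-repeated χ-degree
    ; alternating = alternating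
    }

theorem4p8 : ∀ (k n : ℕ) → 1 ≤ k → 1 ≤ n →
    (χ : Vec (Fin n) (suc (suc k)) → Sgn) → IsDegreeUniform k χ →
    Σ (PseudoConfiguration k n) λ PP →
    GeneralPosition PP ×
    (∃ λ (χPP : Vec (Fin n) (suc (suc k)) → Sgn) →
    IsχOf PP χPP × (± χ ≐ ± χPP))
theorem4p8 k n _ _ χ χ-degree =
  -- `χ` itself satisfies the specification of the map of the configuration, so the two sign classes
  -- are literally the same.
  configuration χ-degree , general-position χ-degree , χ , χ-of-configuration χ-degree , id , id
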